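{- Let $k\geq 4$ and let $\alpha>0$ be sufficiently small. There exist infinitely many integers $N\geq 1$ and sets $A\subseteq \{1,2,\dots,N\}$ with $|A|\geq \alpha N$ such that $A$ contains no more than \[\exp\bigl(-c\log^2(2/\alpha)\bigr)N^{k-1}\] solutions $(x_1,\dots,x_k)\in A^k$ to the equation $x_1+\cdots+x_{k-1}=(k-1)x_k$, where $c>0$ is a constant. -}

module Defs where

open import Algebra.Definitions.RawSemiring as RawSemiring using ()
open import Data.Fin.Base using (Fin; toℕ)
open import Data.Fin.Subset using (Subset)
open import Data.Fin.Subset.Properties using (_∈?_)
open import Data.Integer.Base as ℤ using (ℤ) hiding (module ℤ)
import Data.Integer.Properties as ℤₚ
open import Data.List.Base using (List; []; _∷_; map; filter; length; allFin; cartesianProduct; cartesianProductWith)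
open import Data.Nat.Base as ℕ using (ℕ; zero; suc; _!) hiding (module ℕ)
import Data.Nat.Properties as ℕₚ
open import Data.Product using (Σ; ∃; _×_; _,_; proj₁; proj₂; Σ-syntax; ∃-syntax)
open import Data.Rational.Base as ℚ using (ℚ; 0ℚ; 1ℚ; ½; ∣_∣; 1/_; _⊔_) hiding (module ℚ)
import Data.Rational.Properties as ℚₚ
open import Data.Rational.Solver using (module +-*-Solver)
import Data.Rational.Unnormalised.Base as ℚᵘ
import Data.Rational.Unnormalised.Properties as ℚᵘₚ
open import Data.Sum.Base using (_⊎_; inj₁; inj₂)
open import Data.Vec.Base as Vec using (Vec; []; _∷_)
open import Relation.Binary.PropositionalEquality

open RawSemiring ℚ.+-*-rawSemiring using (_^_)

fromℕ : ℕ → ℚ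
fromℕ n = ℤ.+ n ℚ./ 1

sumTo : ℕ → (ℕ → ℚ) → ℚ
sumTo zero    f = 0ℚ
sumTo (suc n) f = sumTo n f ℚ.+ f n

module Rational where
  open ℚ hiding (_/_)
  open ℚₚ
  open +-*-Solver using (solve; _:+_; _:*_; _:-_; :-_; con; _:=_)
  open ≤-Reasoning

  private
    toℚᵘ-fromℕ : ∀ n → toℚᵘ (fromℕ n) ℚᵘ.≃ ℚᵘ.mkℚᵘ (ℤ.+ n) 0
    toℚᵘ-fromℕ n = toℚᵘ-fromℚᵘ (ℚᵘ.mkℚᵘ (ℤ.+ n) 0)

  fromℕ-mono : ∀ {m n} → m ℕ.≤ n → fromℕ m ≤ fromℕ n
  fromℕ-mono {m} {n} m≤n = toℚᵘ-cancel-≤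
    (ℚᵘₚ.≤-trans (ℚᵘₚ.≤-reflexive (toℚᵘ-fromℕ m))
    (ℚᵘₚ.≤-trans (ℚᵘ.*≤* (ℤ-lem m≤n))
                 (ℚᵘₚ.≤-reflexive (ℚᵘₚ.≃-sym (toℚᵘ-fromℕ n)))))
    where
    ℤ-lem : ∀ {m n} → m ℕ.≤ n → (ℤ.+ m) ℤ.* (ℤ.+ 1) ℤ.≤ (ℤ.+ n) ℤ.* (ℤ.+ 1)
    ℤ-lem {m} {n} p = subst₂ ℤ._≤_ (sym (ℤₚ.*-identityʳ (ℤ.+ m))) (sym (ℤₚ.*-identityʳ (ℤ.+ n))) (ℤ.+≤+ p)

  fromℕ-+ : ∀ m n → fromℕ (m ℕ.+ n) ≡ fromℕ m + fromℕ n
  fromℕ-+ m n = toℚᵘ-injective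
    (ℚᵘₚ.≃-trans (toℚᵘ-fromℕ (m ℕ.+ n))
    (ℚᵘₚ.≃-trans (ℚᵘ.*≡* lem)
    (ℚᵘₚ.≃-trans (ℚᵘₚ.≃-sym (ℚᵘₚ.+-cong (toℚᵘ-fromℕ m) (toℚᵘ-fromℕ n)))
                 (ℚᵘₚ.≃-sym (toℚᵘ-homo-+ (fromℕ m) (fromℕ n))))))
    where
    lem : (ℤ.+ (m ℕ.+ n)) ℤ.* (ℤ.+ 1) ≡ ((ℤ.+ m) ℤ.* (ℤ.+ 1) ℤ.+ (ℤ.+ n) ℤ.* (ℤ.+ 1)) ℤ.* (ℤ.+ 1)
    lem = cong (ℤ._* (ℤ.+ 1)) (sym (cong₂ ℤ._+_ (ℤₚ.*-identityʳ (ℤ.+ m)) (ℤₚ.*-identityʳ (ℤ.+ n))))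

  fromℕ-* : ∀ m n → fromℕ (m ℕ.* n) ≡ fromℕ m * fromℕ n
  fromℕ-* zero    n = sym (*-zeroˡ (fromℕ n))
  fromℕ-* (suc m) n = begin-equality
    fromℕ (n ℕ.+ m ℕ.* n)             ≡⟨ fromℕ-+ n (m ℕ.* n) ⟩
    fromℕ n + fromℕ (m ℕ.* n)         ≡⟨ cong (fromℕ n +_) (fromℕ-* m n) ⟩
    fromℕ n + fromℕ m * fromℕ n       ≡⟨ solve 2 (λ a b → b :+ a :* b := (con 1ℚ :+ a) :* b) refl (fromℕ m) (fromℕ n) ⟩
    (1ℚ + fromℕ m) * fromℕ n          ≡⟨ cong (_* fromℕ n) (fromℕ-+ 1 m) ⟨
    fromℕ (suc m) * fromℕ n           ∎

  fromℕ-^ : ∀ m n → fromℕ (m ℕ.^ n) ≡ fromℕ m ^ n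
  fromℕ-^ m zero    = refl
  fromℕ-^ m (suc n) = trans (fromℕ-* m (m ℕ.^ n)) (cong (fromℕ m *_) (fromℕ-^ m n))

  0≤fromℕ : ∀ n → 0ℚ ≤ fromℕ n
  0≤fromℕ n = fromℕ-mono {0} {n} ℕ.z≤n

  0<1 : 0ℚ < 1ℚ
  0<1 = positive⁻¹ 1ℚ

  0<½ : 0ℚ < ½
  0<½ = positive⁻¹ ½

  0<fromℕ-suc : ∀ n → 0ℚ < fromℕ (suc n)
  0<fromℕ-suc n = <-≤-trans 0<1 (fromℕ-mono {1} {suc n} (ℕ.s≤s ℕ.z≤n))

  archimedean : ∀ q → ∃[ n ] q ≤ fromℕ n
  archimedean q@(mkℚ (ℤ.+ n) d _) = n , toℚᵘ-cancel-≤
    (ℚᵘₚ.≤-trans (ℚᵘ.*≤* n*1≤n*d) (ℚᵘₚ.≤-reflexive (ℚᵘₚ.≃-sym (toℚᵘ-fromℕ n))))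
    where
    n*1≤n*d : (ℤ.+ n) ℤ.* (ℤ.+ 1) ℤ.≤ (ℤ.+ n) ℤ.* (ℤ.+ suc d)
    n*1≤n*d = subst₂ ℤ._≤_ (ℤₚ.pos-* n 1) (ℤₚ.pos-* n (suc d)) (ℤ.+≤+ (ℕₚ.*-monoʳ-≤ n {1} {suc d} (ℕ.s≤s ℕ.z≤n)))
  archimedean q@(mkℚ (ℤ.-[1+ n ]) d _) = 0 , nonPositive⁻¹ q

  *-mono-≤ : ∀ {p q r s} → 0ℚ ≤ p → 0ℚ ≤ s → p ≤ q → r ≤ s → p * r ≤ q * s
  *-mono-≤ {p} {q} {r} {s} 0≤p 0≤s p≤q r≤s =
    ≤-trans (*-monoˡ-≤-nonNeg p {{nonNegative 0≤p}} r≤s)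
            (*-monoʳ-≤-nonNeg s {{nonNegative 0≤s}} p≤q)

  *-monoʳ : ∀ {r p q} → 0ℚ ≤ r → p ≤ q → p * r ≤ q * r
  *-monoʳ {r} 0≤r = *-monoʳ-≤-nonNeg r {{nonNegative 0≤r}}

  *-monoˡ : ∀ {r p q} → 0ℚ ≤ r → p ≤ q → r * p ≤ r * q
  *-monoˡ {r} 0≤r = *-monoˡ-≤-nonNeg r {{nonNegative 0≤r}}

  0≤* : ∀ {p q} → 0ℚ ≤ p → 0ℚ ≤ q → 0ℚ ≤ p * q
  0≤* {p} {q} 0≤p 0≤q = nonNegative⁻¹ (p * q) {{nonNeg*nonNeg⇒nonNeg p {{nonNegative 0≤p}} q {{nonNegative 0≤q}}}}

  0<* : ∀ {p q} → 0ℚ < p → 0ℚ < q → 0ℚ < p * q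
  0<* {p} {q} 0<p 0<q = positive⁻¹ (p * q) {{pos*pos⇒pos p {{positive 0<p}} q {{positive 0<q}}}}

  0≤+ : ∀ {p q} → 0ℚ ≤ p → 0ℚ ≤ q → 0ℚ ≤ p + q
  0≤+ = +-mono-≤

  0≤^ : ∀ {p} n → 0ℚ ≤ p → 0ℚ ≤ p ^ n
  0≤^ zero    _   = <⇒≤ 0<1
  0≤^ (suc n) 0≤p = 0≤* 0≤p (0≤^ n 0≤p)

  ^-mono : ∀ {p q} n → 0ℚ ≤ p → p ≤ q → p ^ n ≤ q ^ n
  ^-mono zero    0≤p p≤q = ≤-refl
  ^-mono (suc n) 0≤p p≤q = *-mono-≤ 0≤p (0≤^ n (≤-trans 0≤p p≤q)) p≤q (^-mono n 0≤p p≤q)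

  ^-distrib-* : ∀ p q n → (p * q) ^ n ≡ p ^ n * q ^ n
  ^-distrib-* p q zero    = refl
  ^-distrib-* p q (suc n) = trans (cong (p * q *_) (^-distrib-* p q n))
    (solve 4 (λ p q a b → p :* q :* (a :* b) := p :* a :* (q :* b)) refl p q (p ^ n) (q ^ n))

  ∣^∣ : ∀ p n → ∣ p ^ n ∣ ≡ ∣ p ∣ ^ n
  ∣^∣ p zero    = refl
  ∣^∣ p (suc n) = trans (∣p*q∣≡∣p∣*∣q∣ p (p ^ n)) (cong (∣ p ∣ *_) (∣^∣ p n))

  p≤∣p∣ : ∀ p → p ≤ ∣ p ∣
  p≤∣p∣ p with ≤-total 0ℚ p
  ... | inj₁ 0≤p = ≤-reflexive (sym (0≤p⇒∣p∣≡p 0≤p))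
  ... | inj₂ p≤0 = ≤-trans p≤0 (0≤∣p∣ p)

  ∣p-q∣≡∣q-p∣ : ∀ p q → ∣ p - q ∣ ≡ ∣ q - p ∣
  ∣p-q∣≡∣q-p∣ p q = trans (sym (∣-p∣≡∣p∣ (p - q)))
    (cong ∣_∣ (solve 2 (λ p q → :- (p :- q) := q :- p) refl p q))

  ∣-∣-triangle : ∀ p q r → ∣ p - r ∣ ≤ ∣ p - q ∣ + ∣ q - r ∣
  ∣-∣-triangle p q r = begin
    ∣ p - r ∣               ≡⟨ cong ∣_∣ (solve 3 (λ p q r → p :- r := p :- q :+ (q :- r)) refl p q r) ⟩
    ∣ p - q + (q - r) ∣     ≤⟨ ∣p+q∣≤∣p∣+∣q∣ (p - q) (q - r) ⟩
    ∣ p - q ∣ + ∣ q - r ∣   ∎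

  p≤q⇒0≤q-p : ∀ {p q} → p ≤ q → 0ℚ ≤ q - p
  p≤q⇒0≤q-p {p} {q} p≤q = begin
    0ℚ     ≡⟨ +-inverseʳ p ⟨
    p - p  ≤⟨ +-monoˡ-≤ (- p) p≤q ⟩
    q - p  ∎

  p<q⇒0<q-p : ∀ {p q} → p < q → 0ℚ < q - p
  p<q⇒0<q-p {p} {q} p<q = begin-strict
    0ℚ     ≡⟨ +-inverseʳ p ⟨
    p - p  <⟨ +-monoˡ-< (- p) p<q ⟩
    q - p  ∎

  0≤q-p⇒p≤q : ∀ {p q} → 0ℚ ≤ q - p → p ≤ q
  0≤q-p⇒p≤q {p} {q} h = begin
    p            ≡⟨ +-identityˡ p ⟨
    0ℚ + p       ≤⟨ +-monoˡ-≤ p h ⟩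
    q - p + p    ≡⟨ solve 2 (λ p q → q :- p :+ p := q) refl p q ⟩
    q            ∎

  ∣-∣-+ : ∀ a b c d → ∣ a + b - (c + d) ∣ ≤ ∣ a - c ∣ + ∣ b - d ∣
  ∣-∣-+ a b c d = begin
    ∣ a + b - (c + d) ∣     ≡⟨ cong ∣_∣ (solve 4 (λ a b c d → a :+ b :- (c :+ d) := a :- c :+ (b :- d)) refl a b c d) ⟩
    ∣ a - c + (b - d) ∣     ≤⟨ ∣p+q∣≤∣p∣+∣q∣ (a - c) (b - d) ⟩
    ∣ a - c ∣ + ∣ b - d ∣   ∎

  ∣-∣-* : ∀ a b c d → ∣ a * b - c * d ∣ ≤ ∣ a - c ∣ * ∣ b ∣ + ∣ b - d ∣ * ∣ c ∣
  ∣-∣-* a b c d = begin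
    ∣ a * b - c * d ∣                    ≡⟨ cong ∣_∣ (solve 4 (λ a b c d → a :* b :- c :* d := (a :- c) :* b :+ (b :- d) :* c) refl a b c d) ⟩
    ∣ (a - c) * b + (b - d) * c ∣        ≤⟨ ∣p+q∣≤∣p∣+∣q∣ ((a - c) * b) ((b - d) * c) ⟩
    ∣ (a - c) * b ∣ + ∣ (b - d) * c ∣    ≡⟨ cong₂ _+_ (∣p*q∣≡∣p∣*∣q∣ (a - c) b) (∣p*q∣≡∣p∣*∣q∣ (b - d) c) ⟩
    ∣ a - c ∣ * ∣ b ∣ + ∣ b - d ∣ * ∣ c ∣ ∎

  ∣-∣-neg : ∀ a b → ∣ - a - - b ∣ ≡ ∣ b - a ∣
  ∣-∣-neg a b = cong ∣_∣ (solve 2 (λ a b → :- a :- (:- b) := b :- a) refl a b)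

  ∣-∣-bound : ∀ a b {δ} → ∣ a - b ∣ ≤ δ → ∣ a ∣ ≤ ∣ b ∣ + δ
  ∣-∣-bound a b {δ} h = begin
    ∣ a ∣               ≡⟨ cong ∣_∣ (solve 2 (λ a b → a := b :+ (a :- b)) refl a b) ⟩
    ∣ b + (a - b) ∣     ≤⟨ ∣p+q∣≤∣p∣+∣q∣ b (a - b) ⟩
    ∣ b ∣ + ∣ a - b ∣   ≤⟨ +-monoʳ-≤ ∣ b ∣ h ⟩
    ∣ b ∣ + δ           ∎

  half+half : ∀ ε → ½ * ε + ½ * ε ≡ ε
  half+half = solve 1 (λ ε → con ½ :* ε :+ con ½ :* ε := ε) refl

  0<half : ∀ {ε} → 0ℚ < ε → 0ℚ < ½ * ε
  0<half = 0<* 0<½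

  inv : (p : ℚ) → 0ℚ < p → ℚ
  inv p 0<p = (1/ p) {{>-nonZero 0<p}}

  inv-pos : ∀ p (0<p : 0ℚ < p) → 0ℚ < inv p 0<p
  inv-pos p 0<p = positive⁻¹ (inv p 0<p) {{1/pos⇒pos p {{positive 0<p}}}}

  inv-inverseʳ : ∀ p (0<p : 0ℚ < p) → p * inv p 0<p ≡ 1ℚ
  inv-inverseʳ p 0<p = *-inverseʳ p {{>-nonZero 0<p}}

  inv-inverseˡ : ∀ p (0<p : 0ℚ < p) → inv p 0<p * p ≡ 1ℚ
  inv-inverseˡ p 0<p = *-inverseˡ p {{>-nonZero 0<p}}

  inv-antimono : ∀ {p q} (0<p : 0ℚ < p) (0<q : 0ℚ < q) → p ≤ q → inv q 0<q ≤ inv p 0<p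
  inv-antimono {p} {q} 0<p 0<q p≤q = begin
    iq             ≡⟨ *-identityˡ iq ⟨
    1ℚ * iq        ≡⟨ cong (_* iq) (inv-inverseˡ p 0<p) ⟨
    ip * p * iq    ≤⟨ *-monoʳ (<⇒≤ (inv-pos q 0<q)) (*-monoˡ (<⇒≤ (inv-pos p 0<p)) p≤q) ⟩
    ip * q * iq    ≡⟨ *-assoc ip q iq ⟩
    ip * (q * iq)  ≡⟨ cong (ip *_) (inv-inverseʳ q 0<q) ⟩
    ip * 1ℚ        ≡⟨ *-identityʳ ip ⟩
    ip             ∎
    where
    ip = inv p 0<p
    iq = inv q 0<q

  scale : ∀ {ε} K → 0ℚ < ε → 0ℚ ≤ K → ∃[ δ ] (0ℚ < δ × δ * K ≤ ε)
  scale {ε} K 0<ε 0≤K = ε * i , 0<* 0<ε (inv-pos (K + 1ℚ) 0<K+1) , (begin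
    ε * i * K           ≤⟨ *-monoˡ (<⇒≤ (0<* 0<ε (inv-pos (K + 1ℚ) 0<K+1))) K≤K+1 ⟩
    ε * i * (K + 1ℚ)    ≡⟨ *-assoc ε i (K + 1ℚ) ⟩
    ε * (i * (K + 1ℚ))  ≡⟨ cong (ε *_) (inv-inverseˡ (K + 1ℚ) 0<K+1) ⟩
    ε * 1ℚ              ≡⟨ *-identityʳ ε ⟩
    ε                   ∎)
    where
    0<K+1 : 0ℚ < K + 1ℚ
    0<K+1 = +-mono-≤-< 0≤K 0<1
    K≤K+1 : K ≤ K + 1ℚ
    K≤K+1 = begin
      K       ≡⟨ +-identityʳ K ⟨
      K + 0ℚ  ≤⟨ +-monoʳ-≤ K (<⇒≤ 0<1) ⟩
      K + 1ℚ  ∎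
    i = inv (K + 1ℚ) 0<K+1

  module _ {r} (0≤r : 0ℚ ≤ r) (r<1 : r < 1ℚ) where
    private
      0<1-r = p<q⇒0<q-p r<1

    geo : ℚ
    geo = inv (1ℚ - r) 0<1-r

    0≤geo : 0ℚ ≤ geo
    0≤geo = <⇒≤ (inv-pos (1ℚ - r) 0<1-r)

    private
      geo-eq : r * geo + 1ℚ ≡ geo
      geo-eq = begin-equality
        r * geo + 1ℚ                ≡⟨ cong (r * geo +_) (inv-inverseʳ (1ℚ - r) 0<1-r) ⟨
        r * geo + (1ℚ - r) * geo    ≡⟨ solve 2 (λ r g → r :* g :+ (con 1ℚ :- r) :* g := g) refl r geo ⟩
        geo                         ∎

    geo-step : ∀ n → r ^ n + r ^ suc n * geo ≡ r ^ n * geo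
    geo-step n = begin-equality
      r ^ n + r * r ^ n * geo   ≡⟨ solve 3 (λ r x g → x :+ r :* x :* g := x :* (r :* g :+ con 1ℚ)) refl r (r ^ n) geo ⟩
      r ^ n * (r * geo + 1ℚ)    ≡⟨ cong (r ^ n *_) geo-eq ⟩
      r ^ n * geo               ∎

    ^-decr : ∀ {m n} → m ℕ.≤ n → r ^ n ≤ r ^ m
    ^-decr {zero} {zero} _ = ≤-refl
    ^-decr {zero} {suc n} _ = begin
      r * r ^ n   ≤⟨ *-mono-≤ 0≤r (<⇒≤ 0<1) (<⇒≤ r<1) (^-decr {zero} {n} ℕ.z≤n) ⟩
      1ℚ * 1ℚ     ≡⟨⟩
      1ℚ          ∎
    ^-decr (ℕ.s≤s m≤n) = *-monoˡ 0≤r (^-decr m≤n)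

    private
      n*rⁿ : ∀ n → fromℕ n * r ^ n + r ^ n * geo ≤ geo
      n*rⁿ zero = ≤-reflexive (solve 1 (λ g → con 0ℚ :* con 1ℚ :+ con 1ℚ :* g := g) refl geo)
      n*rⁿ (suc n) = begin
        fromℕ (suc n) * r ^ suc n + r ^ suc n * geo
          ≡⟨ cong (λ q → q * r ^ suc n + r ^ suc n * geo) (fromℕ-+ 1 n) ⟩
        (1ℚ + fromℕ n) * r ^ suc n + r ^ suc n * geo
          ≤⟨ +-monoˡ-≤ (r ^ suc n * geo) (*-monoˡ (0≤+ (<⇒≤ 0<1) (0≤fromℕ n)) (^-decr (ℕₚ.n≤1+n n))) ⟩
        (1ℚ + fromℕ n) * r ^ n + r ^ suc n * geo
          ≡⟨ solve 3 (λ a x y → (con 1ℚ :+ a) :* x :+ y := a :* x :+ (x :+ y)) refl (fromℕ n) (r ^ n) (r ^ suc n * geo) ⟩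
        fromℕ n * r ^ n + (r ^ n + r ^ suc n * geo)
          ≡⟨ cong (fromℕ n * r ^ n +_) (geo-step n) ⟩
        fromℕ n * r ^ n + r ^ n * geo
          ≤⟨ n*rⁿ n ⟩
        geo ∎

    ^-vanish : ∀ K ε → 0ℚ ≤ K → 0ℚ < ε → ∃[ M ] r ^ M * K ≤ ε
    ^-vanish K ε 0≤K 0<ε with archimedean (geo * K * inv ε 0<ε)
    ... | n , le = suc n , *-cancelˡ-≤-pos (fromℕ (suc n)) {{positive (0<fromℕ-suc n)}} (begin
      N * (r ^ suc n * K)                           ≡⟨ *-assoc N (r ^ suc n) K ⟨
      N * r ^ suc n * K                             ≤⟨ *-monoʳ 0≤K Nr≤geo ⟩
      geo * K                                       ≡⟨ *-identityʳ (geo * K) ⟨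
      geo * K * 1ℚ                                  ≡⟨ cong (geo * K *_) (inv-inverseˡ ε 0<ε) ⟨
      geo * K * (inv ε 0<ε * ε)                     ≡⟨ *-assoc (geo * K) (inv ε 0<ε) ε ⟨
      geo * K * inv ε 0<ε * ε                       ≤⟨ *-monoʳ (<⇒≤ 0<ε) (≤-trans le (fromℕ-mono (ℕₚ.n≤1+n n))) ⟩
      N * ε                                         ∎)
      where
      N = fromℕ (suc n)
      Nr≤geo : N * r ^ suc n ≤ geo
      Nr≤geo = begin
        N * r ^ suc n                        ≡⟨ +-identityʳ (N * r ^ suc n) ⟨
        N * r ^ suc n + 0ℚ                   ≤⟨ +-monoʳ-≤ (N * r ^ suc n) (0≤* (0≤^ (suc n) 0≤r) 0≤geo) ⟩
        N * r ^ suc n + r ^ suc n * geo      ≤⟨ n*rⁿ (suc n) ⟩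
        geo                                  ∎

  ^-lipschitz : ∀ {B} x y n → ∣ x ∣ ≤ B → ∣ y ∣ ≤ B →
                ∣ x ^ suc n - y ^ suc n ∣ ≤ fromℕ (suc n) * B ^ n * ∣ x - y ∣
  ^-lipschitz {B} x y zero _ _ = ≤-reflexive (begin-equality
    ∣ x * 1ℚ - y * 1ℚ ∣       ≡⟨ cong ∣_∣ (cong₂ _-_ (*-identityʳ x) (*-identityʳ y)) ⟩
    ∣ x - y ∣                 ≡⟨ *-identityˡ ∣ x - y ∣ ⟨
    1ℚ * ∣ x - y ∣            ≡⟨⟩
    fromℕ 1 * 1ℚ * ∣ x - y ∣  ∎)
  ^-lipschitz {B} x y (suc n) x≤B y≤B = begin
    ∣ x * X - y * Y ∣
      ≡⟨ cong ∣_∣ (solve 4 (λ x y a b → x :* a :- y :* b := x :* (a :- b) :+ b :* (x :- y)) refl x y X Y) ⟩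
    ∣ x * (X - Y) + Y * (x - y) ∣
      ≤⟨ ∣p+q∣≤∣p∣+∣q∣ (x * (X - Y)) (Y * (x - y)) ⟩
    ∣ x * (X - Y) ∣ + ∣ Y * (x - y) ∣
      ≡⟨ cong₂ _+_ (∣p*q∣≡∣p∣*∣q∣ x (X - Y)) (∣p*q∣≡∣p∣*∣q∣ Y (x - y)) ⟩
    ∣ x ∣ * ∣ X - Y ∣ + ∣ Y ∣ * D
      ≤⟨ +-mono-≤ (*-mono-≤ (0≤∣p∣ x) (0≤* (0≤* (0≤fromℕ (suc n)) (0≤^ n 0≤B)) (0≤∣p∣ (x - y))) x≤B (^-lipschitz x y n x≤B y≤B))
                  (*-monoʳ (0≤∣p∣ (x - y)) (≤-trans (≤-reflexive (∣^∣ y (suc n))) (^-mono (suc n) (0≤∣p∣ y) y≤B))) ⟩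
    B * (fromℕ (suc n) * B ^ n * D) + B * B ^ n * D
      ≡⟨ solve 4 (λ b k p d → b :* (k :* p :* d) :+ b :* p :* d := (con 1ℚ :+ k) :* (b :* p) :* d) refl B (fromℕ (suc n)) (B ^ n) D ⟩
    (1ℚ + fromℕ (suc n)) * (B * B ^ n) * D
      ≡⟨ cong (λ q → q * (B * B ^ n) * D) (fromℕ-+ 1 (suc n)) ⟨
    fromℕ (suc (suc n)) * B ^ suc n * D ∎
    where
    X = x ^ suc n
    Y = y ^ suc n
    D = ∣ x - y ∣
    0≤B : 0ℚ ≤ B
    0≤B = ≤-trans (0≤∣p∣ x) x≤B

  -- Truncations of a power series Σ aᵢ xⁱ whose termwise derivative is
  -- dominated by the geometric series Σ C rⁱ on |x| ≤ B
  truncation : (ℕ → ℚ) → ℚ → ℕ → ℚ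
  truncation a x n = sumTo n (λ i → a i * x ^ i)

  module _ {a : ℕ → ℚ} {B C r : ℚ} (0≤r : 0ℚ ≤ r) (r<1 : r < 1ℚ) (0≤B : 0ℚ ≤ B)
           (dom : ∀ i → ∣ a (suc i) ∣ * (fromℕ (suc i) * B ^ i) ≤ C * r ^ i) where
    private
      G = geo 0≤r r<1
      0≤G = 0≤geo 0≤r r<1

      telescope : ∀ D k → 0ℚ ≤ D → C * r ^ k * D + D * C * (r ^ suc k * G) ≡ D * C * (r ^ k * G)
      telescope D k _ = begin-equality
        C * r ^ k * D + D * C * (r ^ suc k * G)
          ≡⟨ solve 4 (λ c x d y → c :* x :* d :+ d :* c :* y := d :* c :* (x :+ y)) refl C (r ^ k) D (r ^ suc k * G) ⟩
        D * C * (r ^ k + r ^ suc k * G)   ≡⟨ cong (D * C *_) (geo-step 0≤r r<1 k) ⟩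
        D * C * (r ^ k * G)               ∎

    0≤C : 0ℚ ≤ C
    0≤C = begin
      0ℚ                                      ≤⟨ 0≤* (0≤∣p∣ (a 1)) (0≤* (0≤fromℕ 1) (0≤^ 0 0≤B)) ⟩
      ∣ a 1 ∣ * (fromℕ 1 * B ^ 0)             ≤⟨ dom 0 ⟩
      C * 1ℚ                                  ≡⟨ *-identityʳ C ⟩
      C                                       ∎

    private
      lip : ∀ {x y} → ∣ x ∣ ≤ B → ∣ y ∣ ≤ B → ∀ n →
            ∣ truncation a x (suc n) - truncation a y (suc n) ∣ + ∣ x - y ∣ * C * (r ^ n * G) ≤ ∣ x - y ∣ * C * (1ℚ * G)
      lip {x} {y} x≤B y≤B zero = ≤-reflexive (begin-equality
        ∣ 0ℚ + a 0 * 1ℚ - (0ℚ + a 0 * 1ℚ) ∣ + Z  ≡⟨ cong (λ q → ∣ q ∣ + Z) (+-inverseʳ (0ℚ + a 0 * 1ℚ)) ⟩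
        0ℚ + Z                                   ≡⟨ +-identityˡ Z ⟩
        Z                                        ∎)
        where Z = ∣ x - y ∣ * C * (1ℚ * G)
      lip {x} {y} x≤B y≤B (suc n) = begin
        ∣ P + t * X - (Q + t * Y) ∣ + Z
          ≡⟨ cong (λ q → ∣ q ∣ + Z) (solve 5 (λ p q t x y → p :+ t :* x :- (q :+ t :* y) := p :- q :+ t :* (x :- y)) refl P Q t X Y) ⟩
        ∣ P - Q + t * (X - Y) ∣ + Z
          ≤⟨ +-monoˡ-≤ Z (∣p+q∣≤∣p∣+∣q∣ (P - Q) (t * (X - Y))) ⟩
        ∣ P - Q ∣ + ∣ t * (X - Y) ∣ + Z
          ≤⟨ +-monoˡ-≤ Z (+-monoʳ-≤ ∣ P - Q ∣ term) ⟩
        ∣ P - Q ∣ + C * r ^ n * D + Z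
          ≡⟨ +-assoc ∣ P - Q ∣ (C * r ^ n * D) Z ⟩
        ∣ P - Q ∣ + (C * r ^ n * D + Z)
          ≡⟨ cong (∣ P - Q ∣ +_) (telescope D n (0≤∣p∣ (x - y))) ⟩
        ∣ P - Q ∣ + D * C * (r ^ n * G)
          ≤⟨ lip x≤B y≤B n ⟩
        D * C * (1ℚ * G) ∎
        where
        P = truncation a x (suc n)
        Q = truncation a y (suc n)
        X = x ^ suc n
        Y = y ^ suc n
        t = a (suc n)
        D = ∣ x - y ∣
        Z = D * C * (r ^ suc n * G)
        term : ∣ t * (X - Y) ∣ ≤ C * r ^ n * D
        term = begin
          ∣ t * (X - Y) ∣                             ≡⟨ ∣p*q∣≡∣p∣*∣q∣ t (X - Y) ⟩
          ∣ t ∣ * ∣ X - Y ∣                           ≤⟨ *-monoˡ (0≤∣p∣ t) (^-lipschitz x y n x≤B y≤B) ⟩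
          ∣ t ∣ * (fromℕ (suc n) * B ^ n * D)         ≡⟨ *-assoc ∣ t ∣ (fromℕ (suc n) * B ^ n) D ⟨
          ∣ t ∣ * (fromℕ (suc n) * B ^ n) * D         ≤⟨ *-monoʳ (0≤∣p∣ (x - y)) (dom n) ⟩
          C * r ^ n * D                               ∎

    truncation-lipschitz : ∀ {x y} → ∣ x ∣ ≤ B → ∣ y ∣ ≤ B → ∀ n →
      ∣ truncation a x (suc n) - truncation a y (suc n) ∣ ≤ ∣ x - y ∣ * (C * G)
    truncation-lipschitz {x} {y} x≤B y≤B n = begin
      E                                        ≡⟨ +-identityʳ E ⟨
      E + 0ℚ                                   ≤⟨ +-monoʳ-≤ E (0≤* (0≤* (0≤∣p∣ (x - y)) 0≤C) (0≤* (0≤^ n 0≤r) 0≤G)) ⟩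
      E + ∣ x - y ∣ * C * (r ^ n * G)          ≤⟨ lip x≤B y≤B n ⟩
      ∣ x - y ∣ * C * (1ℚ * G)                 ≡⟨ solve 3 (λ d c g → d :* c :* (con 1ℚ :* g) := d :* (c :* g)) refl ∣ x - y ∣ C G ⟩
      ∣ x - y ∣ * (C * G)                      ∎
      where E = ∣ truncation a x (suc n) - truncation a y (suc n) ∣

    private
      term≤ : ∀ {x} → ∣ x ∣ ≤ B → ∀ i → ∣ a (suc i) * x ^ suc i ∣ ≤ C * r ^ i * B
      term≤ {x} x≤B i = begin
        ∣ a (suc i) * x ^ suc i ∣                 ≡⟨ ∣p*q∣≡∣p∣*∣q∣ (a (suc i)) (x ^ suc i) ⟩
        t * ∣ x ^ suc i ∣                         ≤⟨ *-monoˡ (0≤∣p∣ (a (suc i))) (≤-trans (≤-reflexive (∣^∣ x (suc i))) (^-mono (suc i) (0≤∣p∣ x) x≤B)) ⟩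
        t * (B * B ^ i)                           ≡⟨ solve 3 (λ t b p → t :* (b :* p) := t :* (con 1ℚ :* p) :* b) refl t B (B ^ i) ⟩
        t * (1ℚ * B ^ i) * B                      ≤⟨ *-monoʳ 0≤B (*-monoˡ (0≤∣p∣ (a (suc i))) (*-monoʳ (0≤^ i 0≤B) (fromℕ-mono {1} {suc i} (ℕ.s≤s ℕ.z≤n)))) ⟩
        t * (fromℕ (suc i) * B ^ i) * B           ≤⟨ *-monoʳ 0≤B (dom i) ⟩
        C * r ^ i * B                             ∎
        where t = ∣ a (suc i) ∣

      tail : ∀ {x} → ∣ x ∣ ≤ B → ∀ m k →
        ∣ truncation a x (suc (k ℕ.+ m)) - truncation a x (suc m) ∣ + B * C * (r ^ (k ℕ.+ m) * G) ≤ B * C * (r ^ m * G)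
      tail {x} x≤B m zero = ≤-reflexive (begin-equality
        ∣ P - P ∣ + Z  ≡⟨ cong (λ q → ∣ q ∣ + Z) (+-inverseʳ P) ⟩
        0ℚ + Z         ≡⟨ +-identityˡ Z ⟩
        Z              ∎)
        where
        P = truncation a x (suc m)
        Z = B * C * (r ^ m * G)
      tail {x} x≤B m (suc k) = begin
        ∣ P + t - Q ∣ + Z               ≡⟨ cong (λ q → ∣ q ∣ + Z) (solve 3 (λ p t q → p :+ t :- q := p :- q :+ t) refl P t Q) ⟩
        ∣ P - Q + t ∣ + Z               ≤⟨ +-monoˡ-≤ Z (∣p+q∣≤∣p∣+∣q∣ (P - Q) t) ⟩
        ∣ P - Q ∣ + ∣ t ∣ + Z           ≤⟨ +-monoˡ-≤ Z (+-monoʳ-≤ ∣ P - Q ∣ (term≤ x≤B (k ℕ.+ m))) ⟩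
        ∣ P - Q ∣ + C * R * B + Z       ≡⟨ +-assoc ∣ P - Q ∣ (C * R * B) Z ⟩
        ∣ P - Q ∣ + (C * R * B + Z)     ≡⟨ cong (∣ P - Q ∣ +_) (telescope B (k ℕ.+ m) 0≤B) ⟩
        ∣ P - Q ∣ + B * C * (R * G)     ≤⟨ tail x≤B m k ⟩
        B * C * (r ^ m * G)             ∎
        where
        P = truncation a x (suc (k ℕ.+ m))
        Q = truncation a x (suc m)
        R = r ^ (k ℕ.+ m)
        t = a (suc (k ℕ.+ m)) * x ^ suc (k ℕ.+ m)
        Z = B * C * (r ^ suc (k ℕ.+ m) * G)

    truncation-tail : ∀ {x} → ∣ x ∣ ≤ B → ∀ {m n} → m ℕ.≤ n →
      ∣ truncation a x (suc n) - truncation a x (suc m) ∣ ≤ r ^ m * (B * C * G)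
    truncation-tail {x} x≤B {m} {n} m≤n = subst (λ n → ∣ truncation a x (suc n) - truncation a x (suc m) ∣ ≤ r ^ m * (B * C * G))
      (ℕₚ.m∸n+n≡m m≤n) (begin
      E                                   ≡⟨ +-identityʳ E ⟨
      E + 0ℚ                              ≤⟨ +-monoʳ-≤ E (0≤* (0≤* 0≤B 0≤C) (0≤* (0≤^ (k ℕ.+ m) 0≤r) 0≤G)) ⟩
      E + B * C * (r ^ (k ℕ.+ m) * G)     ≤⟨ tail x≤B m k ⟩
      B * C * (r ^ m * G)                 ≡⟨ solve 3 (λ y p g → y :* (p :* g) := p :* (y :* g)) refl (B * C) (r ^ m) G ⟩
      r ^ m * (B * C * G)                 ∎)
      where
      k = n ℕ.∸ m
      E = ∣ truncation a x (suc (k ℕ.+ m)) - truncation a x (suc m) ∣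

  inv-lipschitz : ∀ {ε p q} (0<ε : 0ℚ < ε) (0<p : 0ℚ < p) (0<q : 0ℚ < q) → ε ≤ p → ε ≤ q →
                  ∣ inv p 0<p - inv q 0<q ∣ ≤ ∣ p - q ∣ * (inv ε 0<ε * inv ε 0<ε)
  inv-lipschitz {ε} {p} {q} 0<ε 0<p 0<q ε≤p ε≤q = begin
    ∣ ip - iq ∣
      ≡⟨ cong ∣_∣ (begin-equality
        ip - iq                              ≡⟨ cong₂ _-_ (*-identityʳ ip) (*-identityʳ iq) ⟨
        ip * 1ℚ - iq * 1ℚ                    ≡⟨ cong₂ (λ a b → ip * a - iq * b) (inv-inverseʳ q 0<q) (inv-inverseʳ p 0<p) ⟨
        ip * (q * iq) - iq * (p * ip)        ≡⟨ solve 4 (λ p q a b → a :* (q :* b) :- b :* (p :* a) := (q :- p) :* (a :* b)) refl p q ip iq ⟩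
        (q - p) * (ip * iq)                  ∎) ⟩
    ∣ (q - p) * (ip * iq) ∣
      ≡⟨ ∣p*q∣≡∣p∣*∣q∣ (q - p) (ip * iq) ⟩
    ∣ q - p ∣ * ∣ ip * iq ∣
      ≡⟨ cong₂ _*_ (∣p-q∣≡∣q-p∣ q p) (0≤p⇒∣p∣≡p (0≤* (<⇒≤ (inv-pos p 0<p)) (<⇒≤ (inv-pos q 0<q)))) ⟩
    ∣ p - q ∣ * (ip * iq)
      ≤⟨ *-monoˡ (0≤∣p∣ (p - q)) (*-mono-≤ (<⇒≤ (inv-pos p 0<p)) (<⇒≤ (inv-pos ε 0<ε)) (inv-antimono 0<ε 0<p ε≤p) (inv-antimono 0<ε 0<q ε≤q)) ⟩
    ∣ p - q ∣ * (inv ε 0<ε * inv ε 0<ε) ∎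
    where
    ip = inv p 0<p
    iq = inv q 0<q

  0<⊔ : ∀ {ε} p → 0ℚ < ε → 0ℚ < p ⊔ ε
  0<⊔ {ε} p 0<ε = <-≤-trans 0<ε (p≤q⊔p p ε)

  0≤p*p : ∀ p → 0ℚ ≤ p * p
  0≤p*p p with ≤-total 0ℚ p
  ... | inj₁ 0≤p = 0≤* 0≤p 0≤p
  ... | inj₂ p≤0 = nonNegative⁻¹ (p * p) {{nonPos*nonPos⇒nonPos p {{nonPositive p≤0}} p {{nonPositive p≤0}}}}

  module _ {ε K} (0<ε : 0ℚ < ε) (0≤K : 0ℚ ≤ K) where
    private
      0<K+1 : 0ℚ < K + 1ℚ
      0<K+1 = +-mono-≤-< 0≤K 0<1

    cayley-bound : ℚ
    cayley-bound = 1ℚ - fromℕ 4 * ε * (inv (K + 1ℚ) 0<K+1 * inv (K + 1ℚ) 0<K+1)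

    cayley-bound<1 : cayley-bound < 1ℚ
    cayley-bound<1 = begin-strict
      1ℚ - T    <⟨ +-monoʳ-< 1ℚ (neg-antimono-< 0<T) ⟩
      1ℚ - 0ℚ   ≡⟨⟩
      1ℚ        ∎
      where
      T = fromℕ 4 * ε * (inv (K + 1ℚ) 0<K+1 * inv (K + 1ℚ) 0<K+1)
      0<T : 0ℚ < T
      0<T = 0<* (0<* (0<fromℕ-suc 3) 0<ε) (0<* (inv-pos (K + 1ℚ) 0<K+1) (inv-pos (K + 1ℚ) 0<K+1))

    -- ((q - 1) / (q + 1))² = 1 - 4q / (q + 1)²
    cayley : ∀ {q} (0<d : 0ℚ < (q + 1ℚ) ⊔ 1ℚ) → ε ≤ q → q ≤ K →
             let z = (q - 1ℚ) * inv ((q + 1ℚ) ⊔ 1ℚ) 0<d in ∣ z * z ∣ ≤ cayley-bound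
    cayley {q} 0<d ε≤q q≤K = begin
      ∣ z * z ∣                            ≡⟨ 0≤p⇒∣p∣≡p (0≤p*p z) ⟩
      z * z                                ≡⟨ solve 2 (λ q v → (q :- con 1ℚ) :* v :* ((q :- con 1ℚ) :* v)
                                               := (q :+ con 1ℚ) :* v :* ((q :+ con 1ℚ) :* v) :- con (fromℕ 4) :* q :* (v :* v)) refl q v ⟩
      (q + 1ℚ) * v * ((q + 1ℚ) * v) - fromℕ 4 * q * (v * v)
                                           ≡⟨ cong (λ e → e * e - fromℕ 4 * q * (v * v)) dv≡1 ⟩
      1ℚ - fromℕ 4 * q * (v * v)           ≤⟨ +-monoʳ-≤ 1ℚ (neg-antimono-≤ (*-mono-≤ 0≤4ε (0≤p*p v) (*-monoˡ (0≤fromℕ 4) ε≤q) (*-mono-≤ 0≤u (<⇒≤ (inv-pos d 0<d)) u≤v u≤v))) ⟩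
      cayley-bound                         ∎
      where
      d = (q + 1ℚ) ⊔ 1ℚ
      v = inv d 0<d
      u = inv (K + 1ℚ) 0<K+1
      z = (q - 1ℚ) * v
      0≤4ε = 0≤* (0≤fromℕ 4) (<⇒≤ 0<ε)
      0≤u = <⇒≤ (inv-pos (K + 1ℚ) 0<K+1)
      1≤q+1 : 1ℚ ≤ q + 1ℚ
      1≤q+1 = begin
        1ℚ       ≡⟨ +-identityˡ 1ℚ ⟨
        0ℚ + 1ℚ  ≤⟨ +-monoˡ-≤ 1ℚ (≤-trans (<⇒≤ 0<ε) ε≤q) ⟩
        q + 1ℚ   ∎
      d≡q+1 : d ≡ q + 1ℚ
      d≡q+1 = p≥q⇒p⊔q≡p 1≤q+1
      dv≡1 : (q + 1ℚ) * v ≡ 1ℚ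
      dv≡1 = trans (cong (_* v) (sym d≡q+1)) (inv-inverseʳ d 0<d)
      u≤v : u ≤ v
      u≤v = inv-antimono 0<d 0<K+1 (≤-trans (≤-reflexive d≡q+1) (+-monoˡ-≤ 1ℚ q≤K))

  /-*-cancel : ∀ m n .{{_ : ℕ.NonZero n}} → (ℤ.+ m ℚ./ n) * fromℕ n ≡ fromℕ m
  /-*-cancel m n@(suc n-1) = toℚᵘ-injective
    (ℚᵘₚ.≃-trans (toℚᵘ-homo-* (ℤ.+ m ℚ./ n) (fromℕ n))
    (ℚᵘₚ.≃-trans (ℚᵘₚ.*-cong (toℚᵘ-fromℚᵘ (ℚᵘ.mkℚᵘ (ℤ.+ m) n-1)) (toℚᵘ-fromℕ n))
    (ℚᵘₚ.≃-trans (ℚᵘ.*≡* lem) (ℚᵘₚ.≃-sym (toℚᵘ-fromℕ m)))))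
    where
    lem : (ℤ.+ m ℤ.* ℤ.+ n) ℤ.* ℤ.+ 1 ≡ ℤ.+ m ℤ.* ℤ.+ (n ℕ.* 1)
    lem = trans (ℤₚ.*-identityʳ (ℤ.+ m ℤ.* ℤ.+ n)) (cong (λ k → ℤ.+ m ℤ.* ℤ.+ k) (sym (ℕₚ.*-identityʳ n)))

  0≤/ : ∀ m n .{{_ : ℕ.NonZero n}} → 0ℚ ≤ ℤ.+ m ℚ./ n
  0≤/ m n = nonNegative⁻¹ (ℤ.+ m ℚ./ n) {{normalize-nonNeg m n}}

module _ where
  factorial-bound : ∀ D i → suc D ℕ.^ i ℕ.≤ suc D ℕ.^ suc D ℕ.* i !
  factorial-bound D i with ℕₚ.≤-total i (suc D)
  ... | inj₁ i≤D = ℕₚ.≤-trans (ℕₚ.^-monoʳ-≤ (suc D) i≤D) (ℕₚ.m≤m*n (suc D ℕ.^ suc D) (i !) {{i ℕₚ.!≢0}})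
  ... | inj₂ D≤i = subst (λ i → suc D ℕ.^ i ℕ.≤ suc D ℕ.^ suc D ℕ.* i !) (ℕₚ.m∸n+n≡m D≤i) (go (i ℕ.∸ suc D))
    where
    go : ∀ k → suc D ℕ.^ (k ℕ.+ suc D) ℕ.≤ suc D ℕ.^ suc D ℕ.* (k ℕ.+ suc D) !
    go zero    = ℕₚ.m≤m*n (suc D ℕ.^ suc D) (suc D !) {{suc D ℕₚ.!≢0}}
    go (suc k) = begin
      suc D ℕ.* suc D ℕ.^ n               ≤⟨ ℕₚ.*-mono-≤ (ℕₚ.≤-trans (ℕₚ.m≤n+m (suc D) k) (ℕₚ.n≤1+n n)) (go k) ⟩
      suc n ℕ.* (E ℕ.* n !)               ≡⟨ ℕₚ.*-assoc (suc n) E (n !) ⟨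
      suc n ℕ.* E ℕ.* n !                 ≡⟨ cong (ℕ._* n !) (ℕₚ.*-comm (suc n) E) ⟩
      E ℕ.* suc n ℕ.* n !                 ≡⟨ ℕₚ.*-assoc E (suc n) (n !) ⟩
      E ℕ.* (suc n ℕ.* n !)               ∎
      where
      open ℕₚ.≤-Reasoning
      n = k ℕ.+ suc D
      E = suc D ℕ.^ suc D

expCoeff : ℕ → ℚ
expCoeff i = (ℤ.+ 1 ℚ./ (i !)) {{i ℕₚ.!≢0}}

artanhCoeff : ℕ → ℚ
artanhCoeff i = ℤ.+ 1 ℚ./ suc (2 ℕ.* i)

module _ where
  open ℚ hiding (_/_)
  open ℚₚ
  open Rational
  open +-*-Solver using (solve; _:+_; _:*_; _:-_; :-_; con; _:=_)
  open ≤-Reasoning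

  expCoeff-suc : ∀ i → expCoeff (suc i) * fromℕ (suc i) ≡ expCoeff i
  expCoeff-suc i = begin-equality
    e * s                         ≡⟨ *-identityʳ (e * s) ⟨
    e * s * 1ℚ                    ≡⟨ cong (e * s *_) (/-*-cancel 1 (i !) {{i ℕₚ.!≢0}}) ⟨
    e * s * (f * fromℕ (i !))     ≡⟨ solve 4 (λ e s f n → e :* s :* (f :* n) := e :* (s :* n) :* f) refl e s f (fromℕ (i !)) ⟩
    e * (s * fromℕ (i !)) * f     ≡⟨ cong (λ q → e * q * f) (fromℕ-* (suc i) (i !)) ⟨
    e * fromℕ (suc i !) * f       ≡⟨ cong (_* f) (/-*-cancel 1 (suc i !) {{suc i ℕₚ.!≢0}}) ⟩
    1ℚ * f                        ≡⟨ *-identityˡ f ⟩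
    f                             ∎
    where
    e = expCoeff (suc i)
    f = expCoeff i
    s = fromℕ (suc i)

  0≤expCoeff : ∀ i → 0ℚ ≤ expCoeff i
  0≤expCoeff i = 0≤/ 1 (i !) {{i ℕₚ.!≢0}}

  expCoeff-dominated : ∀ K → 0ℚ ≤ K →
    ∃[ C ] ∀ i → ∣ expCoeff (suc i) ∣ * (fromℕ (suc i) * K ^ i) ≤ C * ½ ^ i
  expCoeff-dominated K 0≤K = C , bound
    where
    D = proj₁ (archimedean (fromℕ 2 * K))
    S = fromℕ (suc D)
    C = fromℕ (suc D ℕ.^ suc D)
    2K≤S : fromℕ 2 * K ≤ S
    2K≤S = ≤-trans (proj₂ (archimedean (fromℕ 2 * K))) (fromℕ-mono (ℕₚ.n≤1+n D))
    K≡½*2K : K ≡ ½ * (fromℕ 2 * K)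
    K≡½*2K = solve 1 (λ k → k := con ½ :* (con (fromℕ 2) :* k)) refl K
    coeff : ∀ i → expCoeff i * S ^ i ≤ C
    coeff i = begin
      f * S ^ i                       ≡⟨ cong (f *_) (fromℕ-^ (suc D) i) ⟨
      f * fromℕ (suc D ℕ.^ i)         ≤⟨ *-monoˡ (0≤expCoeff i) (fromℕ-mono (factorial-bound D i)) ⟩
      f * fromℕ (suc D ℕ.^ suc D ℕ.* i !)  ≡⟨ cong (f *_) (fromℕ-* (suc D ℕ.^ suc D) (i !)) ⟩
      f * (C * fromℕ (i !))           ≡⟨ solve 3 (λ f c n → f :* (c :* n) := c :* (f :* n)) refl f C (fromℕ (i !)) ⟩
      C * (f * fromℕ (i !))           ≡⟨ cong (C *_) (/-*-cancel 1 (i !) {{i ℕₚ.!≢0}}) ⟩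
      C * 1ℚ                          ≡⟨ *-identityʳ C ⟩
      C                               ∎
      where f = expCoeff i
    bound : ∀ i → ∣ expCoeff (suc i) ∣ * (fromℕ (suc i) * K ^ i) ≤ C * ½ ^ i
    bound i = begin
      ∣ expCoeff (suc i) ∣ * (fromℕ (suc i) * K ^ i)  ≡⟨ cong (_* (fromℕ (suc i) * K ^ i)) (0≤p⇒∣p∣≡p (0≤expCoeff (suc i))) ⟩
      expCoeff (suc i) * (fromℕ (suc i) * K ^ i)      ≡⟨ *-assoc (expCoeff (suc i)) (fromℕ (suc i)) (K ^ i) ⟨
      expCoeff (suc i) * fromℕ (suc i) * K ^ i        ≡⟨ cong (_* K ^ i) (expCoeff-suc i) ⟩
      f * K ^ i                                       ≡⟨ cong (λ q → f * q ^ i) K≡½*2K ⟩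
      f * (½ * (fromℕ 2 * K)) ^ i                     ≡⟨ cong (f *_) (^-distrib-* ½ (fromℕ 2 * K) i) ⟩
      f * (½ ^ i * (fromℕ 2 * K) ^ i)                 ≤⟨ *-monoˡ (0≤expCoeff i) (*-monoˡ (0≤^ i (<⇒≤ 0<½)) (^-mono i (0≤* (0≤fromℕ 2) 0≤K) 2K≤S)) ⟩
      f * (½ ^ i * S ^ i)                             ≡⟨ solve 3 (λ f h s → f :* (h :* s) := f :* s :* h) refl f (½ ^ i) (S ^ i) ⟩
      f * S ^ i * ½ ^ i                               ≤⟨ *-monoʳ (0≤^ i (<⇒≤ 0<½)) (coeff i) ⟩
      C * ½ ^ i                                       ∎
      where f = expCoeff i

  artanhCoeff-dominated : ∀ B → 0ℚ ≤ B →
    ∀ i → ∣ artanhCoeff (suc i) ∣ * (fromℕ (suc i) * B ^ i) ≤ 1ℚ * B ^ i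
  artanhCoeff-dominated B 0≤B i = begin
    ∣ c ∣ * (fromℕ (suc i) * B ^ i)     ≡⟨ cong (_* (fromℕ (suc i) * B ^ i)) (0≤p⇒∣p∣≡p 0≤c) ⟩
    c * (fromℕ (suc i) * B ^ i)         ≡⟨ *-assoc c (fromℕ (suc i)) (B ^ i) ⟨
    c * fromℕ (suc i) * B ^ i           ≤⟨ *-monoʳ (0≤^ i 0≤B) (*-monoˡ 0≤c (fromℕ-mono i+1≤d)) ⟩
    c * fromℕ d * B ^ i                 ≡⟨ cong (_* B ^ i) (/-*-cancel 1 d) ⟩
    1ℚ * B ^ i                          ∎
    where
    d = suc (2 ℕ.* suc i)
    c = artanhCoeff (suc i)
    0≤c = 0≤/ 1 d
    i+1≤d : suc i ℕ.≤ d
    i+1≤d = ℕₚ.≤-trans (ℕₚ.m≤n*m (suc i) 2) (ℕₚ.n≤1+n (2 ℕ.* suc i))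

open Rational

Cauchy : (ℕ → ℚ) → Set
Cauchy f = ∀ ε → 0ℚ ℚ.< ε → ∃[ N ] ∀ m n → N ℕ.≤ m → N ℕ.≤ n → ∣ f m ℚ.- f n ∣ ℚ.≤ ε

record ℝ : Set where
  no-eta-equality
  constructor mkℝ
  field
    seq    : ℕ → ℚ
    cauchy : Cauchy seq
open ℝ public

infix 4 _<_ _≤_
infix 8 -_
infixl 7 _*_
infixl 6 _+_ _-_

_<_ : ℝ → ℝ → Set
x < y = ∃[ ε ] 0ℚ ℚ.< ε × ∃[ N ] ∀ n → N ℕ.≤ n → seq x n ℚ.+ ε ℚ.≤ seq y n

_≤_ : ℝ → ℝ → Set
x ≤ y = ∀ ε → 0ℚ ℚ.< ε → ∃[ N ] ∀ n → N ℕ.≤ n → seq x n ℚ.≤ seq y n ℚ.+ ε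

fromℚ : ℚ → ℝ
fromℚ q = mkℝ (λ _ → q) λ ε 0<ε → 0 , λ _ _ _ _ → ℚₚ.≤-trans (ℚₚ.≤-reflexive (cong ∣_∣ (ℚₚ.+-inverseʳ q))) (ℚₚ.<⇒≤ 0<ε)

0ℝ 1ℝ 2ℝ : ℝ
0ℝ = fromℚ 0ℚ
1ℝ = fromℚ 1ℚ
2ℝ = fromℚ (fromℕ 2)

natℝ : ℕ → ℝ
natℝ n = fromℚ (fromℕ n)

cauchy-from-≤ : ∀ {f : ℕ → ℚ} →
  (∀ ε → 0ℚ ℚ.< ε → ∃[ N ] ∀ m n → N ℕ.≤ m → m ℕ.≤ n → ∣ f m ℚ.- f n ∣ ℚ.≤ ε) → Cauchy f
cauchy-from-≤ {f} h ε 0<ε = N , λ m n N≤m N≤n → go m n N≤m N≤n (ℕₚ.≤-total m n)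
  where
  N = proj₁ (h ε 0<ε)
  p = proj₂ (h ε 0<ε)
  go : ∀ m n → N ℕ.≤ m → N ℕ.≤ n → m ℕ.≤ n ⊎ n ℕ.≤ m → ∣ f m ℚ.- f n ∣ ℚ.≤ ε
  go m n N≤m N≤n (inj₁ m≤n) = p m n N≤m m≤n
  go m n N≤m N≤n (inj₂ n≤m) = ℚₚ.≤-trans (ℚₚ.≤-reflexive (∣p-q∣≡∣q-p∣ (f m) (f n))) (p n m N≤n n≤m)

Eventually : (ℕ → Set) → Set
Eventually P = ∃[ N ] ∀ n → N ℕ.≤ n → P n

bounded : ∀ {f} → Cauchy f → ∃[ K ] (0ℚ ℚ.≤ K × Eventually λ n → ∣ f n ∣ ℚ.≤ K)
bounded {f} c = ∣ f N ∣ ℚ.+ 1ℚ , 0≤+ (ℚₚ.0≤∣p∣ (f N)) (ℚₚ.<⇒≤ 0<1) ,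
  N , λ n N≤n → ∣-∣-bound (f n) (f N) (p n N N≤n ℕₚ.≤-refl)
  where
  N = proj₁ (c 1ℚ 0<1)
  p = proj₂ (c 1ℚ 0<1)

cauchy-+ : ∀ {f g} → Cauchy f → Cauchy g → Cauchy (λ n → f n ℚ.+ g n)
cauchy-+ {f} {g} cf cg ε 0<ε = M ℕ.⊔ N , λ m n h k →
  ℚₚ.≤-trans (∣-∣-+ (f m) (g m) (f n) (g n))
  (ℚₚ.≤-trans (ℚₚ.+-mono-≤ (p m n (ℕₚ.m⊔n≤o⇒m≤o M N h) (ℕₚ.m⊔n≤o⇒m≤o M N k))
                           (q m n (ℕₚ.m⊔n≤o⇒n≤o M N h) (ℕₚ.m⊔n≤o⇒n≤o M N k)))
              (ℚₚ.≤-reflexive (half+half ε)))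
  where
  F = cf (½ ℚ.* ε) (0<half 0<ε)
  G = cg (½ ℚ.* ε) (0<half 0<ε)
  M = proj₁ F
  p = proj₂ F
  N = proj₁ G
  q = proj₂ G

cauchy-neg : ∀ {f} → Cauchy f → Cauchy (λ n → ℚ.- f n)
cauchy-neg {f} c ε 0<ε = proj₁ (c ε 0<ε) , λ m n h k →
  ℚₚ.≤-trans (ℚₚ.≤-reflexive (∣-∣-neg (f m) (f n))) (proj₂ (c ε 0<ε) n m k h)

cauchy-* : ∀ {f g} → Cauchy f → Cauchy g → Cauchy (λ n → f n ℚ.* g n)
cauchy-* {f} {g} cf cg ε 0<ε = go (bounded {f} cf) (bounded {g} cg)
  where
  go : ∃[ K ] (0ℚ ℚ.≤ K × Eventually λ n → ∣ f n ∣ ℚ.≤ K) →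
       ∃[ L ] (0ℚ ℚ.≤ L × Eventually λ n → ∣ g n ∣ ℚ.≤ L) →
       ∃[ N ] ∀ m n → N ℕ.≤ m → N ℕ.≤ n → ∣ f m ℚ.* g m ℚ.- f n ℚ.* g n ∣ ℚ.≤ ε
  go (K , 0≤K , M , p) (L , 0≤L , N , q) =
    go′ (scale L (0<half 0<ε) 0≤L) (scale K (0<half 0<ε) 0≤K)
    where
    go′ : ∃[ δ ] (0ℚ ℚ.< δ × δ ℚ.* L ℚ.≤ ½ ℚ.* ε) → ∃[ η ] (0ℚ ℚ.< η × η ℚ.* K ℚ.≤ ½ ℚ.* ε) →
          ∃[ N ] ∀ m n → N ℕ.≤ m → N ℕ.≤ n → ∣ f m ℚ.* g m ℚ.- f n ℚ.* g n ∣ ℚ.≤ ε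
    go′ (δ , 0<δ , δL) (η , 0<η , ηK) = (M ℕ.⊔ N) ℕ.⊔ (M′ ℕ.⊔ N′) , λ m n h k →
      ℚₚ.≤-trans (∣-∣-* (f m) (g m) (f n) (g n))
      (ℚₚ.≤-trans (ℚₚ.+-mono-≤
        (*-mono-≤ (ℚₚ.0≤∣p∣ (f m ℚ.- f n)) 0≤L
          (proj₂ F m n (ℕₚ.m⊔n≤o⇒m≤o M′ N′ (right h)) (ℕₚ.m⊔n≤o⇒m≤o M′ N′ (right k)))
          (q m (ℕₚ.m⊔n≤o⇒n≤o M N (left h))))
        (*-mono-≤ (ℚₚ.0≤∣p∣ (g m ℚ.- g n)) 0≤K
          (proj₂ G m n (ℕₚ.m⊔n≤o⇒n≤o M′ N′ (right h)) (ℕₚ.m⊔n≤o⇒n≤o M′ N′ (right k)))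
          (p n (ℕₚ.m⊔n≤o⇒m≤o M N (left k)))))
      (ℚₚ.≤-trans (ℚₚ.+-mono-≤ δL ηK) (ℚₚ.≤-reflexive (half+half ε))))
      where
      F = cf δ 0<δ
      G = cg η 0<η
      M′ = proj₁ F
      N′ = proj₁ G
      left : ∀ {o} → (M ℕ.⊔ N) ℕ.⊔ (M′ ℕ.⊔ N′) ℕ.≤ o → M ℕ.⊔ N ℕ.≤ o
      left = ℕₚ.m⊔n≤o⇒m≤o (M ℕ.⊔ N) (M′ ℕ.⊔ N′)
      right : ∀ {o} → (M ℕ.⊔ N) ℕ.⊔ (M′ ℕ.⊔ N′) ℕ.≤ o → M′ ℕ.⊔ N′ ℕ.≤ o
      right = ℕₚ.m⊔n≤o⇒n≤o (M ℕ.⊔ N) (M′ ℕ.⊔ N′)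

_+_ : ℝ → ℝ → ℝ
x + y = mkℝ (λ n → seq x n ℚ.+ seq y n) (cauchy-+ {seq x} {seq y} (cauchy x) (cauchy y))

-_ : ℝ → ℝ
- x = mkℝ (λ n → ℚ.- seq x n) (cauchy-neg {seq x} (cauchy x))

_*_ : ℝ → ℝ → ℝ
x * y = mkℝ (λ n → seq x n ℚ.* seq y n) (cauchy-* {seq x} {seq y} (cauchy x) (cauchy y))

_-_ : ℝ → ℝ → ℝ
x - y = x + (- y)

record ℝ⁺ : Set where
  constructor mkℝ⁺
  field
    val : ℝ
    pos : 0ℝ < val
open ℝ⁺ public

module _ where
  positive-above : ∀ {x} ((ε , _) : 0ℝ < x) → Eventually λ n → ε ℚ.≤ seq x n
  positive-above (ε , _ , N , h) = N , λ n N≤n → ℚₚ.≤-trans (ℚₚ.≤-reflexive (sym (ℚₚ.+-identityˡ ε))) (h n N≤n)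

  cauchy-inv : ∀ {f ε} (0<ε : 0ℚ ℚ.< ε) → Cauchy f → (Eventually λ n → ε ℚ.≤ f n) →
               Cauchy (λ n → inv (f n ⊔ ε) (0<⊔ (f n) 0<ε))
  cauchy-inv {f} {ε} 0<ε c (N , h) η 0<η = M ℕ.⊔ N , λ m n M⊔N≤m M⊔N≤n →
    ℚₚ.≤-trans (inv-lipschitz 0<ε (0<⊔ (f m) 0<ε) (0<⊔ (f n) 0<ε) (ℚₚ.p≤q⊔p (f m) ε) (ℚₚ.p≤q⊔p (f n) ε))
    (ℚₚ.≤-trans (*-monoʳ 0≤K (ℚₚ.≤-trans
        (ℚₚ.≤-reflexive (cong₂ (λ a b → ∣ a ℚ.- b ∣) (ℚₚ.p≥q⇒p⊔q≡p (h m (right M⊔N≤m))) (ℚₚ.p≥q⇒p⊔q≡p (h n (right M⊔N≤n)))))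
        (proj₂ C m n (left M⊔N≤m) (left M⊔N≤n))))
      (proj₂ (proj₂ δ)))
    where
    K = inv ε 0<ε ℚ.* inv ε 0<ε
    0≤K = 0≤* (ℚₚ.<⇒≤ (inv-pos ε 0<ε)) (ℚₚ.<⇒≤ (inv-pos ε 0<ε))
    δ = scale K 0<η 0≤K
    C = c (proj₁ δ) (proj₁ (proj₂ δ))
    M = proj₁ C
    left : ∀ {o} → M ℕ.⊔ N ℕ.≤ o → M ℕ.≤ o
    left = ℕₚ.m⊔n≤o⇒m≤o M N
    right : ∀ {o} → M ℕ.⊔ N ℕ.≤ o → N ℕ.≤ o
    right = ℕₚ.m⊔n≤o⇒n≤o M N

-- With ε the witness of positivity, ε ≤ xₙ for all large n; taking the maximum
-- with ε only affects the finitely many earlier terms, which could vanish.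
recip : ℝ⁺ → ℝ
recip (mkℝ⁺ x p@(ε , 0<ε , _)) =
  mkℝ (λ n → inv (seq x n ⊔ ε) (0<⊔ (seq x n) 0<ε)) (cauchy-inv {seq x} 0<ε (cauchy x) (positive-above {x} p))

infixl 7 _/_ _/⁺_

_/_ : ℝ → ℝ⁺ → ℝ
x / y = x * recip y

module _ where
  *-pos : ∀ {x y} → 0ℝ < x → 0ℝ < y → 0ℝ < x * y
  *-pos {x} {y} p@(ε , 0<ε , _) q@(δ , 0<δ , _) = ε ℚ.* δ , 0<* 0<ε 0<δ , M ℕ.⊔ N , λ n h →
    ℚₚ.≤-trans (ℚₚ.≤-reflexive (ℚₚ.+-identityˡ (ε ℚ.* δ)))
      (*-mono-≤ (ℚₚ.<⇒≤ 0<ε) (ℚₚ.≤-trans (ℚₚ.<⇒≤ 0<δ) (proj₂ Y n (ℕₚ.m⊔n≤o⇒n≤o M N h)))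
        (proj₂ X n (ℕₚ.m⊔n≤o⇒m≤o M N h)) (proj₂ Y n (ℕₚ.m⊔n≤o⇒n≤o M N h)))
    where
    X = positive-above {x} p
    Y = positive-above {y} q
    M = proj₁ X
    N = proj₁ Y

  recip-pos : ∀ x → 0ℝ < recip x
  recip-pos (mkℝ⁺ x (ε , 0<ε , _)) = go (bounded {seq x} (cauchy x))
    where
    go : ∃[ K ] (0ℚ ℚ.≤ K × Eventually λ n → ∣ seq x n ∣ ℚ.≤ K) →
         ∃[ δ ] 0ℚ ℚ.< δ × ∃[ N ] ∀ n → N ℕ.≤ n → 0ℚ ℚ.+ δ ℚ.≤ inv (seq x n ⊔ ε) (0<⊔ (seq x n) 0<ε)
    go (K , 0≤K , N , h) = inv (K ⊔ ε) 0<K⊔ε , inv-pos (K ⊔ ε) 0<K⊔ε , N , λ n N≤n →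
      ℚₚ.≤-trans (ℚₚ.≤-reflexive (ℚₚ.+-identityˡ (inv (K ⊔ ε) 0<K⊔ε)))
        (inv-antimono (0<⊔ (seq x n) 0<ε) 0<K⊔ε (ℚₚ.⊔-monoˡ-≤ ε (ℚₚ.≤-trans (p≤∣p∣ (seq x n)) (h n N≤n))))
      where
      0<K⊔ε = 0<⊔ K 0<ε

  +1-pos : ∀ {x} → 0ℝ < x → 0ℝ < x + 1ℝ
  +1-pos {x} p@(ε , 0<ε , _) = 1ℚ , 0<1 , proj₁ X , λ n h →
    ℚₚ.+-monoˡ-≤ 1ℚ (ℚₚ.≤-trans (ℚₚ.<⇒≤ 0<ε) (proj₂ X n h))
    where X = positive-above {x} p

_+1⁺ : ℝ⁺ → ℝ⁺
mkℝ⁺ x p +1⁺ = mkℝ⁺ (x + 1ℝ) (+1-pos {x} p)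

2⁺ : ℝ⁺
2⁺ = mkℝ⁺ 2ℝ (1ℚ , 0<1 , 0 , λ _ _ → fromℕ-mono {1} {2} (ℕ.s≤s ℕ.z≤n))

_/⁺_ : ℝ⁺ → ℝ⁺ → ℝ⁺
x /⁺ y = mkℝ⁺ (val x / y) (*-pos {val x} {recip y} (pos x) (recip-pos y))

-- ∑ aᵢ xⁱ converges: on |x| ≤ B its termwise derivative is dominated by ∑ C rⁱ
record Dominated (a : ℕ → ℚ) (x : ℝ) : Set where
  field
    B C r     : ℚ
    0≤r       : 0ℚ ℚ.≤ r
    r<1       : r ℚ.< 1ℚ
    0≤B       : 0ℚ ℚ.≤ B
    bound     : Eventually λ n → ∣ seq x n ∣ ℚ.≤ B
    dominated : ∀ i → ∣ a (suc i) ∣ ℚ.* (fromℕ (suc i) ℚ.* B ^ i) ℚ.≤ C ℚ.* r ^ i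

module _ where
  cauchy-series : ∀ {a x} → Dominated a x → Cauchy (λ n → truncation a (seq x n) n)
  cauchy-series {a} {x} d = cauchy-from-≤ {λ n → truncation a (seq x n) n} λ ε 0<ε →
    go (0<half 0<ε) (scale K₁ (0<half 0<ε) 0≤K₁) (^-vanish 0≤r r<1 K₂ (½ ℚ.* ε) 0≤K₂ (0<half 0<ε))
    where
    open Dominated d
    G = geo 0≤r r<1
    C≥0 = 0≤C {a} {B} {C} {r} 0≤r r<1 0≤B dominated
    K₁ = C ℚ.* G
    K₂ = B ℚ.* C ℚ.* G
    0≤K₁ = 0≤* C≥0 (0≤geo 0≤r r<1)
    0≤K₂ = 0≤* (0≤* 0≤B C≥0) (0≤geo 0≤r r<1)
    N₀ = proj₁ bound
    t : ℕ → ℕ → ℚ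
    t m n = truncation a (seq x m) n
    go : ∀ {ε} → 0ℚ ℚ.< ½ ℚ.* ε → ∃[ δ ] (0ℚ ℚ.< δ × δ ℚ.* K₁ ℚ.≤ ½ ℚ.* ε) → ∃[ M ] r ^ M ℚ.* K₂ ℚ.≤ ½ ℚ.* ε →
         ∃[ N ] ∀ m n → N ℕ.≤ m → m ℕ.≤ n → ∣ t m m ℚ.- t n n ∣ ℚ.≤ ε
    go {ε} _ (δ , 0<δ , δK) (M , rM) = suc (N₀ ℕ.⊔ (N₁ ℕ.⊔ M)) , est
      where
      N₁ = proj₁ (cauchy x δ 0<δ)
      est : ∀ m n → suc (N₀ ℕ.⊔ (N₁ ℕ.⊔ M)) ℕ.≤ m → m ℕ.≤ n → ∣ t m m ℚ.- t n n ∣ ℚ.≤ ε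
      est (suc m) (suc n) (ℕ.s≤s N≤m) (ℕ.s≤s m≤n) =
        ℚₚ.≤-trans (∣-∣-triangle (t (suc m) (suc m)) (t (suc n) (suc m)) (t (suc n) (suc n)))
        (ℚₚ.≤-trans (ℚₚ.+-mono-≤ first second) (ℚₚ.≤-reflexive (half+half ε)))
        where
        N₀≤m = ℕₚ.m⊔n≤o⇒m≤o N₀ (N₁ ℕ.⊔ M) N≤m
        N₁≤m = ℕₚ.m⊔n≤o⇒m≤o N₁ M (ℕₚ.m⊔n≤o⇒n≤o N₀ (N₁ ℕ.⊔ M) N≤m)
        M≤m  = ℕₚ.m⊔n≤o⇒n≤o N₁ M (ℕₚ.m⊔n≤o⇒n≤o N₀ (N₁ ℕ.⊔ M) N≤m)
        xm≤B = proj₂ bound (suc m) (ℕₚ.m≤n⇒m≤1+n N₀≤m)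
        xn≤B = proj₂ bound (suc n) (ℕₚ.m≤n⇒m≤1+n (ℕₚ.≤-trans N₀≤m m≤n))
        first : ∣ t (suc m) (suc m) ℚ.- t (suc n) (suc m) ∣ ℚ.≤ ½ ℚ.* ε
        first = ℚₚ.≤-trans (truncation-lipschitz {a} {B} {C} {r} 0≤r r<1 0≤B dominated xm≤B xn≤B m)
          (ℚₚ.≤-trans (*-monoʳ 0≤K₁ (proj₂ (cauchy x δ 0<δ) (suc m) (suc n) (ℕₚ.m≤n⇒m≤1+n N₁≤m) (ℕₚ.m≤n⇒m≤1+n (ℕₚ.≤-trans N₁≤m m≤n)))) δK)
        second : ∣ t (suc n) (suc m) ℚ.- t (suc n) (suc n) ∣ ℚ.≤ ½ ℚ.* ε
        second = ℚₚ.≤-trans (ℚₚ.≤-reflexive (∣p-q∣≡∣q-p∣ (t (suc n) (suc m)) (t (suc n) (suc n))))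
          (ℚₚ.≤-trans (truncation-tail {a} {B} {C} {r} 0≤r r<1 0≤B dominated xn≤B m≤n)
          (ℚₚ.≤-trans (*-monoʳ 0≤K₂ (^-decr 0≤r r<1 M≤m)) rM))

-- The Cauchy sequence of the truncations at degree < n, each evaluated at the n-th approximation of x
powerSeries : (a : ℕ → ℚ) (x : ℝ) → Dominated a x → ℝ
powerSeries a x d = mkℝ (λ n → truncation a (seq x n) n) (cauchy-series {a} {x} d)

module _ where
  exp-dominated : ∀ x → Dominated expCoeff x
  exp-dominated x = record
    { B         = proj₁ b
    ; C         = proj₁ dom
    ; r         = ½
    ; 0≤r       = ℚₚ.<⇒≤ 0<½
    ; r<1       = ½<1
    ; 0≤B       = proj₁ (proj₂ b)
    ; bound     = proj₂ (proj₂ b)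
    ; dominated = proj₂ dom
    }
    where
    b = bounded {seq x} (cauchy x)
    dom = expCoeff-dominated (proj₁ b) (proj₁ (proj₂ b))
    ½<1 : ½ ℚ.< 1ℚ
    ½<1 = ℚ.*<* (ℤ.+<+ (ℕ.s≤s (ℕ.s≤s ℕ.z≤n)))

exp : ℝ → ℝ
exp x = powerSeries expCoeff x (exp-dominated x)

ratio : ℝ⁺ → ℝ
ratio y = (val y - 1ℝ) / (y +1⁺)

module _ where
  log-dominated : ∀ y → Dominated artanhCoeff (ratio y * ratio y)
  log-dominated (mkℝ⁺ x p@(ε , 0<ε , _)) = record
    { B         = b
    ; C         = 1ℚ
    ; r         = b
    ; 0≤r       = 0≤b
    ; r<1       = cayley-bound<1 0<ε 0≤K
    ; 0≤B       = 0≤b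
    ; bound     = bnd
    ; dominated = artanhCoeff-dominated b 0≤b
    }
    where
    K = proj₁ (bounded {seq x} (cauchy x))
    0≤K = proj₁ (proj₂ (bounded {seq x} (cauchy x)))
    upper = proj₂ (proj₂ (bounded {seq x} (cauchy x)))
    lower = positive-above {x} p
    b = cayley-bound 0<ε 0≤K
    y = mkℝ⁺ x p
    bnd : Eventually λ n → ∣ seq (ratio y * ratio y) n ∣ ℚ.≤ b
    bnd = proj₁ lower ℕ.⊔ proj₁ upper , λ n h → cayley {ε} {K} 0<ε 0≤K {seq x n} (0<⊔ (seq x n ℚ.+ 1ℚ) 0<1)
      (proj₂ lower n (ℕₚ.m⊔n≤o⇒m≤o (proj₁ lower) (proj₁ upper) h))
      (ℚₚ.≤-trans (p≤∣p∣ (seq x n)) (proj₂ upper n (ℕₚ.m⊔n≤o⇒n≤o (proj₁ lower) (proj₁ upper) h)))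
    0≤b : 0ℚ ℚ.≤ b
    0≤b = ℚₚ.≤-trans (ℚₚ.0≤∣p∣ (seq (ratio y * ratio y) (proj₁ bnd))) (proj₂ bnd (proj₁ bnd) ℕₚ.≤-refl)

-- log y = 2 artanh z = 2 z Σ (z²)ⁱ / (2i + 1) with z = (y - 1) / (y + 1),
-- which converges for every y > 0 since then |z| < 1
log : ℝ⁺ → ℝ
log y = 2ℝ * (ratio y * powerSeries artanhCoeff (ratio y * ratio y) (log-dominated y))

-- A : Subset N stands for a subset of {1, …, N}, with i : Fin N standing for i + 1
elements : ∀ {N} → Subset N → List ℕ
elements {N} A = map (λ i → suc (toℕ i)) (filter (_∈? A) (allFin N))

tuples : List ℕ → (m : ℕ) → List (Vec ℕ m)
tuples xs zero    = [] ∷ []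
tuples xs (suc m) = cartesianProductWith _∷_ xs (tuples xs m)

-- Solutions of x₁ + ⋯ + xₖ₋₁ = (k - 1) xₖ in A, the tuple being ((x₁ , … , xₖ₋₁) , xₖ)
solutions : (k : ℕ) → ∀ {N} → Subset N → List (Vec ℕ (k ℕ.∸ 1) × ℕ)
solutions k A = filter (λ (xs , y) → Vec.sum xs ℕₚ.≟ (k ℕ.∸ 1) ℕ.* y)
                       (cartesianProduct (tuples (elements A) (k ℕ.∸ 1)) (elements A))

{-# OPTIONS --safe #-}
module Submission where

open import Algebra.Definitions.RawSemiring as RawSemiring using ()
import Data.Integer.Base as ℤ
open import Data.Nat.Base as ℕ using (ℕ; zero; suc) hiding (module ℕ)
import Data.Nat.Properties as ℕₚ
open import Data.Nat.Tactic.RingSolver using (solve-∀)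
open import Data.Product.Base using (∃-syntax; Σ-syntax; _×_; _,_; proj₁; proj₂)
open import Data.Rational.Base as ℚ using (ℚ; 0ℚ; 1ℚ; ½) hiding (module ℚ)
import Data.Rational.Properties as ℚₚ
open import Data.Rational.Solver using (module +-*-Solver)
open import Data.Sum.Base using (_⊎_; inj₁; inj₂; [_,_]′)
open import Function.Base using (_∘_)
open import Relation.Binary.PropositionalEquality
open import Relation.Nullary using (Dec; yes; no; does; contradiction; ¬_)
import Defs

-- Behrend's construction. Let q = k - 1 = s + 1. Among the vectors in {0, …, d - 1}ⁿ choose a most
-- popular sphere and read its points as numbers in base B = 2ˢ d ≥ q d, so that the equation holds
-- digit by digit; by strict convexity the sphere only contains the solutions x₁ = ⋯ = xₖ. Blow each
-- point up to an initial segment of proportion 2⁻ˢ ≤ 1/q of an interval of arbitrary length. With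
-- M = Bⁿ, the resulting set has at most M^{-(q-1)} N^q solutions. For d = 2^{2sn} its density is at
-- least 2^{-O(sn)}, while M^{q-1} = 2^{Ω(s²n²)}, so with α of order 2^{-7sn} the saving is
-- exp(-c log²(2/α)) with c independent of k.
--
-- On the analytic side only crude bounds are needed: log y = O(m) for 1 ≤ y ≤ 2ᵐ, from the artanh
-- series compared with the harmonic sum up to 2ᵐ, and exp(-t) ≥ 4^{-T}/2 for 0 ≤ t ≤ T, from
-- exp t exp(-t) = 1 and exp T ≤ 4^T.

-- N has to grow while α stays fixed, and α fixes the dimension n and the side d. This is why the
-- points of the sphere are blown up: neither the density bound nor the saving depends on the length
-- of the blow-up.
--
-- The size of d balances two effects. The density pays about 2^(sn) for the base and d^2 for the
-- sphere, while the saving is at least d^(sn). With log d proportional to sn, log(1/α) has order sn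
-- and the logarithm of the saving has order (sn)^2, with proportions that do not involve k. Powers
-- of two throughout turn the bookkeeping into inequalities between exponents.
--
-- Two obstacles come from the reals. The n-th term of `exp` or `log` is a truncated series
-- evaluated at an n-th approximation, so every analytic estimate is proved for rational partial
-- sums, uniformly in the argument. And the order of the reals cannot be decided, so α cannot be
-- placed between consecutive powers of 2^(-7s) exactly; overlapping ranges are used instead, and
-- their overlap, a factor 2, is paid for in the density.

module Series where
  open ℚ using (_+_; _*_; _-_; -_; _≤_; _<_; ∣_∣; _⊔_)
  open ℚₚ
  open RawSemiring ℚ.+-*-rawSemiring using (_^_)
  open Defs using (fromℕ; sumTo; expCoeff; artanhCoeff; expCoeff-suc; 0≤expCoeff; expCoeff-dominated)
  open Defs.Rational
  open +-*-Solver using (solve; _:+_; _:*_; _:-_; :-_; con; _:=_)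
  open ≤-Reasoning

  -- Finite sums and Cauchy products of rational sequences

  sumTo-cong : ∀ n {f g} → (∀ i → f i ≡ g i) → sumTo n f ≡ sumTo n g
  sumTo-cong zero    _   = refl
  sumTo-cong (suc n) f≡g = cong₂ _+_ (sumTo-cong n f≡g) (f≡g n)

  sumTo-mono : ∀ n {f g} → (∀ i → i ℕ.< n → f i ≤ g i) → sumTo n f ≤ sumTo n g
  sumTo-mono zero    _   = ≤-refl
  sumTo-mono (suc n) f≤g = +-mono-≤ (sumTo-mono n λ i i<n → f≤g i (ℕₚ.m<n⇒m<1+n i<n)) (f≤g n ℕₚ.≤-refl)

  sumTo-*ˡ : ∀ c n f → sumTo n (λ i → c * f i) ≡ c * sumTo n f
  sumTo-*ˡ c zero    f = sym (*-zeroʳ c)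
  sumTo-*ˡ c (suc n) f = trans (cong (_+ c * f n) (sumTo-*ˡ c n f)) (sym (*-distribˡ-+ c (sumTo n f) (f n)))

  sumTo-const : ∀ n c → sumTo n (λ _ → c) ≡ fromℕ n * c
  sumTo-const zero    c = sym (*-zeroˡ c)
  sumTo-const (suc n) c = begin-equality
    sumTo n (λ _ → c) + c    ≡⟨ cong (_+ c) (sumTo-const n c) ⟩
    fromℕ n * c + c          ≡⟨ solve 2 (λ a c → a :* c :+ c := (con 1ℚ :+ a) :* c) refl (fromℕ n) c ⟩
    (1ℚ + fromℕ n) * c       ≡⟨ cong (_* c) (fromℕ-+ 1 n) ⟨
    fromℕ (suc n) * c        ∎

  0≤sumTo : ∀ n {f} → (∀ i → 0ℚ ≤ f i) → 0ℚ ≤ sumTo n f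
  0≤sumTo zero    _   = ≤-refl
  0≤sumTo (suc n) 0≤f = 0≤+ (0≤sumTo n 0≤f) (0≤f n)

  sumTo-++ : ∀ m n f → sumTo (m ℕ.+ n) f ≡ sumTo m f + sumTo n (λ i → f (m ℕ.+ i))
  sumTo-++ m zero    f = trans (cong (λ k → sumTo k f) (ℕₚ.+-identityʳ m)) (sym (+-identityʳ (sumTo m f)))
  sumTo-++ m (suc n) f = begin-equality
    sumTo (m ℕ.+ suc n) f                   ≡⟨ cong (λ k → sumTo k f) (ℕₚ.+-suc m n) ⟩
    sumTo (m ℕ.+ n) f + f (m ℕ.+ n)         ≡⟨ cong (_+ f (m ℕ.+ n)) (sumTo-++ m n f) ⟩
    sumTo m f + sumTo n g + f (m ℕ.+ n)     ≡⟨ +-assoc (sumTo m f) (sumTo n g) (f (m ℕ.+ n)) ⟩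
    sumTo m f + (sumTo n g + f (m ℕ.+ n))   ∎
    where g = λ i → f (m ℕ.+ i)

  sumTo-head : ∀ n f → sumTo (suc n) f ≡ f 0 + sumTo n (λ i → f (suc i))
  sumTo-head n f = trans (sumTo-++ 1 n f) (cong (_+ sumTo n (λ i → f (suc i))) (+-identityˡ (f 0)))

  sumTo-monoˡ : ∀ {m n} {f} → (∀ i → 0ℚ ≤ f i) → m ℕ.≤ n → sumTo m f ≤ sumTo n f
  sumTo-monoˡ {m} {n} {f} 0≤f m≤n = begin
    sumTo m f                                     ≡⟨ +-identityʳ (sumTo m f) ⟨
    sumTo m f + 0ℚ                                ≤⟨ +-monoʳ-≤ (sumTo m f) (0≤sumTo (n ℕ.∸ m) λ i → 0≤f (m ℕ.+ i)) ⟩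
    sumTo m f + sumTo (n ℕ.∸ m) (λ i → f (m ℕ.+ i)) ≡⟨ sumTo-++ m (n ℕ.∸ m) f ⟨
    sumTo (m ℕ.+ (n ℕ.∸ m)) f                     ≡⟨ cong (λ k → sumTo k f) (ℕₚ.m+[n∸m]≡n m≤n) ⟩
    sumTo n f                                     ∎

  -- The coefficients of the Cauchy product. The recursion shifts `f`, so that no index n - i
  -- appears.
  conv : (ℕ → ℚ) → (ℕ → ℚ) → ℕ → ℚ
  conv f g zero    = f 0 * g 0
  conv f g (suc n) = f 0 * g (suc n) + conv (λ i → f (suc i)) g n

  conv-congˡ : ∀ {f f′} g n → (∀ i → f i ≡ f′ i) → conv f g n ≡ conv f′ g n
  conv-congˡ g zero    f≡ = cong (_* g 0) (f≡ 0)
  conv-congˡ g (suc n) f≡ = cong₂ (λ a b → a * g (suc n) + b) (f≡ 0) (conv-congˡ g n λ i → f≡ (suc i))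

  conv-congʳ : ∀ f {g g′} n → (∀ i → g i ≡ g′ i) → conv f g n ≡ conv f g′ n
  conv-congʳ f zero    g≡ = cong (f 0 *_) (g≡ 0)
  conv-congʳ f (suc n) g≡ = cong₂ (λ a b → f 0 * a + b) (g≡ (suc n)) (conv-congʳ (λ i → f (suc i)) n g≡)

  conv-+ˡ : ∀ f f′ g n → conv (λ i → f i + f′ i) g n ≡ conv f g n + conv f′ g n
  conv-+ˡ f f′ g zero    = *-distribʳ-+ (g 0) (f 0) (f′ 0)
  conv-+ˡ f f′ g (suc n) = trans
    (cong ((f 0 + f′ 0) * g (suc n) +_) (conv-+ˡ (λ i → f (suc i)) (λ i → f′ (suc i)) g n))
    (solve 5 (λ a b g c d → (a :+ b) :* g :+ (c :+ d) := a :* g :+ c :+ (b :* g :+ d)) refl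
      (f 0) (f′ 0) (g (suc n)) (conv (λ i → f (suc i)) g n) (conv (λ i → f′ (suc i)) g n))

  conv-*ˡ : ∀ c f g n → conv (λ i → c * f i) g n ≡ c * conv f g n
  conv-*ˡ c f g zero    = *-assoc c (f 0) (g 0)
  conv-*ˡ c f g (suc n) = trans (cong (c * f 0 * g (suc n) +_) (conv-*ˡ c (λ i → f (suc i)) g n))
    (solve 4 (λ c f g x → c :* f :* g :+ c :* x := c :* (f :* g :+ x)) refl c (f 0) (g (suc n)) (conv (λ i → f (suc i)) g n))

  conv-*ʳ : ∀ c f g n → conv f (λ i → c * g i) n ≡ c * conv f g n
  conv-*ʳ c f g zero    = solve 3 (λ c f g → f :* (c :* g) := c :* (f :* g)) refl c (f 0) (g 0)
  conv-*ʳ c f g (suc n) = trans (cong (f 0 * (c * g (suc n)) +_) (conv-*ʳ c (λ i → f (suc i)) g n))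
    (solve 4 (λ c f g x → f :* (c :* g) :+ c :* x := c :* (f :* g :+ x)) refl c (f 0) (g (suc n)) (conv (λ i → f (suc i)) g n))

  deriv : (ℕ → ℚ) → ℕ → ℚ
  deriv f i = fromℕ (suc i) * f (suc i)

  -- The product rule for formal power series. In the factor n + 2 = 1 + (n + 1), the spare 1
  -- supplies the head term of `conv (deriv f) g` and the discrepancy `W` between shifting before
  -- and after differentiating.
  leibniz : ∀ f g n → deriv (conv f g) n ≡ conv (deriv f) g n + conv f (deriv g) n
  leibniz f g zero = solve 4 (λ a b c d → con 1ℚ :* (a :* b :+ c :* d) := con 1ℚ :* c :* d :+ a :* (con 1ℚ :* b)) refl
    (f 0) (g 1) (f 1) (g 0)
  leibniz f g (suc n) = begin-equality
    fromℕ (2 ℕ.+ n) * (f 0 * g₂ + X)                      ≡⟨ cong (_* (f 0 * g₂ + X)) (fromℕ-+ 1 (suc n)) ⟩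
    (1ℚ + s) * (f 0 * g₂ + X)                             ≡⟨ solve 4 (λ s f g x → (con 1ℚ :+ s) :* (f :* g :+ x)
                                                              := f :* ((con 1ℚ :+ s) :* g) :+ x :+ s :* x) refl s (f 0) g₂ X ⟩
    f 0 * ((1ℚ + s) * g₂) + X + s * X                     ≡⟨ cong₂ (λ a b → f 0 * (a * g₂) + X + b) (sym (fromℕ-+ 1 (suc n))) (leibniz Sf g n) ⟩
    f 0 * deriv g (suc n) + X + (Y + Z)                   ≡⟨ solve 5 (λ p f g w yz → p :+ (f :* g :+ w) :+ yz := p :+ (con 1ℚ :* f :* g :+ w :+ yz)) refl
                                                              (f 0 * deriv g (suc n)) (f 1) (g (suc n)) W (Y + Z) ⟩
    f 0 * deriv g (suc n) + (1ℚ * f 1 * g (suc n) + W + (Y + Z))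
                                                          ≡⟨ solve 5 (λ p q w y z → p :+ (q :+ w :+ (y :+ z)) := q :+ (y :+ w) :+ (p :+ z)) refl
                                                              (f 0 * deriv g (suc n)) (1ℚ * f 1 * g (suc n)) W Y Z ⟩
    1ℚ * f 1 * g (suc n) + (Y + W) + (f 0 * deriv g (suc n) + Z)
                                                          ≡⟨ cong (λ a → 1ℚ * f 1 * g (suc n) + a + (f 0 * deriv g (suc n) + Z)) (sym shift) ⟩
    conv (deriv f) g (suc n) + conv f (deriv g) (suc n)   ∎
    where
    Sf = λ i → f (suc i)
    g₂ = g (2 ℕ.+ n)
    s = fromℕ (suc n)
    X = conv Sf g (suc n)
    Y = conv (deriv Sf) g n
    Z = conv Sf (deriv g) n
    W = conv (λ i → f (2 ℕ.+ i)) g n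
    shift : conv (λ i → deriv f (suc i)) g n ≡ Y + W
    shift = trans
      (conv-congˡ g n λ i → trans (cong (_* f (2 ℕ.+ i)) (fromℕ-+ 1 (suc i)))
        (solve 2 (λ a f → (con 1ℚ :+ a) :* f := a :* f :+ f) refl (fromℕ (suc i)) (f (2 ℕ.+ i))))
      (conv-+ˡ (deriv Sf) (λ i → f (2 ℕ.+ i)) g n)

  -- The first n coefficients of the product collect f i * g j over the triangle i + j < n, and row
  -- i of the triangle is f i times a partial sum of g. The sequence g may change sign.
  convSum-≤ : ∀ n {f g U} → (∀ i → 0ℚ ≤ f i) → (∀ j → j ℕ.≤ n → sumTo j g ≤ U) →
              sumTo n (conv f g) ≤ sumTo n f * U
  convSum-head : ∀ n f g → sumTo (suc n) (conv f g) ≡ f 0 * sumTo (suc n) g + sumTo n (conv (λ i → f (suc i)) g)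

  convSum-head zero f g = solve 2 (λ a b → con 0ℚ :+ a :* b := a :* (con 0ℚ :+ b) :+ con 0ℚ) refl (f 0) (g 0)
  convSum-head (suc n) f g = trans (cong (_+ conv f g (suc n)) (convSum-head n f g))
    (solve 5 (λ a b c d e → a :* b :+ c :+ (a :* d :+ e) := a :* (b :+ d) :+ (c :+ e)) refl
      (f 0) (sumTo (suc n) g) (sumTo n (conv (λ i → f (suc i)) g)) (g (suc n)) (conv (λ i → f (suc i)) g n))

  convSum-≤ zero {U = U} _ _ = ≤-reflexive (sym (*-zeroˡ U))
  convSum-≤ (suc n) {f} {g} {U} 0≤f G≤U = begin
    sumTo (suc n) (conv f g)                      ≡⟨ convSum-head n f g ⟩
    f 0 * sumTo (suc n) g + sumTo n (conv Sf g)   ≤⟨ +-mono-≤ (*-monoˡ (0≤f 0) (G≤U (suc n) ℕₚ.≤-refl))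
                                                      (convSum-≤ n (λ i → 0≤f (suc i)) λ j j≤n → G≤U j (ℕₚ.m≤n⇒m≤1+n j≤n)) ⟩
    f 0 * U + sumTo n Sf * U                      ≡⟨ *-distribʳ-+ U (f 0) (sumTo n Sf) ⟨
    (f 0 + sumTo n Sf) * U                        ≡⟨ cong (_* U) (sumTo-head n f) ⟨
    sumTo (suc n) f * U                           ∎
    where Sf = λ i → f (suc i)

  -- The products fᵢ gⱼ with i < m only meet partial sums of g that are longer than p.
  convSum-split-≤ : ∀ m p {f g U V} → (∀ i → 0ℚ ≤ f i) →
    (∀ j → p ℕ.< j → j ℕ.≤ m ℕ.+ p → sumTo j g ≤ U) → (∀ j → j ℕ.≤ p → sumTo j g ≤ V) →
    sumTo (m ℕ.+ p) (conv f g) ≤ sumTo m f * U + sumTo p (λ i → f (m ℕ.+ i)) * V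
  convSum-split-≤ zero p {f} {g} {U} {V} 0≤f _ G≤V = begin
    sumTo p (conv f g)            ≤⟨ convSum-≤ p 0≤f G≤V ⟩
    sumTo p f * V                 ≡⟨ solve 2 (λ a u → a := con 0ℚ :* u :+ a) refl (sumTo p f * V) U ⟩
    0ℚ * U + sumTo p f * V        ∎
  convSum-split-≤ (suc m) p {f} {g} {U} {V} 0≤f G≤U G≤V = begin
    sumTo (suc m ℕ.+ p) (conv f g)
      ≡⟨ convSum-head (m ℕ.+ p) f g ⟩
    f 0 * sumTo (suc m ℕ.+ p) g + sumTo (m ℕ.+ p) (conv Sf g)
      ≤⟨ +-mono-≤ (*-monoˡ (0≤f 0) (G≤U (suc m ℕ.+ p) (ℕ.s≤s (ℕₚ.m≤n+m p m)) ℕₚ.≤-refl))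
          (convSum-split-≤ m p (λ i → 0≤f (suc i)) (λ j p<j j≤ → G≤U j p<j (ℕₚ.m≤n⇒m≤1+n j≤)) G≤V) ⟩
    f 0 * U + (sumTo m Sf * U + tail)
      ≡⟨ solve 4 (λ a u b t → a :* u :+ (b :* u :+ t) := (a :+ b) :* u :+ t) refl (f 0) U (sumTo m Sf) tail ⟩
    (f 0 + sumTo m Sf) * U + tail
      ≡⟨ cong (λ a → a * U + tail) (sumTo-head m f) ⟨
    sumTo (suc m) f * U + tail ∎
    where
    Sf = λ i → f (suc i)
    tail = sumTo p (λ i → f (suc m ℕ.+ i)) * V

  -- Partial sums of the exponential series

  ½<1 : ½ < 1ℚ
  ½<1 = ℚ.*<* (ℤ.+<+ (ℕ.s≤s (ℕ.s≤s ℕ.z≤n)))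

  0<½^ : ∀ n → 0ℚ < ½ ^ n
  0<½^ zero    = 0<1
  0<½^ (suc n) = 0<* 0<½ (0<½^ n)

  expTerm : ℚ → ℕ → ℚ
  expTerm x i = expCoeff i * x ^ i

  deriv-expTerm : ∀ x i → deriv (expTerm x) i ≡ x * expTerm x i
  deriv-expTerm x i = begin-equality
    s * (e′ * (x * x ^ i))     ≡⟨ solve 4 (λ s e x y → s :* (e :* (x :* y)) := x :* (e :* s :* y)) refl s e′ x (x ^ i) ⟩
    x * (e′ * s * x ^ i)       ≡⟨ cong (λ a → x * (a * x ^ i)) (expCoeff-suc i) ⟩
    x * (expCoeff i * x ^ i)   ∎
    where
    s = fromℕ (suc i)
    e′ = expCoeff (suc i)

  *-cancelˡ-fromℕ-suc : ∀ n {p q} → fromℕ (suc n) * p ≡ fromℕ (suc n) * q → p ≡ q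
  *-cancelˡ-fromℕ-suc n eq = ≤-antisym (cancel (≤-reflexive eq)) (cancel (≤-reflexive (sym eq)))
    where
    cancel : ∀ {p q} → fromℕ (suc n) * p ≤ fromℕ (suc n) * q → p ≤ q
    cancel = *-cancelˡ-≤-pos (fromℕ (suc n)) {{ℚ.positive (0<fromℕ-suc n)}}

  -- The binomial theorem without binomial coefficients: both sides are coefficients of a formal
  -- series h with h' = (x + y) h and constant term 1, and this equation determines each coefficient
  -- from the previous one.
  conv-expTerm : ∀ x y n → conv (expTerm x) (expTerm y) n ≡ expTerm (x + y) n
  conv-expTerm x y zero    = refl
  conv-expTerm x y (suc n) = *-cancelˡ-fromℕ-suc n (begin-equality
    s * conv X Y (suc n)                               ≡⟨ leibniz X Y n ⟩
    conv (deriv X) Y n + conv X (deriv Y) n            ≡⟨ cong₂ _+_ (trans (conv-congˡ Y n (deriv-expTerm x)) (conv-*ˡ x X Y n))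
                                                                    (trans (conv-congʳ X n (deriv-expTerm y)) (conv-*ʳ y X Y n)) ⟩
    x * conv X Y n + y * conv X Y n                    ≡⟨ *-distribʳ-+ (conv X Y n) x y ⟨
    (x + y) * conv X Y n                               ≡⟨ cong ((x + y) *_) (conv-expTerm x y n) ⟩
    (x + y) * expTerm (x + y) n                        ≡⟨ deriv-expTerm (x + y) n ⟨
    s * expTerm (x + y) (suc n)                        ∎)
    where
    X = expTerm x
    Y = expTerm y
    s = fromℕ (suc n)

  0≤expTerm : ∀ {x} → 0ℚ ≤ x → ∀ i → 0ℚ ≤ expTerm x i
  0≤expTerm 0≤x i = 0≤* (0≤expCoeff i) (0≤^ i 0≤x)

  -- The triangle i + j < n lies inside the square i, j < n.
  expSum-+ : ∀ x y n → 0ℚ ≤ x → 0ℚ ≤ y → sumTo n (expTerm (x + y)) ≤ sumTo n (expTerm x) * sumTo n (expTerm y)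
  expSum-+ x y n 0≤x 0≤y = begin
    sumTo n (expTerm (x + y))                   ≡⟨ sumTo-cong n (conv-expTerm x y) ⟨
    sumTo n (conv (expTerm x) (expTerm y))      ≤⟨ convSum-≤ n (0≤expTerm 0≤x) (λ j → sumTo-monoˡ (0≤expTerm 0≤y)) ⟩
    sumTo n (expTerm x) * sumTo n (expTerm y)   ∎

  2*expTerm1 : ∀ n → fromℕ 2 * expTerm 1ℚ (2 ℕ.+ n) ≤ expTerm 1ℚ (suc n)
  2*expTerm1 n = begin
    fromℕ 2 * t              ≤⟨ *-monoʳ (0≤expTerm (<⇒≤ 0<1) (2 ℕ.+ n)) (fromℕ-mono {2} {2 ℕ.+ n} (ℕ.s≤s (ℕ.s≤s ℕ.z≤n))) ⟩
    fromℕ (2 ℕ.+ n) * t      ≡⟨ deriv-expTerm 1ℚ (suc n) ⟩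
    1ℚ * expTerm 1ℚ (suc n)  ≡⟨ *-identityˡ (expTerm 1ℚ (suc n)) ⟩
    expTerm 1ℚ (suc n)       ∎
    where t = expTerm 1ℚ (2 ℕ.+ n)

  -- The argument gives 3; it is rounded up to 4 so that the later bounds are powers of two.
  expSum-1 : ∀ n → sumTo n (expTerm 1ℚ) ≤ fromℕ 4
  expSum-1 zero    = 0≤fromℕ 4
  expSum-1 (suc n) = begin
    S (suc n)                               ≡⟨ +-identityʳ (S (suc n)) ⟨
    S (suc n) + 0ℚ                          ≤⟨ +-monoʳ-≤ (S (suc n)) (0≤* (0≤fromℕ 2) (0≤expTerm (<⇒≤ 0<1) (suc n))) ⟩
    S (suc n) + fromℕ 2 * t (suc n)         ≤⟨ go n ⟩
    fromℕ 3                                 ≤⟨ fromℕ-mono (ℕₚ.n≤1+n 3) ⟩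
    fromℕ 4                                 ∎
    where
    t = expTerm 1ℚ
    S = λ n → sumTo n t
    -- From here on the terms at least halve, so twice the next term covers the rest of the series.
    -- The left side never increases from its initial value 1 + 2.
    go : ∀ n → S (suc n) + fromℕ 2 * t (suc n) ≤ fromℕ 3
    go zero    = ≤-refl
    go (suc n) = begin
      S (suc n) + t (suc n) + fromℕ 2 * t (2 ℕ.+ n)   ≤⟨ +-monoʳ-≤ (S (2 ℕ.+ n)) (2*expTerm1 n) ⟩
      S (suc n) + t (suc n) + t (suc n)               ≡⟨ solve 2 (λ s t → s :+ t :+ t := s :+ con (fromℕ 2) :* t) refl (S (suc n)) (t (suc n)) ⟩
      S (suc n) + fromℕ 2 * t (suc n)                 ≤⟨ go n ⟩
      fromℕ 3                                         ∎

  expSum-0 : ∀ n → sumTo (suc n) (expTerm 0ℚ) ≡ 1ℚ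
  expSum-0 n = trans (sumTo-head n (expTerm 0ℚ)) (cong (1ℚ +_) (tail≡0 n))
    where
    tail≡0 : ∀ n → sumTo n (λ i → expTerm 0ℚ (suc i)) ≡ 0ℚ
    tail≡0 zero    = refl
    tail≡0 (suc n) = cong₂ _+_ (tail≡0 n)
      (solve 2 (λ e z → e :* (con 0ℚ :* z) := con 0ℚ) refl (expCoeff (suc n)) (0ℚ ^ n))

  expSum-ℕ : ∀ T n → sumTo n (expTerm (fromℕ T)) ≤ fromℕ 4 ^ T
  expSum-ℕ zero zero    = <⇒≤ 0<1
  expSum-ℕ zero (suc n) = ≤-reflexive (expSum-0 n)
  expSum-ℕ (suc T) n = begin
    sumTo n (expTerm (fromℕ (suc T)))                     ≡⟨ cong (λ x → sumTo n (expTerm x)) (fromℕ-+ 1 T) ⟩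
    sumTo n (expTerm (1ℚ + fromℕ T))                      ≤⟨ expSum-+ 1ℚ (fromℕ T) n (<⇒≤ 0<1) (0≤fromℕ T) ⟩
    sumTo n (expTerm 1ℚ) * sumTo n (expTerm (fromℕ T))    ≤⟨ *-mono-≤ (0≤sumTo n (0≤expTerm (<⇒≤ 0<1))) (0≤^ T (0≤fromℕ 4)) (expSum-1 n) (expSum-ℕ T n) ⟩
    fromℕ 4 * fromℕ 4 ^ T                                 ∎

  ¼ : ℚ
  ¼ = ½ * ½

  0<¼ : 0ℚ < ¼
  0<¼ = 0<* 0<½ 0<½

  1^ : ∀ n → 1ℚ ^ n ≡ 1ℚ
  1^ zero    = refl
  1^ (suc n) = trans (*-identityˡ (1ℚ ^ n)) (1^ n)

  ¼^*4^ : ∀ T → ¼ ^ T * fromℕ 4 ^ T ≡ 1ℚ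
  ¼^*4^ T = trans (sym (^-distrib-* ¼ (fromℕ 4) T)) (1^ T)

  expSum-≤ : ∀ {t} T n → 0ℚ ≤ t → t ≤ fromℕ T → sumTo n (expTerm t) ≤ fromℕ 4 ^ T
  expSum-≤ {t} T n 0≤t t≤T = ≤-trans (sumTo-mono n λ i _ → *-monoˡ (0≤expCoeff i) (^-mono i 0≤t t≤T)) (expSum-ℕ T n)

  expTerm-neg-≤ : ∀ {t} → 0ℚ ≤ t → ∀ i → expTerm (- t) i ≤ expTerm t i
  expTerm-neg-≤ {t} 0≤t i = *-monoˡ (0≤expCoeff i) (begin
    (- t) ^ i         ≤⟨ p≤∣p∣ ((- t) ^ i) ⟩
    ∣ (- t) ^ i ∣     ≡⟨ ∣^∣ (- t) i ⟩
    ∣ - t ∣ ^ i       ≡⟨ cong (_^ i) (trans (∣-p∣≡∣p∣ t) (0≤p⇒∣p∣≡p 0≤t)) ⟩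
    t ^ i             ∎)

  module _ (T : ℕ) where
    private
      Q = fromℕ 4 ^ T
      q = ¼ ^ T
      0≤Q = 0≤^ T (0≤fromℕ 4)
      0≤q = 0≤^ T (<⇒≤ 0<¼)
      dom = expCoeff-dominated (fromℕ T) (0≤fromℕ T)
      0≤½ = <⇒≤ 0<½
      C = proj₁ dom
      K = fromℕ T * C * geo 0≤½ ½<1
      0≤K : 0ℚ ≤ K
      0≤K = 0≤* (0≤* (0≤fromℕ T) (0≤C {expCoeff} {fromℕ T} {C} {½} 0≤½ ½<1 (0≤fromℕ T) (proj₂ dom))) (0≤geo 0≤½ ½<1)
      -- Chosen so that δ times Q = 4^T is ¼: the two error terms below then cost ½ together.
      δ = ¼ * q
      0<¼^ : ∀ T → 0ℚ < ¼ ^ T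
      0<¼^ zero    = 0<1
      0<¼^ (suc T) = 0<* 0<¼ (0<¼^ T)
      van = ^-vanish 0≤½ ½<1 K δ 0≤K (0<* 0<¼ (0<¼^ T))
      M = proj₁ van

      tail≤δ : ∀ {x} → ∣ x ∣ ≤ fromℕ T → ∀ {m n} → M ℕ.< m → m ℕ.≤ n →
               ∣ sumTo n (expTerm x) - sumTo m (expTerm x) ∣ ≤ δ
      tail≤δ {x} x≤T {suc m} {suc n} (ℕ.s≤s M≤m) (ℕ.s≤s m≤n) = begin
        ∣ sumTo (suc n) (expTerm x) - sumTo (suc m) (expTerm x) ∣
               ≤⟨ truncation-tail {expCoeff} {fromℕ T} {C} {½} 0≤½ ½<1 (0≤fromℕ T) (proj₂ dom) x≤T m≤n ⟩
        ½ ^ m * K  ≤⟨ *-monoʳ 0≤K (^-decr 0≤½ ½<1 M≤m) ⟩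
        ½ ^ M * K  ≤⟨ proj₂ van ⟩
        δ      ∎

    -- The threshold depends on T alone, because the n-th term of `exp` evaluates its truncation at
    -- the n-th approximation of the argument, which varies with n. The coefficients of the product
    -- of the series of exp t and exp (- t) sum to 1; up to two small tails this sum is at most F *
    -- R, with F a partial sum of exp t and R the sum to be bounded below.
    expSum-neg : ∃[ n₀ ] ∀ n t → n₀ ℕ.≤ n → 0ℚ ≤ t → t ≤ fromℕ T → ½ * ¼ ^ T ≤ sumTo n (expTerm (- t))
    -- For n at least 2m both halves of the split are long: the first m terms of exp t, and the
    -- partial sums of exp (- t) with more than p = n - m terms, all reach beyond M.
    expSum-neg = m ℕ.+ m , bound
      where
      m = suc M
      bound : ∀ n t → m ℕ.+ m ℕ.≤ n → 0ℚ ≤ t → t ≤ fromℕ T → ½ * q ≤ sumTo n (expTerm (- t))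
      bound n t 2m≤n 0≤t t≤T = begin
        ½ * q                   ≤⟨ *-monoʳ 0≤q ½≤QR ⟩
        Q * R * q               ≡⟨ solve 3 (λ a r b → a :* r :* b := b :* a :* r) refl Q R q ⟩
        q * Q * R               ≡⟨ cong (_* R) (¼^*4^ T) ⟩
        1ℚ * R                  ≡⟨ *-identityˡ R ⟩
        R                       ∎
        where
        f = expTerm t
        g = expTerm (- t)
        R = sumTo n g
        p = n ℕ.∸ m
        m≤p : m ℕ.≤ p
        m≤p = ℕₚ.m+n≤o⇒m≤o∸n m 2m≤n
        m≤n : m ℕ.≤ n
        m≤n = ℕₚ.≤-trans (ℕₚ.m≤m+n m m) 2m≤n
        m+p≡n : m ℕ.+ p ≡ n
        m+p≡n = ℕₚ.m+[n∸m]≡n m≤n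
        ∣t∣≤T : ∣ t ∣ ≤ fromℕ T
        ∣t∣≤T = ≤-trans (≤-reflexive (0≤p⇒∣p∣≡p 0≤t)) t≤T
        ∣-t∣≤T : ∣ - t ∣ ≤ fromℕ T
        ∣-t∣≤T = ≤-trans (≤-reflexive (∣-p∣≡∣p∣ t)) ∣t∣≤T
        sumg≤Q : ∀ j → sumTo j g ≤ Q
        sumg≤Q j = ≤-trans (sumTo-mono j λ i _ → expTerm-neg-≤ 0≤t i) (expSum-≤ T j 0≤t t≤T)
        sumg≤R+δ : ∀ j → p ℕ.< j → j ℕ.≤ m ℕ.+ p → sumTo j g ≤ R + δ
        sumg≤R+δ j p<j j≤ = begin
          G                    ≡⟨ solve 2 (λ a r → a := r :+ (:- (r :- a))) refl G R ⟩
          R + - (R - G)        ≤⟨ +-monoʳ-≤ R (≤-trans (p≤∣p∣ (- (R - G))) (≤-reflexive (∣-p∣≡∣p∣ (R - G)))) ⟩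
          R + ∣ R - G ∣        ≤⟨ +-monoʳ-≤ R (tail≤δ ∣-t∣≤T (ℕₚ.≤-trans m≤p (ℕₚ.<⇒≤ p<j)) (subst (j ℕ.≤_) m+p≡n j≤)) ⟩
          R + δ                ∎
          where G = sumTo j g
        F = sumTo m f
        0≤F : 0ℚ ≤ F
        0≤F = 0≤sumTo m (0≤expTerm 0≤t)
        F≤Q : F ≤ Q
        F≤Q = expSum-≤ T m 0≤t t≤T
        tail = sumTo p (λ i → f (m ℕ.+ i))
        tail≤ : tail ≤ δ
        tail≤ = begin
          tail                       ≡⟨ solve 2 (λ a t → t := a :+ t :- a) refl F tail ⟩
          F + tail - F               ≡⟨ cong (_- F) (sumTo-++ m p f) ⟨
          sumTo (m ℕ.+ p) f - F      ≤⟨ p≤∣p∣ (sumTo (m ℕ.+ p) f - F) ⟩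
          ∣ sumTo (m ℕ.+ p) f - F ∣  ≤⟨ tail≤δ ∣t∣≤T ℕₚ.≤-refl (ℕₚ.m≤m+n m p) ⟩
          δ                          ∎
        δQ≡¼ : δ * Q ≡ ¼
        δQ≡¼ = trans (*-assoc ¼ q Q) (trans (cong (¼ *_) (¼^*4^ T)) (*-identityʳ ¼))
        1≤ : 1ℚ ≤ F * R + ½
        1≤ = begin
          1ℚ                                     ≡⟨ expSum-0 (M ℕ.+ p) ⟨
          sumTo (m ℕ.+ p) (expTerm 0ℚ)           ≡⟨ cong (λ y → sumTo (m ℕ.+ p) (expTerm y)) (+-inverseʳ t) ⟨
          sumTo (m ℕ.+ p) (expTerm (t - t))      ≡⟨ sumTo-cong (m ℕ.+ p) (conv-expTerm t (- t)) ⟨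
          sumTo (m ℕ.+ p) (conv f g)             ≤⟨ convSum-split-≤ m p (0≤expTerm 0≤t) sumg≤R+δ (λ j _ → sumg≤Q j) ⟩
          F * (R + δ) + tail * Q                 ≡⟨ cong (_+ tail * Q) (*-distribˡ-+ F R δ) ⟩
          F * R + F * δ + tail * Q               ≡⟨ +-assoc (F * R) (F * δ) (tail * Q) ⟩
          F * R + (F * δ + tail * Q)             ≤⟨ +-monoʳ-≤ (F * R) (+-mono-≤ (*-monoʳ 0≤δ F≤Q) (*-monoʳ 0≤Q tail≤)) ⟩
          F * R + (Q * δ + δ * Q)                ≡⟨ cong (λ a → F * R + (a + δ * Q)) (*-comm Q δ) ⟩
          F * R + (δ * Q + δ * Q)                ≡⟨ cong (λ a → F * R + (a + a)) δQ≡¼ ⟩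
          F * R + ½                              ∎
          where
          0≤δ : 0ℚ ≤ δ
          0≤δ = 0≤* (<⇒≤ 0<¼) 0≤q
        ½≤FR : ½ ≤ F * R
        ½≤FR = begin
          1ℚ - ½           ≤⟨ +-monoˡ-≤ (- ½) 1≤ ⟩
          F * R + ½ - ½    ≡⟨ solve 2 (λ a h → a :+ h :- h := a) refl (F * R) ½ ⟩
          F * R            ∎
        ½≤QR : ½ ≤ Q * R
        -- The sign of R is not known in advance; F * R ≥ ½ with F ≥ 0 forces it, and only then may
        -- F be replaced by Q.
        ½≤QR = [ (λ 0≤R → ≤-trans ½≤FR (*-monoʳ 0≤R F≤Q))
               , (λ R≤0 → contradiction (<-≤-trans 0<½ (≤-trans ½≤FR (≤-trans (*-monoˡ 0≤F R≤0) (≤-reflexive (*-zeroʳ F))))) (<-irrefl refl))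
               ]′ (≤-total 0ℚ R)

  -- Partial sums of the series for the logarithm

  2^*½^ : ∀ j → fromℕ (2 ℕ.^ j) * ½ ^ j ≡ 1ℚ
  2^*½^ j = begin-equality
    fromℕ (2 ℕ.^ j) * ½ ^ j   ≡⟨ cong (_* ½ ^ j) (fromℕ-^ 2 j) ⟩
    fromℕ 2 ^ j * ½ ^ j       ≡⟨ ^-distrib-* (fromℕ 2) ½ j ⟨
    1ℚ ^ j                    ≡⟨ 1^ j ⟩
    1ℚ                        ∎

  K≤2[K+i]+1 : ∀ K i → K ℕ.≤ suc (2 ℕ.* (K ℕ.+ i))
  K≤2[K+i]+1 K i = ℕₚ.m≤n⇒m≤1+n (ℕₚ.≤-trans (ℕₚ.m≤m+n K i) (ℕₚ.m≤n*m (K ℕ.+ i) 2))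

  artanhCoeff-≤ : ∀ j i → 2 ℕ.^ j ℕ.≤ suc (2 ℕ.* i) → artanhCoeff i ≤ ½ ^ j
  artanhCoeff-≤ j i 2^j≤ = begin
    c                               ≡⟨ *-identityʳ c ⟨
    c * 1ℚ                          ≡⟨ cong (c *_) (2^*½^ j) ⟨
    c * (fromℕ (2 ℕ.^ j) * ½ ^ j)   ≡⟨ *-assoc c (fromℕ (2 ℕ.^ j)) (½ ^ j) ⟨
    c * fromℕ (2 ℕ.^ j) * ½ ^ j     ≤⟨ *-monoʳ (0≤^ j (<⇒≤ 0<½)) (*-monoˡ (0≤/ 1 (suc (2 ℕ.* i))) (fromℕ-mono 2^j≤)) ⟩
    c * fromℕ (suc (2 ℕ.* i)) * ½ ^ j ≡⟨ cong (_* ½ ^ j) (/-*-cancel 1 (suc (2 ℕ.* i))) ⟩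
    1ℚ * ½ ^ j                      ≡⟨ *-identityˡ (½ ^ j) ⟩
    ½ ^ j                           ∎
    where c = artanhCoeff i

  0≤artanhCoeff : ∀ i → 0ℚ ≤ artanhCoeff i
  0≤artanhCoeff i = 0≤/ 1 (suc (2 ℕ.* i))

  -- Dyadic blocks: the 2^m coefficients with index from 2^m up to 2^(m+1) are at most 2^(-m) each,
  -- so every doubling adds at most 1.
  harmonic-≤ : ∀ m → sumTo (2 ℕ.^ m) artanhCoeff ≤ fromℕ (suc m)
  harmonic-≤ zero    = ≤-refl
  harmonic-≤ (suc m) = begin
    sumTo (K ℕ.+ (K ℕ.+ 0)) artanhCoeff                            ≡⟨ cong (λ k → sumTo (K ℕ.+ k) artanhCoeff) (ℕₚ.+-identityʳ K) ⟩
    sumTo (K ℕ.+ K) artanhCoeff                                    ≡⟨ sumTo-++ K K artanhCoeff ⟩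
    sumTo K artanhCoeff + sumTo K (λ i → artanhCoeff (K ℕ.+ i))    ≤⟨ +-mono-≤ (harmonic-≤ m) block ⟩
    fromℕ (suc m) + 1ℚ                                             ≡⟨ +-comm (fromℕ (suc m)) 1ℚ ⟩
    1ℚ + fromℕ (suc m)                                             ≡⟨ fromℕ-+ 1 (suc m) ⟨
    fromℕ (2 ℕ.+ m)                                                ∎
    where
    K = 2 ℕ.^ m
    block : sumTo K (λ i → artanhCoeff (K ℕ.+ i)) ≤ 1ℚ
    block = begin
      sumTo K (λ i → artanhCoeff (K ℕ.+ i))   ≤⟨ sumTo-mono K (λ i _ → artanhCoeff-≤ m (K ℕ.+ i) (K≤2[K+i]+1 K i)) ⟩
      sumTo K (λ _ → ½ ^ m)                   ≡⟨ sumTo-const K (½ ^ m) ⟩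
      fromℕ K * ½ ^ m                         ≡⟨ 2^*½^ m ⟩
      1ℚ                                      ∎

  geometric-≤ : ∀ {u} n → 0ℚ ≤ u → sumTo n (u ^_) * (1ℚ - u) ≤ 1ℚ
  geometric-≤ {u} n 0≤u = begin
    sumTo n (u ^_) * (1ℚ - u)   ≡⟨ sum≡ n ⟩
    1ℚ - u ^ n                  ≤⟨ +-monoʳ-≤ 1ℚ (neg-antimono-≤ (0≤^ n 0≤u)) ⟩
    1ℚ                          ∎
    where
    sum≡ : ∀ n → sumTo n (u ^_) * (1ℚ - u) ≡ 1ℚ - u ^ n
    sum≡ zero    = *-zeroˡ (1ℚ - u)
    sum≡ (suc n) = begin-equality
      (S + u ^ n) * (1ℚ - u)               ≡⟨ *-distribʳ-+ (1ℚ - u) S (u ^ n) ⟩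
      S * (1ℚ - u) + u ^ n * (1ℚ - u)      ≡⟨ cong (_+ u ^ n * (1ℚ - u)) (sum≡ n) ⟩
      1ℚ - u ^ n + u ^ n * (1ℚ - u)        ≡⟨ solve 2 (λ u x → con 1ℚ :- x :+ x :* (con 1ℚ :- u) := con 1ℚ :- u :* x) refl u (u ^ n) ⟩
      1ℚ - u * u ^ n                       ∎
      where S = sumTo n (u ^_)

  -- The hypothesis says 1/(1 - u) ≤ 2^m. Up to index 2^m the powers of u are dropped and the
  -- harmonic bound m + 1 applies; beyond it the coefficients are at most 2^(-m), and the geometric
  -- series contributes at most 2^m.
  artanhSum-≤ : ∀ m {u} n → 0ℚ ≤ u → u ≤ 1ℚ → 1ℚ ≤ (1ℚ - u) * fromℕ (2 ℕ.^ m) →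
                sumTo n (λ i → artanhCoeff i * u ^ i) ≤ fromℕ (2 ℕ.+ m)
  artanhSum-≤ m {u} n 0≤u u≤1 1≤ = begin
    sumTo n f                              ≤⟨ sumTo-monoˡ (λ i → 0≤* (0≤artanhCoeff i) (0≤^ i 0≤u)) (ℕₚ.m≤n+m n K) ⟩
    sumTo (K ℕ.+ n) f                      ≡⟨ sumTo-++ K n f ⟩
    sumTo K f + sumTo n (λ i → f (K ℕ.+ i)) ≤⟨ +-mono-≤ (≤-trans (sumTo-mono K λ i _ → f≤ i) (harmonic-≤ m)) tail ⟩
    fromℕ (suc m) + 1ℚ                     ≡⟨ +-comm (fromℕ (suc m)) 1ℚ ⟩
    1ℚ + fromℕ (suc m)                     ≡⟨ fromℕ-+ 1 (suc m) ⟨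
    fromℕ (2 ℕ.+ m)                        ∎
    where
    K = 2 ℕ.^ m
    f = λ i → artanhCoeff i * u ^ i
    G = sumTo n (u ^_)
    ^≤1 : ∀ i → u ^ i ≤ 1ℚ
    ^≤1 zero    = ≤-refl
    ^≤1 (suc i) = *-mono-≤ 0≤u (<⇒≤ 0<1) u≤1 (^≤1 i)
    f≤ : ∀ i → f i ≤ artanhCoeff i
    f≤ i = ≤-trans (*-monoˡ (0≤artanhCoeff i) (^≤1 i)) (≤-reflexive (*-identityʳ (artanhCoeff i)))
    ^-decr-+ : ∀ k i → u ^ (k ℕ.+ i) ≤ u ^ i
    ^-decr-+ zero    i = ≤-refl
    ^-decr-+ (suc k) i = begin
      u * u ^ (k ℕ.+ i)   ≤⟨ *-mono-≤ 0≤u (0≤^ i 0≤u) u≤1 (^-decr-+ k i) ⟩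
      1ℚ * u ^ i          ≡⟨ *-identityˡ (u ^ i) ⟩
      u ^ i               ∎
    0≤G : 0ℚ ≤ G
    0≤G = 0≤sumTo n λ i → 0≤^ i 0≤u
    G≤K : G ≤ fromℕ K
    G≤K = begin
      G                                ≡⟨ *-identityʳ G ⟨
      G * 1ℚ                           ≤⟨ *-monoˡ 0≤G 1≤ ⟩
      G * ((1ℚ - u) * fromℕ K)         ≡⟨ *-assoc G (1ℚ - u) (fromℕ K) ⟨
      G * (1ℚ - u) * fromℕ K           ≤⟨ *-monoʳ (0≤fromℕ K) (geometric-≤ n 0≤u) ⟩
      1ℚ * fromℕ K                     ≡⟨ *-identityˡ (fromℕ K) ⟩
      fromℕ K                          ∎
    tail : sumTo n (λ i → f (K ℕ.+ i)) ≤ 1ℚ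
    tail = begin
      sumTo n (λ i → f (K ℕ.+ i))
        ≤⟨ sumTo-mono n (λ i _ → *-mono-≤ (0≤artanhCoeff (K ℕ.+ i)) (0≤^ i 0≤u)
            (artanhCoeff-≤ m (K ℕ.+ i) (K≤2[K+i]+1 K i)) (^-decr-+ K i)) ⟩
      sumTo n (λ i → ½ ^ m * u ^ i)      ≡⟨ sumTo-*ˡ (½ ^ m) n (u ^_) ⟩
      ½ ^ m * G                          ≤⟨ *-monoˡ (0≤^ m (<⇒≤ 0<½)) G≤K ⟩
      ½ ^ m * fromℕ K                    ≡⟨ *-comm (½ ^ m) (fromℕ K) ⟩
      fromℕ K * ½ ^ m                    ≡⟨ 2^*½^ m ⟩
      1ℚ                                 ∎

  module _ {y} (m : ℕ) (1≤y : 1ℚ ≤ y) (y≤2^m : y ≤ fromℕ (2 ℕ.^ m)) (0<d : 0ℚ < (y + 1ℚ) ⊔ 1ℚ) where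
    private
      v = inv ((y + 1ℚ) ⊔ 1ℚ) 0<d
      z = (y - 1ℚ) * v
      K = fromℕ (2 ℕ.^ m)
      0≤y = ≤-trans (<⇒≤ 0<1) 1≤y
      0≤v = <⇒≤ (inv-pos ((y + 1ℚ) ⊔ 1ℚ) 0<d)
      0≤z : 0ℚ ≤ z
      0≤z = 0≤* (p≤q⇒0≤q-p 1≤y) 0≤v
      d≡y+1 : (y + 1ℚ) ⊔ 1ℚ ≡ y + 1ℚ
      d≡y+1 = p≥q⇒p⊔q≡p (≤-trans (≤-reflexive (sym (+-identityˡ 1ℚ))) (+-monoˡ-≤ 1ℚ 0≤y))
      dv≡1 : (y + 1ℚ) * v ≡ 1ℚ
      dv≡1 = trans (cong (_* v) (sym d≡y+1)) (inv-inverseʳ ((y + 1ℚ) ⊔ 1ℚ) 0<d)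
      z≤1 : z ≤ 1ℚ
      z≤1 = begin
        (y - 1ℚ) * v   ≤⟨ *-monoʳ 0≤v (+-monoʳ-≤ y (≤-trans (nonPositive⁻¹ (- 1ℚ)) (<⇒≤ 0<1))) ⟩
        (y + 1ℚ) * v   ≡⟨ dv≡1 ⟩
        1ℚ             ∎
      -- 1 − z² = 4y / (y + 1)²
      1-z² : 1ℚ ≤ (1ℚ - z * z) * K
      1-z² = begin
        1ℚ                                         ≡⟨⟩
        1ℚ * 1ℚ                                    ≡⟨ cong₂ _*_ dv≡1 dv≡1 ⟨
        -- As y ≥ 1, the quotient 2y/(y + 1) is at least 1, and its square is exactly (1 - z²) y.
        (y + 1ℚ) * v * ((y + 1ℚ) * v)              ≤⟨ *-mono-≤ (≤-trans (<⇒≤ 0<1) (≤-reflexive (sym dv≡1))) (0≤* (0≤+ 0≤y 0≤y) 0≤v) y+1≤2y y+1≤2y ⟩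
        (y + y) * v * ((y + y) * v)                ≡⟨ solve 2 (λ y v → (y :+ y) :* v :* ((y :+ y) :* v)
                                                       := ((y :+ con 1ℚ) :* v :* ((y :+ con 1ℚ) :* v) :- (y :- con 1ℚ) :* v :* ((y :- con 1ℚ) :* v)) :* y) refl y v ⟩
        ((y + 1ℚ) * v * ((y + 1ℚ) * v) - z * z) * y  ≡⟨ cong (λ a → (a * a - z * z) * y) dv≡1 ⟩
        (1ℚ - z * z) * y                           ≤⟨ *-monoˡ (p≤q⇒0≤q-p (*-mono-≤ 0≤z (<⇒≤ 0<1) z≤1 z≤1)) y≤2^m ⟩
        (1ℚ - z * z) * K                           ∎
        where
        y+1≤2y : (y + 1ℚ) * v ≤ (y + y) * v
        y+1≤2y = *-monoʳ 0≤v (+-monoʳ-≤ y 1≤y)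

    -- `l` has the form of the n-th term of `log`, at an approximation y. The maximum with 1 in its
    -- denominator is the one inserted by `recip`, where 1 is the positivity witness for y + 1. The
    -- artanh bound applies because 1/(1 - z²) ≤ y ≤ 2^m.
    log-bounds : ∀ n → let l = fromℕ 2 * (z * sumTo n (λ i → artanhCoeff i * (z * z) ^ i)) in
                 0ℚ ≤ l × l ≤ fromℕ (2 ℕ.* (2 ℕ.+ m))
    log-bounds n = 0≤* (0≤fromℕ 2) (0≤* 0≤z 0≤S) , (begin
      fromℕ 2 * (z * S)                   ≤⟨ *-monoˡ (0≤fromℕ 2) (*-mono-≤ 0≤z (0≤fromℕ (2 ℕ.+ m)) z≤1 (artanhSum-≤ m n (0≤* 0≤z 0≤z) z²≤1 1-z²)) ⟩
      fromℕ 2 * (1ℚ * fromℕ (2 ℕ.+ m))    ≡⟨ cong (fromℕ 2 *_) (*-identityˡ (fromℕ (2 ℕ.+ m))) ⟩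
      fromℕ 2 * fromℕ (2 ℕ.+ m)           ≡⟨ fromℕ-* 2 (2 ℕ.+ m) ⟨
      fromℕ (2 ℕ.* (2 ℕ.+ m))             ∎)
      where
      S = sumTo n (λ i → artanhCoeff i * (z * z) ^ i)
      z²≤1 = *-mono-≤ 0≤z (<⇒≤ 0<1) z≤1 z≤1
      0≤S : 0ℚ ≤ S
      0≤S = 0≤sumTo n λ i → 0≤* (0≤artanhCoeff i) (0≤^ i (0≤* 0≤z 0≤z))

-- Eventual bounds for the real numbers in the statement

module Bounds where
  open ℚ using (_+_; _*_; _-_; -_; _≤_; _<_; ∣_∣; _⊔_)
  open ℚₚ
  open RawSemiring ℚ.+-*-rawSemiring using (_^_)
  open Defs using (fromℕ; seq; cauchy; fromℚ; ℝ⁺; mkℝ⁺; val; exp; log; 2⁺; _/⁺_; Eventually; positive-above)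
  open Defs.Rational
  open +-*-Solver using (solve; _:+_; _:*_; _:-_; :-_; con; _:=_)
  open ≤-Reasoning
  open Series

  infixr 2 _∧_
  _∧_ : ∀ {P Q : ℕ → Set} → Eventually P → Eventually Q → Eventually λ n → P n × Q n
  (M , p) ∧ (N , q) = M ℕ.⊔ N , λ n h → p n (ℕₚ.m⊔n≤o⇒m≤o M N h) , q n (ℕₚ.m⊔n≤o⇒n≤o M N h)

  eventually-map : ∀ {P Q : ℕ → Set} → (∀ n → P n → Q n) → Eventually P → Eventually Q
  eventually-map f (N , p) = N , λ n h → f n (p n h)

  eventually-≤ : ∀ {x y} → (Eventually λ n → seq x n ≤ seq y n) → x Defs.≤ y
  eventually-≤ {x} {y} (N , x≤y) ε 0<ε = N , λ n h → begin
    seq x n        ≤⟨ x≤y n h ⟩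
    seq y n        ≡⟨ +-identityʳ (seq y n) ⟨
    seq y n + 0ℚ   ≤⟨ +-monoʳ-≤ (seq y n) (<⇒≤ 0<ε) ⟩
    seq y n + ε    ∎

  log-eventually : ∀ y m → (Eventually λ n → 1ℚ ≤ seq (val y) n × seq (val y) n ≤ fromℕ (2 ℕ.^ m)) →
    Eventually λ n → 0ℚ ≤ seq (log y) n × seq (log y) n ≤ fromℕ (2 ℕ.* (2 ℕ.+ m))
  log-eventually (mkℝ⁺ y 0<y) m = eventually-map λ n (1≤y , y≤) → log-bounds m 1≤y y≤ (0<⊔ (seq y n + 1ℚ) 0<1) n

  exp-neg-eventually : ∀ x T → (Eventually λ n → 0ℚ ≤ seq x n × seq x n ≤ fromℕ T) →
    Eventually λ n → ½ * ¼ ^ T ≤ seq (exp (Defs.- x)) n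
  exp-neg-eventually x T x∈[0,T] = eventually-map
    (λ n ((0≤x , x≤T) , n₀≤n) → proj₂ (expSum-neg T) n (seq x n) n₀≤n 0≤x x≤T)
    (x∈[0,T] ∧ (proj₁ (expSum-neg T) , λ n h → h))

  2/-eventually : ∀ α e → (Eventually λ n → seq (val α) n ≤ 1ℚ) → (Eventually λ n → ½ ^ e ≤ seq (val α) n) →
    Eventually λ n → 1ℚ ≤ seq (val (2⁺ /⁺ α)) n × seq (val (2⁺ /⁺ α)) n ≤ fromℕ (2 ℕ.^ suc e)
  2/-eventually (mkℝ⁺ α 0<α@(ε , 0<ε , _)) e α≤1 ½^e≤α = eventually-map bound (positive-above {α} 0<α ∧ α≤1 ∧ ½^e≤α)
    where
    bound : ∀ n → ε ≤ seq α n × seq α n ≤ 1ℚ × ½ ^ e ≤ seq α n →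
            1ℚ ≤ seq (val (2⁺ /⁺ mkℝ⁺ α 0<α)) n × seq (val (2⁺ /⁺ mkℝ⁺ α 0<α)) n ≤ fromℕ (2 ℕ.^ suc e)
    bound n (ε≤a , a≤1 , ½^e≤a) = lower , upper
      where
      a = seq α n
      0<d = 0<⊔ a 0<ε
      i = inv (a ⊔ ε) 0<d
      -- The maximum in `recip` is inactive as soon as the approximation has passed the positivity
      -- witness.
      d≡a : a ⊔ ε ≡ a
      d≡a = p≥q⇒p⊔q≡p ε≤a
      0≤i : 0ℚ ≤ i
      0≤i = <⇒≤ (inv-pos (a ⊔ ε) 0<d)
      1≤i : 1ℚ ≤ i
      1≤i = begin
        1ℚ              ≡⟨ inv-inverseʳ (a ⊔ ε) 0<d ⟨
        (a ⊔ ε) * i     ≤⟨ *-monoʳ 0≤i (≤-trans (≤-reflexive d≡a) a≤1) ⟩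
        1ℚ * i          ≡⟨ *-identityˡ i ⟩
        i               ∎
      lower : 1ℚ ≤ fromℕ 2 * i
      lower = begin
        1ℚ              ≤⟨ 1≤i ⟩
        i               ≡⟨ *-identityˡ i ⟨
        1ℚ * i          ≤⟨ *-monoʳ 0≤i (fromℕ-mono {1} {2} (ℕₚ.n≤1+n 1)) ⟩
        fromℕ 2 * i     ∎
      upper : fromℕ 2 * i ≤ fromℕ (2 ℕ.^ suc e)
      upper = begin
        fromℕ 2 * i                            ≡⟨ cong (fromℕ 2 *_) (*-identityˡ i) ⟨
        fromℕ 2 * (1ℚ * i)                     ≡⟨ cong (λ x → fromℕ 2 * (x * i)) (2^*½^ e) ⟨
        fromℕ 2 * (K * ½ ^ e * i)              ≤⟨ *-monoˡ (0≤fromℕ 2) (*-monoʳ 0≤i (*-monoˡ (0≤fromℕ (2 ℕ.^ e)) (≤-trans ½^e≤a (≤-reflexive (sym d≡a))))) ⟩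
        fromℕ 2 * (K * (a ⊔ ε) * i)            ≡⟨ cong (fromℕ 2 *_) (*-assoc K (a ⊔ ε) i) ⟩
        fromℕ 2 * (K * ((a ⊔ ε) * i))          ≡⟨ cong (λ x → fromℕ 2 * (K * x)) (inv-inverseʳ (a ⊔ ε) 0<d) ⟩
        fromℕ 2 * (K * 1ℚ)                     ≡⟨ cong (fromℕ 2 *_) (*-identityʳ K) ⟩
        fromℕ 2 * K                            ≡⟨ fromℕ-* 2 (2 ℕ.^ e) ⟨
        fromℕ (2 ℕ.^ suc e)                    ∎
        where K = fromℕ (2 ℕ.^ e)

  -- C is the integer 1/c, which turns the condition on T into an inequality between naturals; b
  -- bounds the logarithm because 2/α ≤ 2^(e+1).
  exp-log²-eventually : ∀ {α e T} c {C} → 0ℚ ≤ c → c * fromℕ C ≡ 1ℚ →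
    (Eventually λ n → seq (val α) n ≤ 1ℚ) → (Eventually λ n → ½ ^ e ≤ seq (val α) n) →
    let b = 2 ℕ.* (3 ℕ.+ e) in b ℕ.* b ℕ.≤ C ℕ.* T →
    Eventually λ n → ½ * ¼ ^ T ≤ seq (exp (Defs.- (fromℚ c Defs.* (log (2⁺ /⁺ α) Defs.* log (2⁺ /⁺ α))))) n
  exp-log²-eventually {α} {e} {T} c {C} 0≤c cC≡1 α≤1 ½^e≤α b²≤ =
    exp-neg-eventually (fromℚ c Defs.* (log (2⁺ /⁺ α) Defs.* log (2⁺ /⁺ α))) T
      (eventually-map square (log-eventually (2⁺ /⁺ α) (suc e) (2/-eventually α e α≤1 ½^e≤α)))
    where
    b = 2 ℕ.* (3 ℕ.+ e)
    l = seq (log (2⁺ /⁺ α))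
    square : ∀ n → 0ℚ ≤ l n × l n ≤ fromℕ b → 0ℚ ≤ c * (l n * l n) × c * (l n * l n) ≤ fromℕ T
    square n (0≤l , l≤b) = 0≤* 0≤c (0≤* 0≤l 0≤l) , (begin
      c * (l n * l n)            ≤⟨ *-monoˡ 0≤c (*-mono-≤ 0≤l (0≤fromℕ b) l≤b l≤b) ⟩
      c * (fromℕ b * fromℕ b)    ≡⟨ cong (c *_) (fromℕ-* b b) ⟨
      c * fromℕ (b ℕ.* b)        ≤⟨ *-monoˡ 0≤c (fromℕ-mono b²≤) ⟩
      c * fromℕ (C ℕ.* T)        ≡⟨ cong (c *_) (fromℕ-* C T) ⟩
      c * (fromℕ C * fromℕ T)    ≡⟨ *-assoc c (fromℕ C) (fromℕ T) ⟨
      c * fromℕ C * fromℕ T      ≡⟨ cong (_* fromℕ T) cC≡1 ⟩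
      1ℚ * fromℕ T               ≡⟨ *-identityˡ (fromℕ T) ⟩
      fromℕ T                    ∎)

  -- A search through n = 1, 2, ... with rational comparisons only. It is the factor 2 in the upper
  -- bound that makes each test decidable, since consecutive ranges overlap.
  between-powers : ∀ α w → 1 ℕ.≤ w → val α Defs.≤ fromℚ (½ ^ (w ℕ.* 1)) →
    ∃[ n ] 1 ℕ.≤ n × (Eventually λ j → seq (val α) j ≤ fromℕ 2 * ½ ^ (w ℕ.* n))
                   × (Eventually λ j → ½ ^ (w ℕ.* suc n) ≤ seq (val α) j)
  between-powers (mkℝ⁺ α 0<α@(ε , 0<ε , _)) w 1≤w α≤½^w = search M 1 ℕₚ.≤-refl (ℕₚ.m≤n+m M 1)
    -- Taking `h 1` itself as the tolerance in α ≤ `h 1` gives the initial bound 2 * `h 1`.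
    (eventually-map (λ j → subst (seq α j ≤_) (solve 1 (λ h → h :+ h := con (fromℕ 2) :* h) refl (h 1))) (α≤½^w (h 1) (0<½^ (w ℕ.* 1))))
    where
    h : ℕ → ℚ
    h n = ½ ^ (w ℕ.* n)
    van = ^-vanish (<⇒≤ 0<½) ½<1 (fromℕ 2) (½ * ε) (0≤fromℕ 2) (0<half 0<ε)
    M = proj₁ van
    Goal = ∃[ n ] 1 ℕ.≤ n × (Eventually λ j → seq α j ≤ fromℕ 2 * h n) × (Eventually λ j → h (suc n) ≤ seq α j)
    search : ∀ f n → 1 ℕ.≤ n → M ℕ.≤ n ℕ.+ f → (Eventually λ j → seq α j ≤ fromℕ 2 * h n) → Goal
    -- Without fuel n ≥ M, so α is eventually at most 2 * 2^(-M) ≤ ε/2, against the positivity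
    -- witness ε.
    search zero n 1≤n M≤n α≤ = contradiction (begin-strict
      ½ * ε               <⟨ half< ⟩
      ε                   ≤⟨ proj₁ (proj₂ both _ ℕₚ.≤-refl) ⟩
      seq α (proj₁ both)  ≤⟨ proj₂ (proj₂ both _ ℕₚ.≤-refl) ⟩
      fromℕ 2 * h n       ≡⟨ *-comm (fromℕ 2) (h n) ⟩
      h n * fromℕ 2       ≤⟨ *-monoʳ (0≤fromℕ 2) (^-decr (<⇒≤ 0<½) ½<1 M≤wn) ⟩
      ½ ^ M * fromℕ 2     ≤⟨ proj₂ van ⟩
      ½ * ε               ∎) (<-irrefl refl)
      where
      both = positive-above {α} 0<α ∧ α≤
      half< : ½ * ε < ε
      half< = begin-strict
        ½ * ε           ≡⟨ +-identityʳ (½ * ε) ⟨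
        ½ * ε + 0ℚ      <⟨ +-monoʳ-< (½ * ε) (0<half 0<ε) ⟩
        ½ * ε + ½ * ε   ≡⟨ half+half ε ⟩
        ε               ∎
      M≤wn : M ℕ.≤ w ℕ.* n
      M≤wn = ℕₚ.≤-trans (subst (M ℕ.≤_) (ℕₚ.+-identityʳ n) M≤n) (ℕₚ.m≤n*m n w {{ℕ.>-nonZero 1≤w}})
    -- The approximation `a` is within H/2 of all later ones, so comparing it with 3H/2 is
    -- conclusive either way: below, α ≤ 2H and the search moves on; above, α ≥ H and it stops.
    search (suc f) n 1≤n M≤n+f α≤ =
      [ (λ a≤ → search f (suc n) (ℕ.s≤s ℕ.z≤n) (subst (M ℕ.≤_) (ℕₚ.+-suc n f) M≤n+f) (N , λ j N≤j → (begin
          seq α j               ≡⟨ solve 2 (λ x a → x := a :+ (x :- a)) refl (seq α j) a ⟩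
          a + (seq α j - a)     ≤⟨ +-mono-≤ a≤ (≤-trans (p≤∣p∣ (seq α j - a)) (near j N≤j)) ⟩
          H + ½ * H + ½ * H     ≡⟨ solve 1 (λ h → h :+ con ½ :* h :+ con ½ :* h := con (fromℕ 2) :* h) refl H ⟩
          fromℕ 2 * H           ∎)))
      , (λ ≤a → n , 1≤n , α≤ , N , λ j N≤j → (begin
          H                     ≡⟨ solve 1 (λ h → h := h :+ con ½ :* h :- con ½ :* h) refl H ⟩
          H + ½ * H - ½ * H     ≤⟨ +-mono-≤ ≤a (neg-antimono-≤ (≤-trans (p≤∣p∣ (a - seq α j)) (≤-trans (≤-reflexive (∣p-q∣≡∣q-p∣ a (seq α j))) (near j N≤j)))) ⟩
          a - (a - seq α j)     ≡⟨ solve 2 (λ x a → a :- (a :- x) := x) refl (seq α j) a ⟩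
          seq α j               ∎))
      ]′ (≤-total a (H + ½ * H))
      where
      H = h (suc n)
      close = cauchy α (½ * H) (0<half (0<½^ (w ℕ.* suc n)))
      N = proj₁ close
      a = seq α N
      near : ∀ j → N ℕ.≤ j → ∣ seq α j - a ∣ ≤ ½ * H
      near j N≤j = proj₂ close j N N≤j ℕₚ.≤-refl

module Behrend where
  open import Data.Fin.Base using (Fin; toℕ; fromℕ<)
  import Data.Fin.Properties as Finₚ
  open import Data.Fin.Subset as Subset using (Subset; ∣_∣)
  import Data.Fin.Subset.Properties as Subsetₚ
  open import Data.List.Base as List using (List; []; _∷_; _++_; length; filter; allFin; cartesianProduct; cartesianProductWith)
  import Data.List.Properties as Listₚ
  open import Data.List.Membership.Propositional using (_∈_)
  open import Data.List.Membership.Propositional.Properties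
  open import Data.List.Relation.Unary.All as All using (All; []; _∷_)
  open import Data.List.Relation.Unary.AllPairs.Core using ([]; _∷_)
  open import Data.List.Relation.Unary.Any using (here; there)
  open import Data.List.Relation.Unary.Unique.Propositional using (Unique)
  import Data.List.Relation.Unary.Unique.Propositional.Properties as Uniqueₚ
  open import Data.Nat.DivMod using (_/_; m*n/n≡m)
  open import Data.Vec.Base as Vec using (Vec; []; _∷_; head; tail)
  import Data.Vec.Properties as Vecₚ
  open import Data.Vec.Relation.Unary.All using ([]; _∷_) renaming (All to VecAll)
  open import Data.List.Membership.DecPropositional ℕₚ._≟_ using (_∈?_)
  open import Relation.Nullary.Decidable using (dec-true)
  open import Relation.Unary using (Decidable)
  open import Defs using (elements; tuples; solutions)
  open ℕ
  open ℕₚ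

  private
    variable
      X Y Z : Set

  open ≤-Reasoning

  -- Counting in lists and subsets

  unique-⊆⇒length-≤ : ∀ {xs ys : List X} → Unique xs → (∀ {x} → x ∈ xs → x ∈ ys) → length xs ≤ length ys
  unique-⊆⇒length-≤ [] _ = z≤n
  unique-⊆⇒length-≤ {xs = x ∷ xs} (x∉xs ∷ xs!) xs⊆ys with ∈-∃++ (xs⊆ys (here refl))
  ... | ys₁ , ys₂ , refl = begin
    suc (length xs)                    ≤⟨ s≤s (unique-⊆⇒length-≤ xs! λ z∈xs → drop-x (≢-sym (All.lookup x∉xs z∈xs)) (∈-++⁻ ys₁ (xs⊆ys (there z∈xs)))) ⟩
    suc (length (ys₁ ++ ys₂))          ≡⟨ cong suc (Listₚ.length-++ ys₁) ⟩
    suc (length ys₁ + length ys₂)      ≡⟨ +-suc (length ys₁) (length ys₂) ⟨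
    length ys₁ + length (x ∷ ys₂)      ≡⟨ Listₚ.length-++ ys₁ ⟨
    length (ys₁ ++ x ∷ ys₂)            ∎
    where
    drop-x : ∀ {z} → z ≢ x → z ∈ ys₁ ⊎ z ∈ x ∷ ys₂ → z ∈ ys₁ ++ ys₂
    drop-x _   (inj₁ z∈ys₁)         = ∈-++⁺ˡ z∈ys₁
    drop-x z≢x (inj₂ (here z≡x))    = contradiction z≡x z≢x
    drop-x _   (inj₂ (there z∈ys₂)) = ∈-++⁺ʳ ys₁ z∈ys₂

  length-cartesianProductWith : ∀ (f : X → Y → Z) xs ys → length (cartesianProductWith f xs ys) ≡ length xs * length ys
  length-cartesianProductWith f []       ys = refl
  length-cartesianProductWith f (x ∷ xs) ys = trans (Listₚ.length-++ (List.map (f x) ys))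
    (cong₂ _+_ (Listₚ.length-map (f x) ys) (length-cartesianProductWith f xs ys))

  -- `tuples` over an arbitrary alphabet: it also enumerates digit vectors and tuples of low parts.
  words : List X → ∀ m → List (Vec X m)
  words xs zero    = [] ∷ []
  words xs (suc m) = cartesianProductWith _∷_ xs (words xs m)

  tuples≡words : ∀ xs m → tuples xs m ≡ words xs m
  tuples≡words xs zero    = refl
  tuples≡words xs (suc m) = cong (cartesianProductWith _∷_ xs) (tuples≡words xs m)

  length-words : ∀ (xs : List X) m → length (words xs m) ≡ length xs ^ m
  length-words xs zero    = refl
  length-words xs (suc m) = trans (length-cartesianProductWith _∷_ xs (words xs m)) (cong (length xs *_) (length-words xs m))

  words-unique : ∀ {xs : List X} m → Unique xs → Unique (words xs m)
  words-unique zero    xs! = [] ∷ []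
  words-unique (suc m) xs! = Uniqueₚ.cartesianProductWith⁺ _∷_ Vecₚ.∷-injective xs! (words-unique m xs!)

  ∈-words⁺ : ∀ {xs : List X} → (∀ x → x ∈ xs) → ∀ {m} (w : Vec X m) → w ∈ words xs m
  ∈-words⁺ ∈xs []      = here refl
  ∈-words⁺ ∈xs (x ∷ w) = ∈-cartesianProductWith⁺ _∷_ (∈xs x) (∈-words⁺ ∈xs w)

  ∈-words⁻ : ∀ (xs : List X) {m} {w : Vec X m} → w ∈ words xs m → VecAll (_∈ xs) w
  ∈-words⁻ xs {zero}  {[]}    _ = []
  ∈-words⁻ xs {suc m} {x ∷ w} xw∈ with ∈-cartesianProductWith⁻ _∷_ xs (words xs m) xw∈
  ... | _ , _ , x∈xs , w∈ , refl = x∈xs ∷ ∈-words⁻ xs w∈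

  length-filter-⊎ : ∀ {P Q R : X → Set} (P? : Decidable P) (Q? : Decidable Q) (R? : Decidable R) →
    (∀ x → P x → Q x ⊎ R x) → ∀ xs → length (filter P? xs) ≤ length (filter Q? xs) + length (filter R? xs)
  length-filter-⊎ P? Q? R? P⇒Q⊎R []       = z≤n
  length-filter-⊎ P? Q? R? P⇒Q⊎R (x ∷ xs) with P? x | Q? x | R? x | length-filter-⊎ P? Q? R? P⇒Q⊎R xs
  ... | yes _ | yes _ | yes _ | ih = s≤s (≤-trans ih (+-monoʳ-≤ _ (n≤1+n _)))
  ... | yes _ | yes _ | no _  | ih = s≤s ih
  ... | yes _ | no _  | yes _ | ih = ≤-trans (s≤s ih) (≤-reflexive (sym (+-suc _ _)))
  ... | yes p | no ¬q | no ¬r | ih = contradiction (P⇒Q⊎R x p) [ ¬q , ¬r ]′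
  ... | no _  | yes _ | yes _ | ih = m≤n⇒m≤1+n (≤-trans ih (+-monoʳ-≤ _ (n≤1+n _)))
  ... | no _  | yes _ | no _  | ih = m≤n⇒m≤1+n ih
  ... | no _  | no _  | yes _ | ih = ≤-trans ih (+-monoʳ-≤ _ (n≤1+n _))
  ... | no _  | no _  | no _  | ih = ih

  module _ (f : X → ℕ) where

    fibre : ℕ → List X → List X
    fibre r = filter λ x → f x ≟ r

    private
      below : ℕ → List X → List X
      below k = filter λ x → f x <? k

      below-suc : ∀ k xs → length (below (suc k) xs) ≤ length (fibre k xs) + length (below k xs)
      below-suc k = length-filter-⊎ (λ x → f x <? suc k) (λ x → f x ≟ k) (λ x → f x <? k)
        λ x fx≤k → [ inj₂ , inj₁ ]′ (m≤n⇒m<n∨m≡n (s≤s⁻¹ fx≤k))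

      below-≤ : ∀ k xs → ∃[ r ] length (below k xs) ≤ k * length (fibre r xs)
      below-≤ zero    xs = 0 , ≤-reflexive (cong length (Listₚ.filter-none (λ x → f x <? 0) {xs} (All.tabulate λ _ ())))
      below-≤ (suc k) xs with below-≤ k xs
      ... | r , ≤r with ≤-total (length (fibre k xs)) (length (fibre r xs))
      ...   | inj₁ k≤r = r , ≤-trans (below-suc k xs) (+-mono-≤ k≤r ≤r)
      ...   | inj₂ r≤k = k , ≤-trans (below-suc k xs) (+-monoʳ-≤ (length (fibre k xs)) (≤-trans ≤r (*-monoʳ-≤ k r≤k)))

    -- Pigeonhole: the induction on k keeps the longer of the new fibre and the best one so far.
    largest-fibre : ∀ k xs → (∀ x → f x < k) → ∃[ r ] length xs ≤ k * length (fibre r xs)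
    largest-fibre k xs f<k with below-≤ k xs
    ... | r , below≤ = r , subst (λ ys → length ys ≤ k * length (fibre r xs))
      (Listₚ.filter-all (λ x → f x <? k) {xs} (All.tabulate λ {x} _ → f<k x)) below≤

  -- Each entry of the list pays for one element deleted from A; by uniqueness the remaining entries
  -- survive the deletion.
  unique⇒length-≤∣A∣ : ∀ {N} (A : Subset N) {us : List ℕ} → Unique us →
    (∀ {u} → u ∈ us → ∃[ i ] toℕ i ≡ u × i Subset.∈ A) → length us ≤ ∣ A ∣
  unique⇒length-≤∣A∣ A [] _ = z≤n
  unique⇒length-≤∣A∣ A {u ∷ us} (u∉us ∷ us!) us⊆A with us⊆A (here refl)
  ... | i , i≡u , i∈A = ≤-<-trans
    (unique⇒length-≤∣A∣ (A Subset.- i) us! λ {v} v∈us → let j , j≡v , j∈A = us⊆A (there v∈us) in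
      j , j≡v , Subsetₚ.x∈p∧x≢y⇒x∈p-y j∈A λ j≡i → All.lookup u∉us v∈us (trans (sym i≡u) (trans (cong toℕ (sym j≡i)) j≡v)))
    (Subsetₚ.x∈p⇒∣p-x∣<∣p∣ i∈A)

  fromList : ∀ N → List ℕ → Subset N
  fromList N us = Vec.tabulate λ i → does (toℕ i ∈? us)

  ∈-fromList⁺ : ∀ {N us} (i : Fin N) → toℕ i ∈ us → i Subset.∈ fromList N us
  ∈-fromList⁺ {us = us} i i∈us = Vecₚ.lookup⇒[]= i _ (trans (Vecₚ.lookup∘tabulate _ i) (dec-true (toℕ i ∈? us) i∈us))

  ∈-fromList⁻ : ∀ {N us} (i : Fin N) → i Subset.∈ fromList N us → toℕ i ∈ us
  ∈-fromList⁻ {us = us} i i∈ with toℕ i ∈? us | trans (sym (Vecₚ.lookup∘tabulate (λ i → does (toℕ i ∈? us)) i)) (Vecₚ.[]=⇒lookup i∈)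
  ... | yes i∈us | _ = i∈us
  ... | no  _    | ()

  elements-unique : ∀ {N} (A : Subset N) → Unique (elements A)
  elements-unique {N} A = Uniqueₚ.map⁺ (Finₚ.toℕ-injective ∘ suc-injective) (Uniqueₚ.filter⁺ (Subsetₚ._∈? A) (Uniqueₚ.allFin⁺ N))

  ∈-elements⁻ : ∀ {N} (A : Subset N) {x} → x ∈ elements A → ∃[ i ] i Subset.∈ A × x ≡ suc (toℕ i)
  ∈-elements⁻ {N} A x∈ with ∈-map⁻ _ x∈
  ... | i , i∈ , x≡ = i , proj₂ (∈-filter⁻ (Subsetₚ._∈? A) {xs = allFin N} i∈) , x≡

  -- Sums over tuples, and digits in a base

  sumOf : (X → ℕ) → ∀ {m} → Vec X m → ℕ
  sumOf f xs = Vec.sum (Vec.map f xs)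

  sumOf-cong : ∀ {f g : X → ℕ} → (∀ x → f x ≡ g x) → ∀ {m} (xs : Vec X m) → sumOf f xs ≡ sumOf g xs
  sumOf-cong f≡g xs = cong Vec.sum (Vecₚ.map-cong f≡g xs)

  sumOf-+ : ∀ (f g : X → ℕ) {m} (xs : Vec X m) → sumOf (λ x → f x + g x) xs ≡ sumOf f xs + sumOf g xs
  sumOf-+ f g []       = refl
  sumOf-+ f g (x ∷ xs) = trans (cong (f x + g x +_) (sumOf-+ f g xs)) (interchange (f x) (g x) (sumOf f xs) (sumOf g xs))
    where
    interchange : ∀ a b c d → a + b + (c + d) ≡ a + c + (b + d)
    interchange = solve-∀

  sumOf-*ˡ : ∀ c (f : X → ℕ) {m} (xs : Vec X m) → sumOf (λ x → c * f x) xs ≡ c * sumOf f xs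
  sumOf-*ˡ c f []       = sym (*-zeroʳ c)
  sumOf-*ˡ c f (x ∷ xs) = trans (cong (c * f x +_) (sumOf-*ˡ c f xs)) (sym (*-distribˡ-+ c (f x) (sumOf f xs)))

  sumOf-*ʳ : ∀ c (f : X → ℕ) {m} (xs : Vec X m) → sumOf (λ x → f x * c) xs ≡ sumOf f xs * c
  sumOf-*ʳ c f xs = trans (sumOf-cong (λ x → *-comm (f x) c) xs) (trans (sumOf-*ˡ c f xs) (*-comm c (sumOf f xs)))

  sumOf-const : ∀ {c} {f : X → ℕ} → (∀ x → f x ≡ c) → ∀ {m} (xs : Vec X m) → sumOf f xs ≡ m * c
  sumOf-const f≡c []       = refl
  sumOf-const f≡c (x ∷ xs) = cong₂ _+_ (f≡c x) (sumOf-const f≡c xs)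

  sumOf-< : ∀ {c} {f : X → ℕ} → (∀ x → f x < c) → ∀ {m} (xs : Vec X (suc m)) → sumOf f xs < suc m * c
  sumOf-< f<c (x ∷ [])          = +-monoˡ-< 0 (f<c x)
  sumOf-< f<c (x ∷ xs@(_ ∷ _))  = +-mono-< (f<c x) (sumOf-< f<c xs)

  -- If e < f, then x + B e < B (e + 1) ≤ B f. This is the no-carry principle, used in base B for
  -- vectors and in base L for the blow-up.
  digit-injective : ∀ B {x y e f} → x < B → y < B → x + B * e ≡ y + B * f → x ≡ y × e ≡ f
  digit-injective B {x} {y} {e} {f} x<B y<B eq = +-cancelʳ-≡ (B * e) x y (trans eq (cong (λ g → y + B * g) (sym e≡f))) , e≡f
    where
    lower : ∀ {x y e f} → x < B → x + B * e ≡ y + B * f → ¬ e < f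
    lower {x} {y} {e} {f} x<B eq e<f = <-irrefl eq (begin-strict
      x + B * e     <⟨ +-monoˡ-< (B * e) x<B ⟩
      B + B * e     ≡⟨ *-suc B e ⟨
      B * suc e     ≤⟨ *-monoʳ-≤ B e<f ⟩
      B * f         ≤⟨ m≤n+m (B * f) y ⟩
      y + B * f     ∎)
    e≡f : e ≡ f
    e≡f = ≤-antisym (≮⇒≥ (lower y<B (sym eq))) (≮⇒≥ (lower x<B eq))

  digit-< : ∀ {B M x e} → x < B → e < M → x + B * e < B * M
  digit-< {B} {M} {x} {e} x<B e<M = begin-strict
    x + B * e   <⟨ +-monoˡ-< (B * e) x<B ⟩
    B + B * e   ≡⟨ *-suc B e ⟨
    B * suc e   ≤⟨ *-monoʳ-≤ B e<M ⟩
    B * M       ∎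

  -- The expansion of (a - b)², with the cross term on the right and the absolute difference in the
  -- square, so that it holds in the naturals.
  ∣-∣²-expand : ∀ a b → a * a + b * b ≡ 2 * (a * b) + ∣ a - b ∣ * ∣ a - b ∣
  ∣-∣²-expand a b with ≤-total a b
  ... | inj₁ a≤b = subst (λ b → a * a + b * b ≡ 2 * (a * b) + ∣ a - b ∣ * ∣ a - b ∣) (m+[n∸m]≡n a≤b)
    (trans (expand a (b ∸ a)) (cong (λ d → 2 * (a * (a + (b ∸ a))) + d * d) (sym (∣m-m+n∣≡n a (b ∸ a)))))
    where
    expand : ∀ a k → a * a + (a + k) * (a + k) ≡ 2 * (a * (a + k)) + k * k
    expand = solve-∀
  ... | inj₂ b≤a = subst (λ a → a * a + b * b ≡ 2 * (a * b) + ∣ a - b ∣ * ∣ a - b ∣) (m+[n∸m]≡n b≤a)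
    (trans (expand b (a ∸ b)) (cong (λ d → 2 * ((b + (a ∸ b)) * b) + d * d) (sym (trans (∣-∣-comm (b + (a ∸ b)) b) (∣m-m+n∣≡n b (a ∸ b))))))
    where
    expand : ∀ b k → (b + k) * (b + k) + b * b ≡ 2 * ((b + k) * b) + k * k
    expand = solve-∀

  -- Spheres in a box of digits and their encodings

  module Sphere (d : ℕ) where

    -- Recursion on the length, with `head` and `tail` in place of patterns, lets this unfold at
    -- `v x` for a family v of vectors; `dist²` and `encode` follow suit.
    inner : ∀ {n} → Vec (Fin d) n → Vec (Fin d) n → ℕ
    inner {zero}  v w = 0
    inner {suc n} v w = toℕ (head v) * toℕ (head w) + inner (tail v) (tail w)

    norm² : ∀ {n} → Vec (Fin d) n → ℕ
    norm² v = inner v v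

    dist² : ∀ {n} → Vec (Fin d) n → Vec (Fin d) n → ℕ
    dist² {zero}  v w = 0
    dist² {suc n} v w = ∣ toℕ (head v) - toℕ (head w) ∣ * ∣ toℕ (head v) - toℕ (head w) ∣ + dist² (tail v) (tail w)

    -- The factor n + 1 keeps the bound strict for the empty vector, and so counts the possible
    -- values of the norm.
    norm²-< : 0 < d → ∀ {n} (v : Vec (Fin d) n) → norm² v < suc n * (d * d)
    norm²-< 0<d []      = ≤-trans (*-mono-≤ 0<d 0<d) (m≤m+n (d * d) 0)
    norm²-< 0<d (x ∷ v) = +-mono-≤-< (*-mono-≤ x≤d x≤d) (norm²-< 0<d v)
      where x≤d = <⇒≤ (Finₚ.toℕ<n x)

    dist²-expand : ∀ {n} (v w : Vec (Fin d) n) → norm² v + norm² w ≡ 2 * inner v w + dist² v w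
    dist²-expand []      []      = refl
    dist²-expand (x ∷ v) (y ∷ w) = combine (toℕ x * toℕ x) (norm² v) (toℕ y * toℕ y) (norm² w) (toℕ x * toℕ y) (inner v w)
      (∣ toℕ x - toℕ y ∣ * ∣ toℕ x - toℕ y ∣) (dist² v w) (∣-∣²-expand (toℕ x) (toℕ y)) (dist²-expand v w)
      where
      rearrange₁ : ∀ a b c d → a + b + (c + d) ≡ a + c + (b + d)
      rearrange₁ = solve-∀
      rearrange₂ : ∀ e f g h → 2 * e + g + (2 * f + h) ≡ 2 * (e + f) + (g + h)
      rearrange₂ = solve-∀
      combine : ∀ a b c d e f g h → a + c ≡ 2 * e + g → b + d ≡ 2 * f + h → a + b + (c + d) ≡ 2 * (e + f) + (g + h)
      combine a b c d e f g h p q = trans (rearrange₁ a b c d) (trans (cong₂ _+_ p q) (rearrange₂ e f g h))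

    dist²≡0⇒≡ : ∀ {n} (v w : Vec (Fin d) n) → dist² v w ≡ 0 → v ≡ w
    dist²≡0⇒≡ []      []      _  = refl
    dist²≡0⇒≡ (x ∷ v) (y ∷ w) eq = cong₂ _∷_
      (Finₚ.toℕ-injective (∣m-n∣≡0⇒m≡n ([ (λ h → h) , (λ h → h) ]′ (m*n≡0⇒m≡0∨n≡0 (∣ toℕ x - toℕ y ∣) (m+n≡0⇒m≡0 _ eq)))))
      (dist²≡0⇒≡ v w (m+n≡0⇒n≡0 (∣ toℕ x - toℕ y ∣ * ∣ toℕ x - toℕ y ∣) eq))

    module Encoding (B : ℕ) where

      encode : ∀ {n} → Vec (Fin d) n → ℕ
      encode {zero}  v = 0
      encode {suc n} v = toℕ (head v) + B * encode (tail v)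

      encode-< : d ≤ B → ∀ {n} (v : Vec (Fin d) n) → encode v < B ^ n
      encode-< d≤B []      = s≤s z≤n
      encode-< d≤B (x ∷ v) = digit-< (<-≤-trans (Finₚ.toℕ<n x) d≤B) (encode-< d≤B v)

      encode-injective : d ≤ B → ∀ {n} (v w : Vec (Fin d) n) → encode v ≡ encode w → v ≡ w
      encode-injective d≤B []      []      _  = refl
      encode-injective d≤B (x ∷ v) (y ∷ w) eq with digit-injective B (<-≤-trans (Finₚ.toℕ<n x) d≤B) (<-≤-trans (Finₚ.toℕ<n y) d≤B) eq
      ... | x≡y , v≡w = cong₂ _∷_ (Finₚ.toℕ-injective x≡y) (encode-injective d≤B v w v≡w)

      -- No carries occur, so the equation between the encodings holds digit by digit.
      inner-mean : ∀ {m} → suc m * d ≤ B → ∀ {n} (v : X → Vec (Fin d) n) (xs : Vec X (suc m)) w →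
        sumOf (encode ∘ v) xs ≡ suc m * encode w → sumOf (λ x → inner (v x) w) xs ≡ suc m * norm² w
      inner-mean {m = m} md≤B {zero} v xs w _ = sumOf-const (λ _ → refl) xs
      inner-mean {m = m} md≤B {suc n} v xs w eq with digit-injective B
        (<-≤-trans (sumOf-< (λ x → Finₚ.toℕ<n (head (v x))) xs) md≤B)
        (<-≤-trans (*-monoʳ-< (suc m) (Finₚ.toℕ<n (head w))) md≤B)
        (begin-equality
          sumOf hd xs + B * sumOf (encode ∘ tl) xs           ≡⟨ cong (sumOf hd xs +_) (sumOf-*ˡ B (encode ∘ tl) xs) ⟨
          sumOf hd xs + sumOf (λ x → B * encode (tl x)) xs   ≡⟨ sumOf-+ hd (λ x → B * encode (tl x)) xs ⟨
          sumOf (encode ∘ v) xs                              ≡⟨ eq ⟩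
          suc m * (toℕ (head w) + B * encode (tail w))       ≡⟨ distrib (suc m) (toℕ (head w)) B (encode (tail w)) ⟩
          suc m * toℕ (head w) + B * (suc m * encode (tail w)) ∎)
        where
        hd = λ x → toℕ (head (v x))
        tl = λ x → tail (v x)
        distrib : ∀ m a B e → m * (a + B * e) ≡ m * a + B * (m * e)
        distrib = solve-∀
      ... | heads , tails = begin-equality
        sumOf (λ x → hd x * y + inner (tl x) (tail w)) xs              ≡⟨ sumOf-+ (λ x → hd x * y) (λ x → inner (tl x) (tail w)) xs ⟩
        sumOf (λ x → hd x * y) xs + sumOf (λ x → inner (tl x) (tail w)) xs
                                                                       ≡⟨ cong₂ _+_ (trans (sumOf-*ʳ y hd xs) (cong (_* y) heads)) (inner-mean md≤B tl xs (tail w) tails) ⟩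
        suc m * y * y + suc m * norm² (tail w)                         ≡⟨ factor (suc m) y (norm² (tail w)) ⟩
        suc m * (y * y + norm² (tail w))                               ∎
        where
        y = toℕ (head w)
        hd = λ x → toℕ (head (v x))
        tl = λ x → tail (v x)
        factor : ∀ m y r → m * y * y + m * r ≡ m * (y * y + r)
        factor = solve-∀

      -- Strict convexity: if w is the mean of points of norm R and has norm R itself, then
      -- ∑ |vᵢ - w|² = mR - 2mR + mR = 0.
      mean-on-sphere : ∀ {m} → suc m * d ≤ B → ∀ {n R} (v : X → Vec (Fin d) n) (xs : Vec X (suc m)) w →
        (∀ x → norm² (v x) ≡ R) → norm² w ≡ R →
        sumOf (encode ∘ v) xs ≡ suc m * encode w → sumOf (λ x → dist² (v x) w) xs ≡ 0
      mean-on-sphere {m = m} md≤B {n} {R} v xs w ∣v∣≡R ∣w∣≡R eq = m+n≡m⇒n≡0 (2 * (suc m * R)) (begin-equality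
        2 * (suc m * R) + sumOf δ xs                               ≡⟨ cong (λ r → 2 * (suc m * r) + sumOf δ xs) ∣w∣≡R ⟨
        2 * (suc m * norm² w) + sumOf δ xs                         ≡⟨ cong (λ s → 2 * s + sumOf δ xs) (inner-mean md≤B v xs w eq) ⟨
        2 * sumOf ι xs + sumOf δ xs                                ≡⟨ cong (_+ sumOf δ xs) (sumOf-*ˡ 2 ι xs) ⟨
        sumOf (λ x → 2 * ι x) xs + sumOf δ xs                      ≡⟨ sumOf-+ (λ x → 2 * ι x) δ xs ⟨
        sumOf (λ x → 2 * ι x + δ x) xs                             ≡⟨ sumOf-cong (λ x → dist²-expand (v x) w) xs ⟨
        sumOf (λ x → norm² (v x) + norm² w) xs                     ≡⟨ sumOf-const (λ x → cong₂ _+_ (∣v∣≡R x) ∣w∣≡R) xs ⟩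
        suc m * (R + R)                                            ≡⟨ double (suc m) R ⟩
        2 * (suc m * R)                                            ∎)
        where
        ι = λ x → inner (v x) w
        δ = λ x → dist² (v x) w
        double : ∀ m R → m * (R + R) ≡ 2 * (m * R)
        double = solve-∀
        m+n≡m⇒n≡0 : ∀ a {b} → a + b ≡ a → b ≡ 0
        m+n≡m⇒n≡0 a {b} a+b≡a = +-cancelˡ-≡ a b 0 (trans a+b≡a (sym (+-identityʳ a)))

      -- A vanishing sum of naturals has vanishing terms, so every vector equals w; the labels `r x`
      -- remain free.
      map-collapse : ∀ {n} (f : Vec (Fin d) n → Y → Z) (v : X → Vec (Fin d) n) (r : X → Y) w {m} (xs : Vec X m) →
        sumOf (λ x → dist² (v x) w) xs ≡ 0 → Vec.map (λ x → f (v x) (r x)) xs ≡ Vec.map (f w) (Vec.map r xs)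
      map-collapse f v r w []       _  = refl
      map-collapse f v r w (x ∷ xs) eq = cong₂ _∷_
        (cong (λ u → f u (r x)) (dist²≡0⇒≡ (v x) w (m+n≡0⇒m≡0 _ eq)))
        (map-collapse f v r w xs (m+n≡0⇒n≡0 (dist² (v x) w) eq))

  -- The blown-up sphere for k = m + 2, and its solutions

  module _ (m n d ℓ c : ℕ) (m<c : m < c) (0<d : 0 < d) where
    private
      B = c * d
      L = c * ℓ
      open Sphere d
      open Encoding B

      scaled-≤ : ∀ e → suc m * e ≤ c * e
      scaled-≤ e = *-monoˡ-≤ e m<c

      e≤c*e : ∀ e → e ≤ c * e
      e≤c*e e = ≤-trans (m≤n*m e (suc m)) (scaled-≤ e)

      vectors : List (Vec (Fin d) n)
      vectors = words (allFin d) n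

      length-vectors : length vectors ≡ d ^ n
      length-vectors = trans (length-words (allFin d) n) (cong (_^ n) (Listₚ.length-tabulate {n = d} (λ i → i)))

      R = proj₁ (largest-fibre norm² (suc n * (d * d)) vectors (norm²-< 0<d))

      sphere : List (Vec (Fin d) n)
      sphere = fibre norm² R vectors

      d^n≤ : d ^ n ≤ suc n * (d * d) * length sphere
      d^n≤ = subst (_≤ suc n * (d * d) * length sphere) length-vectors
        (proj₂ (largest-fibre norm² (suc n * (d * d)) vectors (norm²-< 0<d)))

      -- The blow-up adds a lowest digit r < ℓ in base L = c ℓ. As m + 1 ≤ c, sums of m + 1 such
      -- digits do not carry either.
      code : Vec (Fin d) n → Fin ℓ → ℕ
      code v r = toℕ r + L * encode v

      code-< : ∀ v r → code v r < L * B ^ n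
      code-< v r = digit-< (<-≤-trans (Finₚ.toℕ<n r) (e≤c*e ℓ)) (encode-< (e≤c*e d) v)

      code-injective : ∀ {v w r s} → code v r ≡ code w s → v ≡ w × r ≡ s
      code-injective {v} {w} {r} {s} eq with digit-injective L (<-≤-trans (Finₚ.toℕ<n r) (e≤c*e ℓ)) (<-≤-trans (Finₚ.toℕ<n s) (e≤c*e ℓ)) eq
      ... | r≡s , v≡w = encode-injective (e≤c*e d) v w v≡w , Finₚ.toℕ-injective r≡s

      codes : List ℕ
      codes = cartesianProductWith code sphere (allFin ℓ)

      codes-unique : Unique codes
      codes-unique = Uniqueₚ.cartesianProductWith⁺ code code-injective
        (Uniqueₚ.filter⁺ (λ v → norm² v ≟ R) (words-unique n (Uniqueₚ.allFin⁺ d))) (Uniqueₚ.allFin⁺ ℓ)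

      length-codes : length codes ≡ length sphere * ℓ
      length-codes = trans (length-cartesianProductWith code sphere (allFin ℓ)) (cong (length sphere *_) (Listₚ.length-tabulate {n = ℓ} (λ i → i)))

      A : Subset (L * B ^ n)
      A = fromList (L * B ^ n) codes

      A-large : d ^ n * ℓ ≤ suc n * (d * d) * ∣ A ∣
      A-large = begin
        d ^ n * ℓ                                    ≤⟨ *-monoˡ-≤ ℓ d^n≤ ⟩
        suc n * (d * d) * length sphere * ℓ          ≡⟨ *-assoc (suc n * (d * d)) (length sphere) ℓ ⟩
        suc n * (d * d) * (length sphere * ℓ)        ≡⟨ cong (suc n * (d * d) *_) length-codes ⟨
        suc n * (d * d) * length codes               ≤⟨ *-monoʳ-≤ (suc n * (d * d)) (unique⇒length-≤∣A∣ A codes-unique member) ⟩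
        suc n * (d * d) * ∣ A ∣                      ∎
        where
        member : ∀ {u} → u ∈ codes → ∃[ i ] toℕ i ≡ u × i Subset.∈ A
        member {u} u∈ with ∈-cartesianProductWith⁻ code sphere (allFin ℓ) u∈
        ... | v , r , _ , _ , u≡ = fromℕ< u<N , Finₚ.toℕ-fromℕ< u<N , ∈-fromList⁺ (fromℕ< u<N) (subst (_∈ codes) (sym (Finₚ.toℕ-fromℕ< u<N)) u∈)
          where
          u<N : u < L * B ^ n
          u<N = subst (_< L * B ^ n) (sym u≡) (code-< v r)

      -- The sphere condition is part of the type, so that `mean-on-sphere` applies to every tuple
      -- of points.
      Point = (Σ[ v ∈ Vec (Fin d) n ] norm² v ≡ R) × Fin ℓ

      vec : Point → Vec (Fin d) n
      vec p = proj₁ (proj₁ p)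

      low : Point → Fin ℓ
      low = proj₂

      element : Point → ℕ
      element p = suc (code (vec p) (low p))

      ∈-elements-A⁻ : ∀ {x} → x ∈ elements A → ∃[ p ] x ≡ element p
      ∈-elements-A⁻ x∈ with ∈-elements⁻ A x∈
      ... | i , i∈A , refl with ∈-cartesianProductWith⁻ code sphere (allFin ℓ) (∈-fromList⁻ i i∈A)
      ... | v , r , v∈ , _ , i≡ = ((v , proj₂ (∈-filter⁻ (λ v → norm² v ≟ R) {xs = vectors} v∈)) , r) , cong suc i≡

      points : ∀ {k} {xs : Vec ℕ k} → VecAll (_∈ elements A) xs → ∃[ ps ] xs ≡ Vec.map element ps
      points []        = [] , refl
      points (x∈ ∷ xs∈) with ∈-elements-A⁻ x∈ | points xs∈
      ... | p , refl | ps , refl = p ∷ ps , refl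

      -- Once all vector parts equal w, the low parts on the left determine the solution: the
      -- equation makes the last low part their mean. The division is exact on solutions, and other
      -- tuples only enlarge the count.
      trivial : Vec (Fin d) n → Vec (Fin ℓ) (suc m) → Vec ℕ (suc m) × ℕ
      trivial w rs = Vec.map (λ r → suc (code w r)) rs , suc (sumOf toℕ rs / suc m + L * encode w)

      sumOf-suc : ∀ (f : Point → ℕ) {k} (ps : Vec Point k) → sumOf (λ p → suc (f p)) ps ≡ k + sumOf f ps
      sumOf-suc f ps = trans (sumOf-+ (λ _ → 1) f ps) (cong (_+ sumOf f ps) (trans (sumOf-const {c = 1} (λ _ → refl) ps) (*-identityʳ _)))

      solution-trivial : ∀ ps p → sumOf element ps ≡ suc m * element p →
        (Vec.map element ps , element p) ≡ trivial (vec p) (Vec.map low ps)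
      solution-trivial ps p eq = cong₂ _,_
        (map-collapse (λ v r → suc (code v r)) vec low w ps
          (mean-on-sphere (scaled-≤ d) vec ps w (λ p → proj₂ (proj₁ p)) (proj₂ (proj₁ p)) (proj₂ digits)))
        (cong (λ r → suc (r + L * encode w)) (sym (begin-equality
          sumOf toℕ (Vec.map low ps) / suc m    ≡⟨ cong (λ xs → Vec.sum xs / suc m) (Vecₚ.map-∘ toℕ low ps) ⟨
          sumOf lo ps / suc m                   ≡⟨ cong (_/ suc m) (trans (proj₁ digits) (*-comm (suc m) (lo p))) ⟩
          lo p * suc m / suc m                  ≡⟨ m*n/n≡m (lo p) (suc m) ⟩
          lo p                                  ∎)))
        where
        w = vec p
        lo = toℕ ∘ low
        -- Elements are codes shifted by 1, and the shift adds m + 1 to both sides of the equation.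
        codes-eq : sumOf (λ p → code (vec p) (low p)) ps ≡ suc m * code w (low p)
        codes-eq = +-cancelˡ-≡ (suc m) _ _ (trans (sym (sumOf-suc (λ p → code (vec p) (low p)) ps)) (trans eq (*-suc (suc m) (code w (low p)))))
        distrib : ∀ k a L e → k * (a + L * e) ≡ k * a + L * (k * e)
        distrib = solve-∀
        digits : sumOf lo ps ≡ suc m * lo p × sumOf (encode ∘ vec) ps ≡ suc m * encode w
        digits = digit-injective L
          (<-≤-trans (sumOf-< (λ p → Finₚ.toℕ<n (low p)) ps) (scaled-≤ ℓ))
          (<-≤-trans (*-monoʳ-< (suc m) (Finₚ.toℕ<n (low p))) (scaled-≤ ℓ))
          (begin-equality
            sumOf lo ps + L * sumOf (encode ∘ vec) ps              ≡⟨ cong (sumOf lo ps +_) (sumOf-*ˡ L (encode ∘ vec) ps) ⟨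
            sumOf lo ps + sumOf (λ p → L * encode (vec p)) ps      ≡⟨ sumOf-+ lo (λ p → L * encode (vec p)) ps ⟨
            sumOf (λ p → code (vec p) (low p)) ps                  ≡⟨ codes-eq ⟩
            suc m * code w (low p)                                 ≡⟨ distrib (suc m) (lo p) L (encode w) ⟩
            suc m * lo p + L * (suc m * encode w)                  ∎)

      isSolution? : ∀ (s : Vec ℕ (suc m) × ℕ) → Dec (Vec.sum (proj₁ s) ≡ suc m * proj₂ s)
      isSolution? (xs , y) = Vec.sum xs ≟ suc m * y

      candidates : List (Vec ℕ (suc m) × ℕ)
      candidates = cartesianProduct (tuples (elements A) (suc m)) (elements A)

      solutions-unique : Unique (solutions (2 + m) A)
      solutions-unique = Uniqueₚ.filter⁺ isSolution? (Uniqueₚ.cartesianProduct⁺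
        (subst Unique (sym (tuples≡words (elements A) (suc m))) (words-unique (suc m) (elements-unique A))) (elements-unique A))

      -- Letting w range over all vectors of the box overcounts the sphere, but d^n is small enough
      -- for `solution-count`.
      trivials : List (Vec ℕ (suc m) × ℕ)
      trivials = cartesianProductWith trivial vectors (words (allFin ℓ) (suc m))

      length-trivials : length trivials ≡ d ^ n * ℓ ^ suc m
      length-trivials = trans (length-cartesianProductWith trivial vectors (words (allFin ℓ) (suc m)))
        (cong₂ _*_ length-vectors (trans (length-words (allFin ℓ) (suc m)) (cong (_^ suc m) (Listₚ.length-tabulate {n = ℓ} (λ i → i)))))

      solutions⊆trivials : ∀ {s} → s ∈ solutions (2 + m) A → s ∈ trivials
      solutions⊆trivials {xs , y} s∈ with ∈-filter⁻ isSolution? {xs = candidates} s∈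
      ... | s∈′ , eq with ∈-cartesianProduct⁻ (tuples (elements A) (suc m)) (elements A) s∈′
      ... | xs∈ , y∈ with points (∈-words⁻ (elements A) (subst (xs ∈_) (tuples≡words (elements A) (suc m)) xs∈)) | ∈-elements-A⁻ y∈
      ... | ps , refl | p , refl = subst (_∈ trivials) (sym (solution-trivial ps p eq))
        (∈-cartesianProductWith⁺ trivial (∈-words⁺ ∈-allFin (vec p)) (∈-words⁺ ∈-allFin (Vec.map low ps)))

    few-solutions : ∃[ A ] d ^ n * ℓ ≤ suc n * (d * d) * ∣ A ∣ × length (solutions (2 + m) {c * ℓ * (c * d) ^ n} A) ≤ d ^ n * ℓ ^ suc m
    few-solutions = A , A-large , ≤-trans (unique-⊆⇒length-≤ solutions-unique solutions⊆trivials) (≤-reflexive length-trivials)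

-- Inequalities between the parameters

module Parameters where
  open ℕ
  open ℕₚ
  open ≤-Reasoning

  n<2^n : ∀ n → n < 2 ^ n
  n<2^n zero    = s≤s z≤n
  n<2^n (suc n) = begin-strict
    suc n                  <⟨ s≤s (n<2^n n) ⟩
    suc (2 ^ n)            ≤⟨ +-monoˡ-≤ (2 ^ n) (m^n>0 2 n) ⟩
    2 ^ n + 2 ^ n          ≡⟨ cong (2 ^ n +_) (+-identityʳ (2 ^ n)) ⟨
    2 ^ suc n              ∎

  ^-distribʳ-* : ∀ a b n → (a * b) ^ n ≡ a ^ n * b ^ n
  ^-distribʳ-* a b zero    = refl
  ^-distribʳ-* a b (suc n) = trans (cong (a * b *_) (^-distribʳ-* a b n)) (swap a b (a ^ n) (b ^ n))
    where
    swap : ∀ a b c d → a * b * (c * d) ≡ a * c * (b * d)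
    swap = solve-∀

  module _ {s n} (2≤s : 2 ≤ s) (1≤n : 1 ≤ n) where
    private
      c = 2 ^ s
      d = 2 ^ (2 * s * n)

    -- The left side bounds log²(2/α) when α ≥ 2^{-7s(n+1)}, and 1024 = 1/c.
    log-budget : let b = 2 * (3 + 7 * s * suc n) in b * b ≤ 1024 * (s * n * (s * n))
    log-budget = ≤-trans (*-mono-≤ b≤ b≤) (≤-reflexive (square (s * n)))
      where
      square : ∀ x → 32 * x * (32 * x) ≡ 1024 * (x * x)
      square = solve-∀
      expand : ∀ s n → 3 + 7 * s * suc n ≡ 7 * (s * n) + (3 + 7 * s)
      expand = solve-∀
      b≤ : 2 * (3 + 7 * s * suc n) ≤ 32 * (s * n)
      b≤ = begin
        2 * (3 + 7 * s * suc n)              ≡⟨ cong (2 *_) (expand s n) ⟩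
        -- Here 3 ≤ 2s because s ≥ 2, that is k ≥ 4; next, s ≤ sn.
        2 * (7 * (s * n) + (3 + 7 * s))      ≤⟨ *-monoʳ-≤ 2 (+-monoʳ-≤ (7 * (s * n)) (+-monoˡ-≤ (7 * s) (≤-trans (n≤1+n 3) (*-monoʳ-≤ 2 2≤s)))) ⟩
        2 * (7 * (s * n) + (2 * s + 7 * s))  ≡⟨ cong (λ x → 2 * (7 * (s * n) + x)) (*-distribʳ-+ s 2 7) ⟨
        2 * (7 * (s * n) + 9 * s)            ≤⟨ *-monoʳ-≤ 2 (+-monoʳ-≤ (7 * (s * n)) (*-monoʳ-≤ 9 (m≤m*n s n {{>-nonZero 1≤n}}))) ⟩
        2 * (7 * (s * n) + 9 * (s * n))      ≡⟨ collect (s * n) ⟩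
        32 * (s * n)                         ∎
        where
        collect : ∀ x → 2 * (7 * x + 9 * x) ≡ 32 * x
        collect = solve-∀

    private
      1+s+n≤2sn : 1 + s + n ≤ 2 * s * n
      1+s+n≤2sn = subst₂ (λ s n → 1 + s + n ≤ 2 * s * n) (m+[n∸m]≡n 2≤s) (m+[n∸m]≡n 1≤n) (begin
        1 + (2 + a) + (1 + b)                                        ≤⟨ m≤m+n _ (a + 3 * b + 2 * a * b) ⟩
        1 + (2 + a) + (1 + b) + (a + 3 * b + 2 * a * b)              ≡⟨ expand a b ⟩
        2 * (2 + a) * (1 + b)                                        ∎)
        where
        a = s ∸ 2
        b = n ∸ 1
        expand : ∀ a b → 1 + (2 + a) + (1 + b) + (a + 3 * b + 2 * a * b) ≡ 2 * (2 + a) * (1 + b)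
        expand = solve-∀

    -- The origin of the 7: the blow-up costs 2^s, the base 2^(sn), and the choice of a sphere (n +
    -- 1) d² ≤ 2^(n + 4sn). Together with the factor 2 on the left, the slack of `between-powers`,
    -- the exponent is 1 + s + n + 5sn, and 1 + s + n ≤ 2sn.
    density : ∀ {ℓ a} → d ^ n * ℓ ≤ suc n * (d * d) * a → 2 * (c * ℓ * (c * d) ^ n) ≤ 2 ^ (7 * s * n) * a
    density {ℓ} {a} large = begin
      2 * (c * ℓ * (c * d) ^ n)                        ≡⟨ cong (λ x → 2 * (c * ℓ * x)) (^-distribʳ-* c d n) ⟩
      2 * (c * ℓ * (c ^ n * d ^ n))                    ≡⟨ rearrange₁ c ℓ (c ^ n) (d ^ n) ⟩
      2 * (c * c ^ n) * (d ^ n * ℓ)                    ≤⟨ *-monoʳ-≤ (2 * (c * c ^ n)) (≤-trans large (*-monoˡ-≤ a (*-monoˡ-≤ (d * d) (n<2^n n)))) ⟩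
      2 * (c * c ^ n) * (2 ^ n * (d * d) * a)          ≡⟨ rearrange₂ c (c ^ n) (2 ^ n) d a ⟩
      2 * c * 2 ^ n * (c ^ n * d * d) * a              ≡⟨ cong (_* a) powers ⟩
      2 ^ (1 + s + n + 5 * s * n) * a                  ≤⟨ *-monoˡ-≤ a (^-monoʳ-≤ 2 exponent) ⟩
      2 ^ (7 * s * n) * a                              ∎
      where
      rearrange₁ : ∀ c ℓ x y → 2 * (c * ℓ * (x * y)) ≡ 2 * (c * x) * (y * ℓ)
      rearrange₁ = solve-∀
      rearrange₂ : ∀ c x y d a → 2 * (c * x) * (y * (d * d) * a) ≡ 2 * c * y * (x * d * d) * a
      rearrange₂ = solve-∀
      sum-of-exponents : ∀ s n → s * n + 2 * s * n + 2 * s * n ≡ 5 * s * n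
      sum-of-exponents = solve-∀
      powers : 2 * c * 2 ^ n * (c ^ n * d * d) ≡ 2 ^ (1 + s + n + 5 * s * n)
      powers = begin-equality
        2 * c * 2 ^ n * (c ^ n * d * d)                ≡⟨ cong (λ x → 2 * c * 2 ^ n * (x * d * d)) (^-*-assoc 2 s n) ⟩
        2 * c * 2 ^ n * (2 ^ (s * n) * d * d)          ≡⟨ cong (λ x → 2 * c * 2 ^ n * (x * d)) (^-distribˡ-+-* 2 (s * n) (2 * s * n)) ⟨
        2 * c * 2 ^ n * (2 ^ (s * n + 2 * s * n) * d)  ≡⟨ cong (2 * c * 2 ^ n *_) (^-distribˡ-+-* 2 (s * n + 2 * s * n) (2 * s * n)) ⟨
        2 * c * 2 ^ n * 2 ^ (s * n + 2 * s * n + 2 * s * n) ≡⟨ cong₂ (λ x y → x * 2 ^ y) (sym (^-distribˡ-+-* 2 (1 + s) n)) (sum-of-exponents s n) ⟩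
        2 ^ (1 + s + n) * 2 ^ (5 * s * n)              ≡⟨ ^-distribˡ-+-* 2 (1 + s + n) (5 * s * n) ⟨
        2 ^ (1 + s + n + 5 * s * n)                    ∎
      exponent : 1 + s + n + 5 * s * n ≤ 7 * s * n
      exponent = ≤-trans (+-monoˡ-≤ (5 * s * n) 1+s+n≤2sn) (≤-reflexive (collect s n))
        where
        collect : ∀ s n → 2 * s * n + 5 * s * n ≡ 7 * s * n
        collect = solve-∀

    -- By the choice of d, (d^n)^s equals 4^((sn)²), the bound on the exponential. The factor 2
    -- answers the ½ in the lower bound for `exp` and is absorbed by one of the s + 1 factors c.
    solution-count : ∀ ℓ → 2 * 4 ^ (s * n * (s * n)) * (d ^ n * ℓ ^ suc s) ≤ (c * ℓ * (c * d) ^ n) ^ suc s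
    solution-count ℓ = begin
      2 * 4 ^ (s * n * (s * n)) * (d ^ n * ℓ ^ suc s)     ≡⟨ cong (λ x → 2 * x * (d ^ n * ℓ ^ suc s)) 4^≡ ⟩
      2 * (d ^ n) ^ s * (d ^ n * ℓ ^ suc s)               ≡⟨ rearrange ((d ^ n) ^ s) (d ^ n) (ℓ ^ suc s) ⟩
      2 * d ^ n * (d ^ n) ^ s * ℓ ^ suc s                 ≤⟨ *-monoˡ-≤ (ℓ ^ suc s) (*-mono-≤ (*-mono-≤ 2≤c d^n≤) (^-monoˡ-≤ s (≤-trans d^n≤ (m≤n*m X c {{>-nonZero (≤-trans (n≤1+n 1) 2≤c)}})))) ⟩
      (c * X) ^ suc s * ℓ ^ suc s                         ≡⟨ ^-distribʳ-* (c * X) ℓ (suc s) ⟨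
      (c * X * ℓ) ^ suc s                                 ≡⟨ cong (_^ suc s) (swap c X ℓ) ⟩
      (c * ℓ * X) ^ suc s                                 ∎
      where
      X = (c * d) ^ n
      2≤c : 2 ≤ c
      2≤c = ≤-trans 2≤s (<⇒≤ (n<2^n s))
      d^n≤ : d ^ n ≤ X
      d^n≤ = ^-monoˡ-≤ n (m≤n*m d c {{>-nonZero (≤-trans (n≤1+n 1) 2≤c)}})
      rearrange : ∀ x y z → 2 * x * (y * z) ≡ 2 * y * x * z
      rearrange = solve-∀
      swap : ∀ c x ℓ → c * x * ℓ ≡ c * ℓ * x
      swap = solve-∀
      exponents : ∀ s n → 2 * (s * n * (s * n)) ≡ 2 * s * n * n * s
      exponents = solve-∀
      4^≡ : 4 ^ (s * n * (s * n)) ≡ (d ^ n) ^ s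
      4^≡ = begin-equality
        4 ^ (s * n * (s * n))          ≡⟨ ^-*-assoc 2 2 (s * n * (s * n)) ⟩
        2 ^ (2 * (s * n * (s * n)))    ≡⟨ cong (2 ^_) (exponents s n) ⟩
        2 ^ (2 * s * n * n * s)        ≡⟨ ^-*-assoc 2 (2 * s * n * n) s ⟨
        (2 ^ (2 * s * n * n)) ^ s      ≡⟨ cong (_^ s) (^-*-assoc 2 (2 * s * n) n) ⟨
        (d ^ n) ^ s                    ∎

-- From inequalities between naturals to rational ones

module Scaling where
  open ℚ using (_+_; _*_; _≤_; _<_)
  open ℚₚ
  open RawSemiring ℚ.+-*-rawSemiring using (_^_)
  open Defs using (fromℕ; fromℚ; 0ℝ)
  open Defs.Rational
  open Series
  open +-*-Solver using (solve; _:*_; con; _:=_)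
  open ≤-Reasoning

  fromℚ-pos : ∀ {q} → 0ℚ < q → 0ℝ Defs.< fromℚ q
  fromℚ-pos {q} 0<q = q , 0<q , 0 , λ _ _ → ≤-reflexive (+-identityˡ q)

  2½^≤1 : ∀ {n} → 1 ℕ.≤ n → fromℕ 2 * ½ ^ n ≤ 1ℚ
  2½^≤1 {n} 1≤n = *-monoˡ (0≤fromℕ 2) (^-decr (<⇒≤ 0<½) ½<1 1≤n)

  density-ℚ : ∀ {x} e {N a} → x ≤ fromℕ 2 * ½ ^ e → 2 ℕ.* N ℕ.≤ 2 ℕ.^ e ℕ.* a → x * fromℕ N ≤ fromℕ a
  density-ℚ {x} e {N} {a} x≤ 2N≤ = begin
    x * fromℕ N                            ≤⟨ *-monoʳ (0≤fromℕ N) x≤ ⟩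
    fromℕ 2 * ½ ^ e * fromℕ N              ≡⟨ solve 3 (λ t h n → t :* h :* n := h :* (t :* n)) refl (fromℕ 2) (½ ^ e) (fromℕ N) ⟩
    ½ ^ e * (fromℕ 2 * fromℕ N)            ≡⟨ cong (½ ^ e *_) (fromℕ-* 2 N) ⟨
    ½ ^ e * fromℕ (2 ℕ.* N)                ≤⟨ *-monoˡ (<⇒≤ (0<½^ e)) (fromℕ-mono 2N≤) ⟩
    ½ ^ e * fromℕ (2 ℕ.^ e ℕ.* a)          ≡⟨ cong (½ ^ e *_) (fromℕ-* (2 ℕ.^ e) a) ⟩
    ½ ^ e * (fromℕ (2 ℕ.^ e) * fromℕ a)    ≡⟨ solve 3 (λ h t a → h :* (t :* a) := t :* h :* a) refl (½ ^ e) (fromℕ (2 ℕ.^ e)) (fromℕ a) ⟩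
    fromℕ (2 ℕ.^ e) * ½ ^ e * fromℕ a      ≡⟨ cong (_* fromℕ a) (2^*½^ e) ⟩
    1ℚ * fromℕ a                           ≡⟨ *-identityˡ (fromℕ a) ⟩
    fromℕ a                                ∎

  count-ℚ : ∀ {x} T {a M} → ½ * ¼ ^ T ≤ x → 2 ℕ.* 4 ℕ.^ T ℕ.* a ℕ.≤ M → fromℕ a ≤ x * fromℕ M
  count-ℚ {x} T {a} {M} ≤x 2·4^T·a≤M = begin
    fromℕ a                                              ≡⟨ *-identityˡ (fromℕ a) ⟨
    1ℚ * fromℕ a                                         ≡⟨ cong (_* fromℕ a) (¼^*4^ T) ⟨
    q * fromℕ 4 ^ T * fromℕ a                            ≡⟨ solve 3 (λ q f a → q :* f :* a := con ½ :* q :* (con (fromℕ 2) :* f :* a)) refl q (fromℕ 4 ^ T) (fromℕ a) ⟩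
    ½ * q * (fromℕ 2 * fromℕ 4 ^ T * fromℕ a)            ≡⟨ cong (λ y → ½ * q * (fromℕ 2 * y * fromℕ a)) (fromℕ-^ 4 T) ⟨
    ½ * q * (fromℕ 2 * fromℕ (4 ℕ.^ T) * fromℕ a)        ≡⟨ cong (λ y → ½ * q * (y * fromℕ a)) (fromℕ-* 2 (4 ℕ.^ T)) ⟨
    ½ * q * (fromℕ (2 ℕ.* 4 ℕ.^ T) * fromℕ a)            ≡⟨ cong (½ * q *_) (fromℕ-* (2 ℕ.* 4 ℕ.^ T) a) ⟨
    ½ * q * fromℕ (2 ℕ.* 4 ℕ.^ T ℕ.* a)                  ≤⟨ *-monoˡ (0≤* (<⇒≤ 0<½) (0≤^ T (<⇒≤ 0<¼))) (fromℕ-mono 2·4^T·a≤M) ⟩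
    ½ * q * fromℕ M                                      ≤⟨ *-monoʳ (0≤fromℕ M) ≤x ⟩
    x * fromℕ M                                          ∎
    where q = ¼ ^ T

open import Defs
open import Data.Nat.Base using (ℕ; _∸_; _^_; _≥_; _>_)
open import Data.Fin.Subset using (Subset; ∣_∣)
open import Data.List.Base using (length)
open RawSemiring ℚ.+-*-rawSemiring using () renaming (_^_ to _^ℚ_)
open Behrend using (few-solutions)
open Bounds
open Parameters
open Scaling
open Series using (0<½^)

-- Assembly for a given α and N₀

private
  SparseSet : ℝ → ℕ → ℝ⁺ → ℕ → Set
  SparseSet c k α N₀ = Σ[ N ∈ ℕ ] N > N₀ × (Σ[ A ∈ Subset N ]
    val α * natℝ N ≤ natℝ ∣ A ∣ ×
    natℝ (length (solutions k A))
      ≤ exp (- (c * (log (2⁺ /⁺ α) * log (2⁺ /⁺ α)))) * natℝ (N ^ (k ∸ 1)))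

  module _ {s} (2≤s : 2 ℕ.≤ s) (α : ℝ⁺) (N₀ : ℕ) {n} (1≤n : 1 ℕ.≤ n)
           (α≤ : Eventually λ j → seq (val α) j ℚ.≤ fromℕ 2 ℚ.* ½ ^ℚ (7 ℕ.* s ℕ.* n))
           (≤α : Eventually λ j → ½ ^ℚ (7 ℕ.* s ℕ.* suc n) ℚ.≤ seq (val α) j) where
    c = 2 ^ s
    d = 2 ^ (2 ℕ.* s ℕ.* n)
    -- The blow-up length ℓ is N₀ + 1, which alone forces N > N₀.
    N = c ℕ.* suc N₀ ℕ.* (c ℕ.* d) ^ n
    T = s ℕ.* n ℕ.* (s ℕ.* n)

    α≤1 : Eventually λ j → seq (val α) j ℚ.≤ 1ℚ
    α≤1 = eventually-map (λ _ x≤ → ℚₚ.≤-trans x≤ (2½^≤1 1≤7sn)) α≤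
      where
      1≤7sn : 1 ℕ.≤ 7 ℕ.* s ℕ.* n
      1≤7sn = ℕₚ.*-mono-≤ (ℕₚ.≤-trans (ℕₚ.≤-trans (ℕₚ.n≤1+n 1) 2≤s) (ℕₚ.m≤n*m s 7)) 1≤n

    N>N₀ : N > N₀
    N>N₀ = ℕₚ.≤-trans (ℕₚ.m≤n*m (suc N₀) c {{ℕₚ.m^n≢0 2 s}})
      (ℕₚ.m≤m*n (c ℕ.* suc N₀) ((c ℕ.* d) ^ n)
        {{ℕₚ.m^n≢0 (c ℕ.* d) n {{ℕₚ.m*n≢0 c d {{ℕₚ.m^n≢0 2 s}} {{ℕₚ.m^n≢0 2 (2 ℕ.* s ℕ.* n)}}}}}})

    sparseSet : SparseSet (fromℚ (½ ^ℚ 10)) (2 ℕ.+ s) α N₀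
    sparseSet = N , N>N₀ , A ,
      eventually-≤ {val α * natℝ N} {natℝ ∣ A ∣}
        (eventually-map (λ _ x≤ → density-ℚ (7 ℕ.* s ℕ.* n) {N} {∣ A ∣} x≤ (density 2≤s 1≤n {suc N₀} {∣ A ∣} (proj₁ (proj₂ few)))) α≤) ,
      eventually-≤ {natℝ (length (solutions (2 ℕ.+ s) A))} {exp (- (fromℚ (½ ^ℚ 10) * (log (2⁺ /⁺ α) * log (2⁺ /⁺ α)))) * natℝ (N ^ suc s)}
        (eventually-map
          (λ _ ≤x → count-ℚ T {length (solutions (2 ℕ.+ s) A)} {N ^ suc s} ≤x
            (ℕₚ.≤-trans (ℕₚ.*-monoʳ-≤ (2 ℕ.* 4 ^ T) (proj₂ (proj₂ few))) (solution-count 2≤s 1≤n (suc N₀))))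
          (exp-log²-eventually {α} {7 ℕ.* s ℕ.* suc n} {T} (½ ^ℚ 10) {1024} (ℚₚ.<⇒≤ (0<½^ 10)) refl α≤1 ≤α (log-budget 2≤s 1≤n)))
      where
      few = few-solutions s n d (suc N₀) c (n<2^n s) (ℕₚ.m^n>0 2 (2 ℕ.* s ℕ.* n))
      A = proj₁ few

  sparseSets : ∀ k → k ≥ 4 → ∃[ α₀ ] 0ℝ < α₀ × (∀ α → val α ≤ α₀ → ∀ N₀ → SparseSet (fromℚ (½ ^ℚ 10)) k α N₀)
  sparseSets (suc (suc s)) (ℕ.s≤s (ℕ.s≤s 2≤s)) =
    -- The threshold is the scale n = 1, where the search for n starts.
    fromℚ (½ ^ℚ (7 ℕ.* s ℕ.* 1)) , fromℚ-pos (0<½^ (7 ℕ.* s ℕ.* 1)) , λ α α≤α₀ N₀ →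
    let n , 1≤n , α≤ , ≤α = between-powers α (7 ℕ.* s) (ℕₚ.≤-trans (ℕₚ.≤-trans (ℕₚ.n≤1+n 1) 2≤s) (ℕₚ.m≤n*m s 7)) α≤α₀
    in sparseSet 2≤s α N₀ 1≤n α≤ ≤α

theorem4 : ∃[ c ] 0ℝ < c ×
    (∀ (k : ℕ) → k ≥ 4 →
    ∃[ α₀ ] 0ℝ < α₀ ×
    (∀ (α : ℝ⁺) → val α ≤ α₀ →
    ∀ (N₀ : ℕ) → Σ[ N ∈ ℕ ] N > N₀ × (Σ[ A ∈ Subset N ]
    val α * natℝ N ≤ natℝ ∣ A ∣ ×
    natℝ (length (solutions k A))
    ≤ exp (- (c * (log (2⁺ /⁺ α) * log (2⁺ /⁺ α)))) * natℝ (N ^ (k ∸ 1)))))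
-- 2^(-10) is the reciprocal of the 1024 in `log-budget`.
theorem4 = fromℚ (½ ^ℚ 10) , fromℚ-pos (0<½^ 10) , sparseSets
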